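{- Let $m,n,r,s,\lambda$ be positive integers with $n>m>3$. An $r$-factorization of $\lambda K_m^3$ can be embedded into a connected $s$-factorization of $\lambda K_n^3$ if and only if (i) $(m,r,\lambda)$ and $(n,s,\lambda)$ are $3$-admissible; (ii) $1<s/r\le\binom{n-1}{2}/\binom{m-1}{2}$; (iii) if $r\binom{n-1}{2}>s\binom{m-1}{2}$, then $n\ge 3m/2$; (iv) $(n-m)\binom m2\ge\big(m-\frac n3\big)\Big[\binom{n-1}{2}-\frac sr\binom{m-1}{2}\Big]$.
   Context: $\lambda K_n^h$: $n$ vertices, every $h$-subset an edge of multiplicity $\lambda$; $\lambda K_m^h$ is its sub-hypergraph induced on a fixed set of $m$ vertices. An $r$-factor is a spanning sub-hypergraph in which every vertex has degree $r$; an $r$-factorization is a partition of the edges into $r$-factors. An $r$-factorization of $\lambda K_m^h$ embeds into a connected $s$-factorization of $\lambda K_n^h$ if there is a partition of the edges of $\lambda K_n^h$ into connected $s$-factors such that each given $r$-factor is contained in one of them and distinct $r$-factors are contained in distinct $s$-factors. $(n,r,\lambda)$ is $h$-admissible if $h\mid rn$ and $r\mid\lambda\binom{n-1}{h-1}$. -}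

module Defs where

open import Data.Nat using (ℕ; zero; suc; _+_; _*_; _∸_; _≤_; _<_)
open import Data.Nat.Divisibility using (_∣_)
open import Data.Nat.Combinatorics using (_C_)
open import Data.Integer as ℤ using (ℤ; +_)
open import Data.Fin as Fin using (Fin; toℕ; inject≤)
open import Data.Fin.Properties using (_≟_; _<?_; toℕ-inject≤)
open import Data.Bool using (Bool; true; false; if_then_else_; _∧_; _∨_)
open import Data.Product using (Σ; ∃; _×_; _,_)
open import Relation.Nullary using (yes; no)
open import Relation.Nullary.Decidable using (⌊_⌋)
open import Relation.Binary.PropositionalEquality using (_≡_; subst; sym)
open import Relation.Binary.Construct.Closure.ReflexiveTransitive using (Star)
open import Function.Definitions using (Injective)

∑ : ∀ {n} → (Fin n → ℕ) → ℕ
∑ {zero}  f = 0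
∑ {suc n} f = f Fin.zero + ∑ (λ i → f (Fin.suc i))

-- An edge of  l K_n^3 : a 3-subset {a < b < c} of the vertex set Fin n,
-- together with the index of one of its l parallel copies.
record Edge (n l : ℕ) : Set where
  constructor mkEdge
  field
    a b c : Fin n
    a<b   : a Fin.< b
    b<c   : b Fin.< c
    copy  : Fin l

open Edge public

_∈ₑ_ : ∀ {n l} → Fin n → Edge n l → Set
v ∈ₑ e = (v ≡ a e) Data.Sum.⊎ ((v ≡ b e) Data.Sum.⊎ (v ≡ c e))
  where import Data.Sum

ind : ∀ {n l k} → (Edge n l → Fin k) → Fin k → Fin n →
      Fin n → Fin n → Fin n → Fin l → ℕ
ind col i v a b c j with a <? b | b <? c
... | yes p | yes q =
  if (⌊ v ≟ a ⌋ ∨ ⌊ v ≟ b ⌋ ∨ ⌊ v ≟ c ⌋) ∧ ⌊ col (mkEdge a b c p q j) ≟ i ⌋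
  then 1 else 0
... | _ | _ = 0

deg : ∀ {n l k} → (Edge n l → Fin k) → Fin k → Fin n → ℕ
deg col i v = ∑ λ a → ∑ λ b → ∑ λ c → ∑ λ j → ind col i v a b c j

-- An r-factorization of l K_n^3: a partition of the edges into k classes
-- (given as a colouring) each of which is an r-factor (every vertex has degree r).
record Factorization (n l r : ℕ) : Set where
  field
    k       : ℕ
    col     : Edge n l → Fin k
    regular : ∀ (i : Fin k) (v : Fin n) → deg col i v ≡ r

open Factorization public

Adjacent : ∀ {n l k} → (Edge n l → Fin k) → Fin k → Fin n → Fin n → Set
Adjacent col i u v = Σ (Edge _ _) λ e → (col e ≡ i) × (u ∈ₑ e) × (v ∈ₑ e)

AllConnected : ∀ {n l r} → Factorization n l r → Set
AllConnected {n} F = ∀ (i : Fin (k F)) (u v : Fin n) → Star (Adjacent (col F) i) u v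

ι : ∀ {m n l} → m ≤ n → Edge m l → Edge n l
ι {m} {n} m≤n (mkEdge a b c p q j) =
  mkEdge (inject≤ a m≤n) (inject≤ b m≤n) (inject≤ c m≤n)
    (subst₂' (sym (toℕ-inject≤ a m≤n)) (sym (toℕ-inject≤ b m≤n)) p)
    (subst₂' (sym (toℕ-inject≤ b m≤n)) (sym (toℕ-inject≤ c m≤n)) q)
    j
  where
  subst₂' : ∀ {x x' y y' : ℕ} → x ≡ x' → y ≡ y' → x < y → x' < y'
  subst₂' Relation.Binary.PropositionalEquality.refl
          Relation.Binary.PropositionalEquality.refl p = p

Embeds : ∀ {m n l r} (s : ℕ) → m ≤ n → Factorization m l r → Set
Embeds {m} {n} {l} s m≤n F =
  Σ (Factorization n l s) λ G → AllConnected G ×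
    Σ (Fin (k F) → Fin (k G)) λ φ → Injective _≡_ _≡_ φ ×
      (∀ (e : Edge m l) → col G (ι m≤n e) ≡ φ (col F e))

Admissible3 : ℕ → ℕ → ℕ → Set
Admissible3 n r l = (3 ∣ r * n) × (r ∣ l * ((n ∸ 1) C 2))

-- Conditions (i)-(iv) of Theorem 8.5
-- (ii): 1 < s/r ≤ C(n-1,2)/C(m-1,2) with denominators cleared (r, C(m-1,2) > 0).
-- (iv): multiplied through by 3r > 0, in ℤ.
Conditions : (m n r s l : ℕ) → Set
Conditions m n r s l =
  (Admissible3 m r l × Admissible3 n s l) ×
  ((r < s) × (s * ((m ∸ 1) C 2) ≤ r * ((n ∸ 1) C 2))) ×
  (s * ((m ∸ 1) C 2) < r * ((n ∸ 1) C 2) → 3 * m ≤ 2 * n) ×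
  ((ℤ._-_ (+ (3 * m)) (+ n)) ℤ.* (ℤ._-_ (+ (r * ((n ∸ 1) C 2))) (+ (s * ((m ∸ 1) C 2))))
     ℤ.≤ + (3 * r * ((n ∸ m) * (m C 2))))

{-# OPTIONS --safe #-}

-- Necessity: an edge of a new colour has at most two old vertices.  Comparing the number of edges of such a
-- colour with the sum of its degrees at the old vertices gives (iii) and a lower bound for its number of
-- edges with exactly two old vertices; summing over the new colours gives (iv).  If s = r, an s-factor
-- containing a given r-factor has no edge between old and new vertices.
--
-- Sufficiency: amalgamate the old vertices into one vertex and the new vertices into another.  Conditions
-- (ii)-(iv) allow one to prescribe, for every colour, the numbers of edges with two, one and no old vertices.
-- Then the vertices are split off their amalgams one at a time.  When p vertices are still amalgamated, a
-- fraction 1/p of every class of parallel edges of each colour should move to the new vertex; this fractional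
-- solution is rounded to an integral one by Rado's theorem for polymatroids.  While the new vertices are
-- split off, the rounding also bounds what is taken from each component of a colour class, so that every
-- component keeps meeting the amalgam at least twice; hence the colour classes end up connected.

module Submission where

open import Defs
open import Data.Nat using (ℕ; _≤_; _<_; zero; suc; _+_; _*_; _∸_; _⊓_; z≤n; s≤s; s≤s⁻¹; NonZero; >-nonZero; _≟_; _≤?_; _<?_)
open import Data.Nat.Properties hiding (_≟_; _≤?_; _<?_)
open import Data.Nat.Divisibility using (_∣_; divides; ∣m+n∣m⇒∣n)
open import Data.Nat.DivMod using (_/_; _%_; m≡m%n+[m/n]*n; m%n<n)
open import Data.Nat.Combinatorics using (_C_; nC1≡n; nCk+nC[k+1]≡[n+1]C[k+1]; k>n⇒nCk≡0)
open import Data.Nat.Tactic.RingSolver using (solve-∀)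
import Data.Integer as ℤ
import Data.Integer.Properties as ℤₚ
open import Data.Bool using (Bool; true; false; if_then_else_; _∧_; _∨_; not)
import Data.Bool.Properties as Boolₚ
open import Data.Fin as Fin using (Fin; toℕ; inject≤; opposite)
import Data.Fin.Properties as Finₚ
open import Data.List using (List; []; _∷_; map; _++_; allFin; tabulate; cartesianProduct; length)
open import Data.List.Relation.Unary.Any using (here; there)
open import Data.List.Properties using (length-map)
open import Data.List.Membership.Propositional using (_∈_)
open import Data.Vec as Vec using (Vec; []; _∷_; lookup)
open import Data.Vec.Properties using (≡-dec; lookup-zipWith; lookup-replicate)
open import Data.Product using (∃; _×_; _,_; proj₁; proj₂)
open import Data.Product.Properties using () renaming (≡-dec to ×-≡-dec)
open import Data.Sum using (_⊎_; inj₁; inj₂; [_,_]′)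
open import Data.Unit using (⊤; tt)
open import Data.Empty using (⊥; ⊥-elim)
open import Function using (_∘_; id; case_of_)
open import Function.Bundles using (_⇔_; mk⇔)
open import Function.Definitions using (Injective)
open import Relation.Nullary using (Dec; yes; no; ¬_; contradiction)
open import Relation.Nullary.Decidable using (⌊_⌋; _×-dec_; map′; ¬?)
open import Relation.Binary.Definitions using (DecidableEquality)
open import Relation.Binary.PropositionalEquality using (_≡_; _≢_; refl; sym; trans; cong; cong₂; subst; subst₂; module ≡-Reasoning)
open import Relation.Binary.Construct.Closure.ReflexiveTransitive using (Star; ε; _◅_; _◅◅_; gmap)
open import Algebra.Properties.CommutativeSemigroup *-commutativeSemigroup using () renaming (x∙yz≈y∙xz to *-swap)
open import Algebra.Properties.CommutativeSemigroup +-commutativeSemigroup using (interchange)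

-- Once the number of edges of a colour with two old vertices is chosen, its degree sums fix the
-- numbers with one and with none. So prescribing them means choosing one integer per colour from an
-- interval, with a given total. (iv) controls the sum of the lower ends, (iii) makes the intervals
-- nonempty when there are new colours, and the upper ends lose only by parity; bounding the number
-- of odd degree sums uses m > 3. Rado's theorem fits because the restrictions on one colour are
-- nested (per class of parallel edges, per component, in total), and nested caps define a
-- polymatroid. Why twice: let a component have W incidences with the amalgam of p vertices. At most
-- the ceiling of W/p of them move to the new vertex. For p > 1 this leaves some behind exactly when
-- W > 1, so two components hit together leave two incidences. If only one is hit, it supplies all s
-- edges at the new vertex and is so heavy that two incidences remain; the delicate case is p = s =
-- 2. At p = 1 everything moves and all components merge.

private variable
  A B : Set

-- Finite sums

⟦_⟧ : Bool → ℕ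
⟦ true ⟧  = 1
⟦ false ⟧ = 0

S : List A → (A → ℕ) → ℕ
S []       f = 0
S (x ∷ xs) f = f x + S xs f

S-cong : ∀ (xs : List A) {f g : A → ℕ} → (∀ x → f x ≡ g x) → S xs f ≡ S xs g
S-cong []       h = refl
S-cong (x ∷ xs) h = cong₂ _+_ (h x) (S-cong xs h)

S-mono : ∀ (xs : List A) {f g : A → ℕ} → (∀ x → f x ≤ g x) → S xs f ≤ S xs g
S-mono []       h = z≤n
S-mono (x ∷ xs) h = +-mono-≤ (h x) (S-mono xs h)

S-zero : ∀ (xs : List A) {f : A → ℕ} → (∀ x → f x ≡ 0) → S xs f ≡ 0
S-zero []       h = refl
S-zero (x ∷ xs) h = cong₂ _+_ (h x) (S-zero xs h)

S-+ : ∀ (xs : List A) (f g : A → ℕ) → S xs (λ x → f x + g x) ≡ S xs f + S xs g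
S-+ []       f g = refl
S-+ (x ∷ xs) f g = trans (cong (f x + g x +_) (S-+ xs f g)) (interchange (f x) (g x) (S xs f) (S xs g))

S-*ˡ : ∀ (xs : List A) n (f : A → ℕ) → S xs (λ x → n * f x) ≡ n * S xs f
S-*ˡ []       n f = sym (*-zeroʳ n)
S-*ˡ (x ∷ xs) n f = trans (cong (n * f x +_) (S-*ˡ xs n f)) (sym (*-distribˡ-+ n (f x) (S xs f)))

S-*ʳ : ∀ (xs : List A) n (f : A → ℕ) → S xs (λ x → f x * n) ≡ S xs f * n
S-*ʳ xs n f = trans (S-cong xs (λ x → *-comm (f x) n)) (trans (S-*ˡ xs n f) (*-comm n (S xs f)))

S-swap : ∀ (xs : List A) (ys : List B) (f : A → B → ℕ) →
  S xs (λ x → S ys (f x)) ≡ S ys (λ y → S xs (λ x → f x y))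
S-swap []       ys f = sym (S-zero ys (λ _ → refl))
S-swap (x ∷ xs) ys f = trans (cong (S ys (f x) +_) (S-swap xs ys f))
  (sym (S-+ ys (f x) (λ y → S xs (λ x → f x y))))

S-++ : ∀ (xs ys : List A) (f : A → ℕ) → S (xs ++ ys) f ≡ S xs f + S ys f
S-++ []       ys f = refl
S-++ (x ∷ xs) ys f = trans (cong (f x +_) (S-++ xs ys f)) (sym (+-assoc (f x) _ _))

S-map : ∀ (g : A → B) (xs : List A) (f : B → ℕ) → S (map g xs) f ≡ S xs (f ∘ g)
S-map g []       f = refl
S-map g (x ∷ xs) f = cong (f (g x) +_) (S-map g xs f)

S-cartesianProduct : ∀ (xs : List A) (ys : List B) (f : A × B → ℕ) →
  S (cartesianProduct xs ys) f ≡ S xs (λ x → S ys (λ y → f (x , y)))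
S-cartesianProduct []       ys f = refl
S-cartesianProduct (x ∷ xs) ys f = trans (S-++ (map (x ,_) ys) (cartesianProduct xs ys) f)
  (cong₂ _+_ (S-map (x ,_) ys f) (S-cartesianProduct xs ys f))

S-positive : ∀ (xs : List A) (f : A → ℕ) → 0 < S xs f → ∃ λ x → 0 < f x
S-positive (x ∷ xs) f pos with f x in eq
... | zero  = S-positive xs f pos
... | suc _ = x , subst (0 <_) (sym eq) (s≤s z≤n)

-- Slack in one term could not be made up by the others. This turns bounds into equalities at three
-- places: the column sums of a rounding, the last split, and the case r = s of necessity.
S-equality : ∀ (xs : List A) {f g : A → ℕ} → (∀ x → f x ≤ g x) → S xs g ≤ S xs f →
  ∀ {x} → x ∈ xs → f x ≡ g x
S-equality (x ∷ xs) {f} {g} f≤g h (here refl) = ≤-antisym (f≤g x)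
  (+-cancelʳ-≤ (S xs f) (g x) (f x) (≤-trans (+-monoʳ-≤ (g x) (S-mono xs f≤g)) h))
S-equality (x ∷ xs) {f} {g} f≤g h (there p) = S-equality xs f≤g
  (+-cancelˡ-≤ (f x) _ _ (≤-trans (+-monoˡ-≤ (S xs g) (f≤g x)) h)) p

S-∈ : ∀ {xs : List A} (f : A → ℕ) {x} → x ∈ xs → f x ≤ S xs f
S-∈ f (here refl)         = m≤m+n _ _
S-∈ {xs = y ∷ _} f (there p) = ≤-trans (S-∈ f p) (m≤n+m _ (f y))

S-none : ∀ {xs : List A} (f : A → ℕ) → S xs f ≡ 0 → ∀ {x} → x ∈ xs → f x ≡ 0
S-none f e p = n≤0⇒n≡0 (subst (f _ ≤_) e (S-∈ f p))

⟦⟧*-≤ : ∀ b n → ⟦ b ⟧ * n ≤ n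
⟦⟧*-≤ true  n = ≤-reflexive (+-identityʳ n)
⟦⟧*-≤ false n = z≤n

⟦⟧-split : ∀ b n → ⟦ b ⟧ * n + ⟦ not b ⟧ * n ≡ n
⟦⟧-split true  n = trans (+-identityʳ _) (+-identityʳ n)
⟦⟧-split false n = +-identityʳ n

⌊⌋-⇔ : ∀ {P Q : Set} → (P → Q) → (Q → P) → (p : Dec P) (q : Dec Q) → ⌊ p ⌋ ≡ ⌊ q ⌋
⌊⌋-⇔ f g (yes p) (yes q) = refl
⌊⌋-⇔ f g (no ¬p) (no ¬q) = refl
⌊⌋-⇔ f g (yes p) (no ¬q) = contradiction (f p) ¬q
⌊⌋-⇔ f g (no ¬p) (yes q) = contradiction (g q) ¬p

⌊⌋-yes : ∀ {P : Set} (p? : Dec P) → P → ⌊ p? ⌋ ≡ true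
⌊⌋-yes p? p = ⌊⌋-⇔ _ (λ _ → p) p? (yes tt)

⌊⌋-no : ∀ {P : Set} (p? : Dec P) → ¬ P → ⌊ p? ⌋ ≡ false
⌊⌋-no p? ¬p = ⌊⌋-⇔ ¬p ⊥-elim p? (no id)

⌊⌋-true : ∀ {P : Set} (p? : Dec P) → ⌊ p? ⌋ ≡ true → P
⌊⌋-true (yes p) _ = p

-- That every element is listed exactly once is phrased as a sum, so that `δ` can be summed out
-- directly; membership in the list follows.
record Finite (A : Set) : Set where
  field
    elems : List A
    _==_  : DecidableEquality A
    once  : ∀ a → S elems (λ x → ⟦ ⌊ x == a ⌋ ⟧) ≡ 1

  δ : A → A → ℕ
  δ a x = ⟦ ⌊ x == a ⌋ ⟧

  δ-refl : ∀ a → δ a a ≡ 1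
  δ-refl a = cong ⟦_⟧ (⌊⌋-yes (a == a) refl)

  δ-≢ : ∀ {a x} → x ≢ a → δ a x ≡ 0
  δ-≢ ne = cong ⟦_⟧ (⌊⌋-no (_ == _) ne)

  δ-* : ∀ a x (f : A → ℕ) → δ a x * f x ≡ δ a x * f a
  δ-* a x f with x == a
  ... | yes refl = refl
  ... | no _     = refl

  S-δ : ∀ a (f : A → ℕ) → S elems (λ x → δ a x * f x) ≡ f a
  S-δ a f = trans (S-cong elems (λ x → δ-* a x f)) (trans (S-*ʳ elems (f a) (δ a))
    (trans (cong (_* f a) (once a)) (+-identityʳ (f a))))

  S-δ-sym : ∀ a (f : A → ℕ) → S elems (λ x → δ x a * f x) ≡ f a
  S-δ-sym a f = trans (S-cong elems (λ x →
    cong (λ b → ⟦ b ⟧ * f x) (⌊⌋-⇔ sym sym (a == x) (x == a)))) (S-δ a f)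

  complete : ∀ a → a ∈ elems
  complete a = search elems (≤-reflexive (sym (once a)))
    where
    search : ∀ xs → 0 < S xs (δ a) → a ∈ xs
    search (x ∷ xs) pos with x == a
    ... | yes refl = here refl
    ... | no _     = there (search xs pos)

  S-term : ∀ (f : A → ℕ) a → f a ≤ S elems f
  S-term f a = S-∈ f (complete a)

  -- Exhaustive search. Subsets are functions, hence found only up to pointwise equality, which is
  -- why `P` must respect it. It decides whether Hall's condition fails somewhere.
  anySubset? : (P : (A → Bool) → Set) → (∀ {X Y} → (∀ a → X a ≡ Y a) → P X → P Y) →
    (∀ X → Dec (P X)) → Dec (∃ P)
  anySubset? P resp P? = map′ (λ (X , pX , _) → X , pX) (λ (X , pX) → X , pX , λ a → inj₁ (complete a))
    (search elems (λ _ → false))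
    where
    update : A → Bool → (A → Bool) → A → Bool
    update a b X x = if ⌊ x == a ⌋ then b else X x

    Extends : List A → (A → Bool) → (A → Bool) → Set
    Extends xs X₀ X = ∀ a → a ∈ xs ⊎ X a ≡ X₀ a

    weaken : ∀ {x xs b X₀ X} → Extends xs (update x b X₀) X → Extends (x ∷ xs) X₀ X
    weaken {x} ext a with a == x | ext a
    ... | yes refl | _      = inj₁ (here refl)
    ... | no _     | inj₁ p = inj₁ (there p)
    ... | no _     | inj₂ e = inj₂ e

    strengthen : ∀ {x xs X₀ X} → Extends (x ∷ xs) X₀ X → Extends xs (update x (X x) X₀) X
    strengthen {x} ext a with a == x | ext a
    ... | yes refl | _                = inj₂ refl
    ... | no ne    | inj₁ (here refl) = contradiction refl ne
    ... | no _     | inj₁ (there p)   = inj₁ p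
    ... | no _     | inj₂ e           = inj₂ e

    search : ∀ xs X₀ → Dec (∃ λ X → P X × Extends xs X₀ X)
    search []       X₀ = map′ (λ p → X₀ , p , λ _ → inj₂ refl)
      (λ (X , pX , ext) → resp (λ a → [ (λ ()) , id ]′ (ext a)) pX) (P? X₀)
    search (x ∷ xs) X₀ with search xs (update x true X₀) | search xs (update x false X₀)
    ... | yes (X , pX , ext) | _                  = yes (X , pX , weaken ext)
    ... | no _               | yes (X , pX , ext) = yes (X , pX , weaken ext)
    ... | no ¬t              | no ¬f              = no λ (X , pX , ext) → absurd X pX (strengthen ext)
      where
      absurd : ∀ X → P X → Extends xs (update x (X x) X₀) X → ⊥
      absurd X pX ext with X x
      ... | true  = ¬t (X , pX , ext)
      ... | false = ¬f (X , pX , ext)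

-- Rado's theorem for polymatroids

_⊑_ : (A → Bool) → (A → Bool) → Set
X ⊑ Y = ∀ a → X a ≡ true → Y a ≡ true

_∪_ _∩_ : (A → Bool) → (A → Bool) → A → Bool
(X ∪ Y) a = X a ∨ Y a
(X ∩ Y) a = X a ∧ Y a

∅ : A → Bool
∅ _ = false

record Polymatroid (c : (A → Bool) → ℕ) : Set where
  field
    normalized : c ∅ ≡ 0
    monotone   : ∀ {X Y} → X ⊑ Y → c X ≤ c Y
    submodular : ∀ X Y → c (X ∪ Y) + c (X ∩ Y) ≤ c X + c Y

  respects : ∀ {X Y} → (∀ a → X a ≡ Y a) → c X ≡ c Y
  respects e = ≤-antisym (monotone (λ a → trans (sym (e a)))) (monotone (λ a → trans (e a)))

module _ {A : Set} (finA : Finite A) where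
  open Finite finA

  mass : (A → ℕ) → (A → Bool) → ℕ
  mass ρ X = S elems (λ a → ⟦ X a ⟧ * ρ a)

  mass-mono : ∀ ρ {X Y} → X ⊑ Y → mass ρ X ≤ mass ρ Y
  mass-mono ρ {X} {Y} X⊑Y = S-mono elems pointwise
    where
    pointwise : ∀ a → ⟦ X a ⟧ * ρ a ≤ ⟦ Y a ⟧ * ρ a
    pointwise a with X a | Y a | X⊑Y a
    ... | false | _     | _ = z≤n
    ... | true  | true  | _ = ≤-refl
    ... | true  | false | f = contradiction (f refl) λ ()

  mass-modular : ∀ ρ X Y → mass ρ (X ∪ Y) + mass ρ (X ∩ Y) ≡ mass ρ X + mass ρ Y
  mass-modular ρ X Y = trans (sym (S-+ elems _ _)) (trans (S-cong elems pointwise) (S-+ elems _ _))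
    where
    pointwise : ∀ a → ⟦ X a ∨ Y a ⟧ * ρ a + ⟦ X a ∧ Y a ⟧ * ρ a ≡ ⟦ X a ⟧ * ρ a + ⟦ Y a ⟧ * ρ a
    pointwise a with X a | Y a
    ... | true  | true  = refl
    ... | true  | false = refl
    ... | false | true  = +-comm (ρ a + 0) 0
    ... | false | false = refl

  mass-∅ : ∀ ρ → mass ρ ∅ ≡ 0
  mass-∅ ρ = S-zero elems (λ _ → refl)

  mass-+ : ∀ ρ σ X → mass (λ a → ρ a + σ a) X ≡ mass ρ X + mass σ X
  mass-+ ρ σ X = trans (S-cong elems (λ a → *-distribˡ-+ ⟦ X a ⟧ (ρ a) (σ a))) (S-+ elems _ _)

  mass-δ : ∀ a X → mass (δ a) X ≡ ⟦ X a ⟧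
  mass-δ a X = trans (S-cong elems (λ x → *-comm ⟦ X x ⟧ (δ a x))) (S-δ a (λ x → ⟦ X x ⟧))

  mass-polymatroid : ∀ ρ → Polymatroid (mass ρ)
  mass-polymatroid ρ = record
    { normalized = mass-∅ ρ
    ; monotone   = mass-mono ρ
    ; submodular = λ X Y → ≤-reflexive (mass-modular ρ X Y)
    }

  insert : A → (A → Bool) → A → Bool
  insert a X x = ⌊ x == a ⌋ ∨ X x

  ⊑-insert : ∀ a X → X ⊑ insert a X
  ⊑-insert a X x e with x == a
  ... | yes _ = refl
  ... | no _  = e

  insert-mono : ∀ a {X Y} → X ⊑ Y → insert a X ⊑ insert a Y
  insert-mono a X⊑Y x e with x == a
  ... | yes _ = refl
  ... | no _  = X⊑Y x e

  insert-absorb : ∀ a X → X a ≡ true → insert a X ⊑ X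
  insert-absorb a X e x h with x == a
  ... | yes refl = e
  ... | no _     = h

  mass-insert : ∀ ρ a X → X a ≡ false → mass ρ (insert a X) ≡ mass ρ X + ρ a
  mass-insert ρ a X a∉X = trans (S-cong elems pointwise)
    (trans (S-+ elems _ _) (cong (mass ρ X +_) (S-δ a ρ)))
    where
    pointwise : ∀ x → ⟦ insert a X x ⟧ * ρ x ≡ ⟦ X x ⟧ * ρ x + δ a x * ρ x
    pointwise x with x == a
    ... | yes refl rewrite a∉X = refl
    ... | no _ = sym (+-identityʳ _)

  -- The capacity left in a column that already holds one unit of row `a`: a set must respect its
  -- old bound, and together with `a` it must leave room for that unit.
  reduce : A → ((A → Bool) → ℕ) → (A → Bool) → ℕ
  reduce a c X = c X ⊓ (c (insert a X) ∸ 1)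

  module _ (a : A) (c : (A → Bool) → ℕ) (pol : Polymatroid c) (1≤c : 1 ≤ c (insert a ∅)) where
    open Polymatroid pol

    private
      D : (A → Bool) → ℕ
      D X = c (insert a X) ∸ 1

      D+1 : ∀ X → D X + 1 ≡ c (insert a X)
      D+1 X = m∸n+n≡m (≤-trans 1≤c (monotone (insert-mono a {∅} {X} λ _ ())))

      D-mono : ∀ {X Y} → X ⊑ Y → D X ≤ D Y
      D-mono X⊑Y = ∸-monoˡ-≤ 1 (monotone (insert-mono a X⊑Y))

      -- Submodularity for `insert a X` and `Y`. The element `a` is forced into the first set only,
      -- so the decrement occurs once on each side.
      mixed : ∀ X Y → D (X ∪ Y) + c (X ∩ Y) ≤ D X + c Y
      mixed X Y = +-cancelʳ-≤ 1 _ _ (begin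
        D (X ∪ Y) + c (X ∩ Y) + 1                      ≡⟨ shuffle (D (X ∪ Y)) _ ⟩
        (D (X ∪ Y) + 1) + c (X ∩ Y)                    ≡⟨ cong (_+ c (X ∩ Y)) (D+1 (X ∪ Y)) ⟩
        c (insert a (X ∪ Y)) + c (X ∩ Y)               ≤⟨ +-mono-≤ (monotone outer) (monotone inner) ⟩
        c (insert a X ∪ Y) + c (insert a X ∩ Y)        ≤⟨ submodular (insert a X) Y ⟩
        c (insert a X) + c Y                           ≡⟨ cong (_+ c Y) (sym (D+1 X)) ⟩
        (D X + 1) + c Y                                ≡⟨ sym (shuffle (D X) _) ⟩
        D X + c Y + 1 ∎)
        where
        open ≤-Reasoning
        shuffle : ∀ x y → x + y + 1 ≡ (x + 1) + y
        shuffle = solve-∀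
        outer : insert a (X ∪ Y) ⊑ (insert a X ∪ Y)
        outer x e with x == a
        ... | yes _ = refl
        ... | no _  = e
        inner : (X ∩ Y) ⊑ (insert a X ∩ Y)
        inner x e with x == a | X x | Y x
        ... | yes _ | true  | true = refl
        ... | no _  | true  | true = refl

      both : ∀ X Y → D (X ∪ Y) + D (X ∩ Y) ≤ D X + D Y
      both X Y = +-cancelʳ-≤ 2 _ _ (begin
        D (X ∪ Y) + D (X ∩ Y) + 2                          ≡⟨ shuffle (D (X ∪ Y)) _ ⟩
        (D (X ∪ Y) + 1) + (D (X ∩ Y) + 1)                  ≡⟨ cong₂ _+_ (D+1 (X ∪ Y)) (D+1 (X ∩ Y)) ⟩
        c (insert a (X ∪ Y)) + c (insert a (X ∩ Y))        ≤⟨ +-mono-≤ (monotone outer) (monotone inner) ⟩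
        c (insert a X ∪ insert a Y) + c (insert a X ∩ insert a Y) ≤⟨ submodular (insert a X) (insert a Y) ⟩
        c (insert a X) + c (insert a Y)                    ≡⟨ sym (cong₂ _+_ (D+1 X) (D+1 Y)) ⟩
        (D X + 1) + (D Y + 1)                              ≡⟨ sym (shuffle (D X) _) ⟩
        D X + D Y + 2 ∎)
        where
        open ≤-Reasoning
        shuffle : ∀ x y → x + y + 2 ≡ (x + 1) + (y + 1)
        shuffle = solve-∀
        outer : insert a (X ∪ Y) ⊑ (insert a X ∪ insert a Y)
        outer x e with x == a
        ... | yes _ = refl
        ... | no _  = e
        inner : insert a (X ∩ Y) ⊑ (insert a X ∩ insert a Y)
        inner x e with x == a
        ... | yes _ = refl
        ... | no _  = e

    reduce-polymatroid : Polymatroid (reduce a c)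
    reduce-polymatroid = record
      { normalized = n≤0⇒n≡0 (≤-trans (m⊓n≤m _ _) (≤-reflexive normalized))
      ; monotone   = λ X⊑Y → ⊓-mono-≤ (monotone X⊑Y) (D-mono X⊑Y)
      ; submodular = sub
      }
      where
      ∪-comm : ∀ X Y → (X ∪ Y) ⊑ (Y ∪ X)
      ∪-comm X Y x e with X x | Y x
      ... | _     | true  = refl
      ... | true  | false = refl
      ∩-comm : ∀ X Y → (X ∩ Y) ⊑ (Y ∩ X)
      ∩-comm X Y x e with X x | Y x
      ... | true | true = refl
      sub : ∀ X Y → reduce a c (X ∪ Y) + reduce a c (X ∩ Y) ≤ reduce a c X + reduce a c Y
      sub X Y with ⊓-sel (c X) (D X) | ⊓-sel (c Y) (D Y)
      ... | inj₁ p | inj₁ q rewrite p | q = ≤-trans (+-mono-≤ (m⊓n≤m (c (X ∪ Y)) _) (m⊓n≤m (c (X ∩ Y)) _)) (submodular X Y)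
      ... | inj₂ p | inj₁ q rewrite p | q = ≤-trans (+-mono-≤ (m⊓n≤n (c (X ∪ Y)) _) (m⊓n≤m (c (X ∩ Y)) _)) (mixed X Y)
      ... | inj₁ p | inj₂ q rewrite p | q = ≤-trans (+-mono-≤ (m⊓n≤n (c (X ∪ Y)) _) (m⊓n≤m (c (X ∩ Y)) _))
              (≤-trans (+-mono-≤ (D-mono {X ∪ Y} {Y ∪ X} (∪-comm X Y)) (monotone (∩-comm X Y)))
              (≤-trans (mixed Y X) (≤-reflexive (+-comm (D Y) (c X)))))
      ... | inj₂ p | inj₂ q rewrite p | q = ≤-trans (+-mono-≤ (m⊓n≤n (c (X ∪ Y)) _) (m⊓n≤n (c (X ∩ Y)) _)) (both X Y)

  remove-unit : ∀ (ρ : A → ℕ) {a} → 0 < ρ a → ∀ x → ρ x ≡ (ρ x ∸ δ a x) + δ a x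
  remove-unit ρ {a} pos x with x == a
  ... | yes refl = sym (m∸n+n≡m pos)
  ... | no _     = sym (+-identityʳ _)

  module _ {Col : Set} (finC : Finite Col) where
    private
      module FC = Finite finC
      cs : List Col
      cs = FC.elems

    Hall : (A → ℕ) → (Col → (A → Bool) → ℕ) → Set
    Hall ρ c = ∀ X → mass ρ X ≤ S cs (λ i → c i X)

    reduceAt : A → Col → (Col → (A → Bool) → ℕ) → Col → (A → Bool) → ℕ
    reduceAt a i c j = if ⌊ j FC.== i ⌋ then reduce a (c j) else c j

    -- If X is also tight, no unit of row a can be placed in column i.
    Blocking : (Col → (A → Bool) → ℕ) → A → Col → (A → Bool) → Set
    Blocking c a i X = c i (insert a X) ≤ c i X

    Tight : (A → ℕ) → (Col → (A → Bool) → ℕ) → A → (A → Bool) → Set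
    Tight ρ c a X = X a ≡ false × S cs (λ i → c i X) ≤ mass ρ X

    module _ (ρ : A → ℕ) (c : Col → (A → Bool) → ℕ) (pol : ∀ i → Polymatroid (c i)) (hall : Hall ρ c) where

      -- Column capacity minus mass is submodular, and nonnegative by Hall's condition. Tight sets
      -- are its zeros, and the minimisers of a submodular function are closed under union.
      tight-∪ : ∀ {a X Y} → Tight ρ c a X → Tight ρ c a Y → Tight ρ c a (X ∪ Y)
      tight-∪ {a} {X} {Y} (a∉X , tX) (a∉Y , tY) = cong₂ _∨_ a∉X a∉Y , +-cancelʳ-≤ (mass ρ (X ∩ Y)) _ _ (begin
        S cs (λ i → c i (X ∪ Y)) + mass ρ (X ∩ Y)                  ≤⟨ +-monoʳ-≤ _ (hall (X ∩ Y)) ⟩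
        S cs (λ i → c i (X ∪ Y)) + S cs (λ i → c i (X ∩ Y))        ≡⟨ sym (S-+ cs _ _) ⟩
        S cs (λ i → c i (X ∪ Y) + c i (X ∩ Y))                     ≤⟨ S-mono cs (λ i → Polymatroid.submodular (pol i) X Y) ⟩
        S cs (λ i → c i X + c i Y)                                 ≡⟨ S-+ cs _ _ ⟩
        S cs (λ i → c i X) + S cs (λ i → c i Y)                    ≤⟨ +-mono-≤ tX tY ⟩
        mass ρ X + mass ρ Y                                        ≡⟨ sym (mass-modular ρ X Y) ⟩
        mass ρ (X ∪ Y) + mass ρ (X ∩ Y) ∎)
        where open ≤-Reasoning

      -- Diminishing returns: the marginal value of `a` cannot grow when the set grows.
      blocking-up : ∀ {a i X Z} → Z a ≡ false → X ⊑ Z → Blocking c a i X → Blocking c a i Z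
      blocking-up {a} {i} {X} {Z} a∉Z X⊑Z bX = +-cancelʳ-≤ (c i X) _ _ (begin
        c i (insert a Z) + c i X                            ≤⟨ +-mono-≤ (monotone outer) (monotone inner) ⟩
        c i (insert a X ∪ Z) + c i (insert a X ∩ Z)         ≤⟨ submodular (insert a X) Z ⟩
        c i (insert a X) + c i Z                            ≤⟨ +-monoˡ-≤ (c i Z) bX ⟩
        c i X + c i Z                                       ≡⟨ +-comm (c i X) (c i Z) ⟩
        c i Z + c i X ∎)
        where
        open ≤-Reasoning
        open Polymatroid (pol i)
        outer : insert a Z ⊑ (insert a X ∪ Z)
        outer x e with x == a | X x | Z x
        ... | yes _ | _     | _    = refl
        ... | no _  | true  | true = refl
        ... | no _  | false | true = refl
        inner : X ⊑ (insert a X ∩ Z)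
        inner x e = cong₂ _∧_ (⊑-insert a X x e) (X⊑Z x e)

      blocking-all : ∀ a → (∀ i → ∃ λ X → Tight ρ c a X × Blocking c a i X) →
        ∀ (is : List Col) → ∃ λ X → Tight ρ c a X × (∀ {i} → i ∈ is → Blocking c a i X)
      blocking-all a blocked [] = ∅ , (refl , ≤-reflexive
        (trans (S-zero cs (λ i → Polymatroid.normalized (pol i))) (sym (mass-∅ ρ)))) , λ ()
      blocking-all a blocked (i ∷ is) with blocked i | blocking-all a blocked is
      ... | X , tX , bX | Y , tY , bY = X ∪ Y , tX∪Y , λ
        { (here refl) → blocking-up (proj₁ tX∪Y) (λ x e → cong (_∨ Y x) e) bX
        ; (there p)   → blocking-up (proj₁ tX∪Y) (λ x e → subst (λ b → X x ∨ b ≡ true) (sym e) (∨-true (X x))) (bY p) }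
        where
        tX∪Y = tight-∪ tX tY
        ∨-true : ∀ b → b ∨ true ≡ true
        ∨-true true  = refl
        ∨-true false = refl

      not-all-blocked : ∀ a → 0 < ρ a → ¬ (∀ i → ∃ λ X → Tight ρ c a X × Blocking c a i X)
      not-all-blocked a pos blocked with blocking-all a blocked cs
      ... | X , (a∉X , tX) , bX = <-irrefl refl (begin-strict
        mass ρ X                           <⟨ m<m+n (mass ρ X) pos ⟩
        mass ρ X + ρ a                     ≡⟨ sym (mass-insert ρ a X a∉X) ⟩
        mass ρ (insert a X)                ≤⟨ hall (insert a X) ⟩
        S cs (λ i → c i (insert a X))      ≤⟨ S-mono cs (λ i → bX (FC.complete i)) ⟩
        S cs (λ i → c i X)                 ≤⟨ tX ⟩
        mass ρ X ∎)
        where open ≤-Reasoning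

      reduceAt-lower : ∀ a i j X → c j X ≤ reduceAt a i c j X + FC.δ i j
      reduceAt-lower a i j X with j FC.== i
      ... | no _  = m≤m+n _ 0
      ... | yes _ = begin
        c j X                                        ≡⟨ sym (m≤n⇒m⊓n≡m (≤-trans (Polymatroid.monotone (pol j) (⊑-insert a X)) (m≤n+m∸n _ 1))) ⟩
        c j X ⊓ suc (c j (insert a X) ∸ 1)           ≤⟨ ⊓-monoˡ-≤ _ (n≤1+n (c j X)) ⟩
        suc (reduce a (c j) X)                       ≡⟨ +-comm 1 _ ⟩
        reduce a (c j) X + 1 ∎
        where open ≤-Reasoning

      -- Reduction lowers the total capacity by at most one, and removing the unit lowers the mass
      -- of every set containing `a` by one. So a violated set avoids `a`, was tight before, and
      -- really lost capacity in column `i`; the last means that `a` adds nothing to it there.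
      violation-blocks : ∀ a i ρ' → 1 ≤ c i (insert a ∅) → (∀ x → ρ x ≡ ρ' x + δ a x) →
        ∀ X → ¬ (mass ρ' X ≤ S cs (λ j → reduceAt a i c j X)) → Tight ρ c a X × Blocking c a i X
      violation-blocks a i ρ' 1≤c split X viol = result (X a) refl
        where
        open ≤-Reasoning
        open Polymatroid (pol i) using (monotone)
        R : ℕ
        R = S cs (λ j → reduceAt a i c j X)
        mass-split : mass ρ X ≡ mass ρ' X + ⟦ X a ⟧
        mass-split = trans (S-cong elems (λ x → cong (⟦ X x ⟧ *_) (split x)))
          (trans (mass-+ ρ' (δ a) X) (cong (mass ρ' X +_) (mass-δ a X)))
        total : S cs (λ j → c j X) ≤ R + 1
        total = begin
          S cs (λ j → c j X)                          ≤⟨ S-mono cs (λ j → reduceAt-lower a i j X) ⟩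
          S cs (λ j → reduceAt a i c j X + FC.δ i j)  ≡⟨ S-+ cs _ _ ⟩
          R + S cs (FC.δ i)                           ≡⟨ cong (R +_) (FC.once i) ⟩
          R + 1 ∎
        result : ∀ b → X a ≡ b → Tight ρ c a X × Blocking c a i X
        result true e = contradiction (+-cancelʳ-≤ 1 _ _ (begin
          mass ρ' X + 1           ≡⟨ cong (λ b → mass ρ' X + ⟦ b ⟧) (sym e) ⟩
          mass ρ' X + ⟦ X a ⟧     ≡⟨ sym mass-split ⟩
          mass ρ X                ≤⟨ hall X ⟩
          S cs (λ j → c j X)      ≤⟨ total ⟩
          R + 1 ∎)) viol
        result false e = (e , tight) , blocking
          where
          same : mass ρ X ≡ mass ρ' X
          same = trans mass-split (trans (cong (λ b → mass ρ' X + ⟦ b ⟧) e) (+-identityʳ _))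
          tight : S cs (λ j → c j X) ≤ mass ρ X
          tight = begin
            S cs (λ j → c j X)  ≤⟨ total ⟩
            R + 1               ≡⟨ +-comm R 1 ⟩
            suc R               ≤⟨ ≰⇒> viol ⟩
            mass ρ' X           ≡⟨ sym same ⟩
            mass ρ X ∎
          blocking : c i (insert a X) ≤ c i X
          blocking with c i (insert a X) ≤? c i X
          ... | yes p = p
          ... | no ¬p = contradiction (begin
            mass ρ' X           ≡⟨ sym same ⟩
            mass ρ X            ≤⟨ hall X ⟩
            S cs (λ j → c j X)  ≤⟨ S-mono cs unreduced ⟩
            R ∎) viol
            where
            unreduced : ∀ j → c j X ≤ reduceAt a i c j X
            unreduced j with j FC.== i
            ... | no _     = ≤-refl
            ... | yes refl = ⊓-glb ≤-refl (∸-monoˡ-≤ 1 (≰⇒> ¬p))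

      violation-resp : ∀ a i ρ' {X Y} → (∀ x → X x ≡ Y x) →
        ¬ (mass ρ' X ≤ S cs (λ j → reduceAt a i c j X)) → ¬ (mass ρ' Y ≤ S cs (λ j → reduceAt a i c j Y))
      violation-resp a i ρ' {X} {Y} e = subst₂ (λ u v → ¬ (u ≤ v))
        (S-cong elems (λ x → cong (λ b → ⟦ b ⟧ * ρ' x) (e x))) (S-cong cs pointwise)
        where
        pointwise : ∀ j → reduceAt a i c j X ≡ reduceAt a i c j Y
        pointwise j with j FC.== i
        ... | no _  = Polymatroid.respects (pol j) e
        ... | yes _ = cong₂ _⊓_ (Polymatroid.respects (pol j) e)
          (cong (_∸ 1) (Polymatroid.respects (pol j) (λ x → cong (⌊ x == a ⌋ ∨_) (e x))))

      placeable : ∀ a ρ' → (∀ x → ρ x ≡ ρ' x + δ a x) → ∀ i →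
        (1 ≤ c i (insert a ∅) × Hall ρ' (reduceAt a i c)) ⊎ (∃ λ X → Tight ρ c a X × Blocking c a i X)
      placeable a ρ' split i with 1 ≤? c i (insert a ∅)
      -- The column has no room for row `a` at all, so the empty set is already tight and blocking.
      ... | no ¬1≤c = inj₂ (∅ , (refl , ≤-reflexive
        (trans (S-zero cs (λ i → Polymatroid.normalized (pol i))) (sym (mass-∅ ρ)))) ,
          ≤-trans (≤-pred (≰⇒> ¬1≤c)) z≤n)
      ... | yes 1≤c with anySubset? (λ X → ¬ (mass ρ' X ≤ S cs (λ j → reduceAt a i c j X)))
                           (violation-resp a i ρ') (λ X → ¬? (mass ρ' X ≤? S cs (λ j → reduceAt a i c j X)))
      ... | yes (X , viol) = inj₂ (X , violation-blocks a i ρ' 1≤c split X viol)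
      ... | no ¬viol = inj₁ (1≤c , λ X → case mass ρ' X ≤? S cs (λ j → reduceAt a i c j X) of λ
        { (yes p) → p ; (no ¬p) → contradiction (X , ¬p) ¬viol })

    private
      search : {P Q : Col → Set} (is : List Col) → (∀ i → P i ⊎ Q i) → (∃ P) ⊎ (∀ {i} → i ∈ is → Q i)
      search []       f = inj₂ λ ()
      search (i ∷ is) f with f i | search is f
      ... | inj₁ p | _      = inj₁ (i , p)
      ... | inj₂ _ | inj₁ p = inj₁ p
      ... | inj₂ q | inj₂ g = inj₂ λ { (here refl) → q ; (there m) → g m }

    -- Greedy placement of one unit at a time: if no column accepts a unit of
    -- row a, the union of the blocking tight sets, together with a, violates Hall's condition.
    rado : ∀ N (ρ : A → ℕ) (c : Col → (A → Bool) → ℕ) → S elems ρ ≡ N → (∀ i → Polymatroid (c i)) →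
      Hall ρ c → ∃ λ (y : A → Col → ℕ) → (∀ a → S cs (y a) ≡ ρ a) × (∀ i X → mass (λ a → y a i) X ≤ c i X)
    rado zero ρ c total pol hall = (λ _ _ → 0) ,
      (λ a → trans (S-zero cs (λ _ → refl)) (sym (S-none ρ total (complete a)))) ,
      (λ i X → ≤-trans (≤-reflexive (S-zero elems (λ a → *-zeroʳ ⟦ X a ⟧))) z≤n)
    rado (suc N) ρ c total pol hall
      with S-positive elems ρ (subst (0 <_) (sym total) (s≤s z≤n))
    ... | a , pos with search cs (placeable ρ c pol hall a (λ x → ρ x ∸ δ a x) (remove-unit ρ pos))
    ... | inj₂ blocked = contradiction (λ i → blocked (FC.complete i)) (not-all-blocked ρ c pol hall a pos)
    ... | inj₁ (i , 1≤c , hall') = y , rows , columns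
      where
      ρ' : A → ℕ
      ρ' x = ρ x ∸ δ a x
      split : ∀ x → ρ x ≡ ρ' x + δ a x
      split = remove-unit ρ pos
      total' : S elems ρ' ≡ N
      total' = suc-injective (trans (+-comm 1 _) (trans (trans (cong (S elems ρ' +_) (sym (once a)))
        (trans (sym (S-+ elems ρ' (δ a))) (S-cong elems (λ x → sym (split x))))) total))
      pol' : ∀ j → Polymatroid (reduceAt a i c j)
      pol' j with j FC.== i
      ... | no _     = pol j
      ... | yes refl = reduce-polymatroid a (c i) (pol i) 1≤c
      rec = rado N ρ' (reduceAt a i c) total' pol' hall'
      y' : A → Col → ℕ
      y' = proj₁ rec
      y : A → Col → ℕ
      y x j = y' x j + δ a x * FC.δ i j
      rows : ∀ x → S cs (y x) ≡ ρ x
      rows x = trans (S-+ cs (y' x) (λ j → δ a x * FC.δ i j)) (trans (cong₂ _+_ (proj₁ (proj₂ rec) x)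
        (trans (S-*ˡ cs (δ a x) (FC.δ i)) (trans (cong (δ a x *_) (FC.once i)) (*-identityʳ _)))) (sym (split x)))
      columns : ∀ j X → mass (λ x → y x j) X ≤ c j X
      columns j X = ≤-trans (≤-reflexive (mass-+ (λ x → y' x j) (λ x → δ a x * FC.δ i j) X)) (bound (proj₂ (proj₂ rec) j X))
        where
        bound : mass (λ x → y' x j) X ≤ reduceAt a i c j X →
          mass (λ x → y' x j) X + mass (λ x → δ a x * FC.δ i j) X ≤ c j X
        bound h with j FC.== i
        ... | no _ = ≤-trans (≤-reflexive (trans (cong (mass (λ x → y' x j) X +_)
          (S-zero elems (λ x → trans (cong (⟦ X x ⟧ *_) (*-zeroʳ (δ a x))) (*-zeroʳ ⟦ X x ⟧)))) (+-identityʳ _))) h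
        ... | yes refl = ≤-trans (≤-reflexive (cong (mass (λ x → y' x j) X +_)
          (trans (S-cong elems (λ x → cong (⟦ X x ⟧ *_) (*-identityʳ (δ a x)))) (mass-δ a X)))) (place (X a) refl)
          where
          place : ∀ b → X a ≡ b → mass (λ x → y' x j) X + ⟦ X a ⟧ ≤ c j X
          place false e = ≤-trans (≤-reflexive (trans (cong (λ b → mass (λ x → y' x j) X + ⟦ b ⟧) e) (+-identityʳ _)))
            (≤-trans h (m⊓n≤m _ _))
          place true e = begin
            mass (λ x → y' x j) X + ⟦ X a ⟧    ≡⟨ cong (λ b → mass (λ x → y' x j) X + ⟦ b ⟧) e ⟩
            mass (λ x → y' x j) X + 1          ≤⟨ +-monoˡ-≤ 1 (≤-trans h (m⊓n≤n (c j X) _)) ⟩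
            c j (insert a X) ∸ 1 + 1           ≡⟨ m∸n+n≡m (≤-trans 1≤c (monotone (insert-mono a {∅} {X} λ _ ()))) ⟩
            c j (insert a X)                   ≤⟨ monotone (insert-absorb a X e) ⟩
            c j X ∎
            where
            open ≤-Reasoning
            open Polymatroid (pol j)

-- If `X` or `Y` is cut off at `k`, then `k` also bounds the term of the union, and monotonicity
-- compares the intersection with the other set. Otherwise submodularity of `c` applies.
⊓-polymatroid : ∀ k {c : (A → Bool) → ℕ} → Polymatroid c → Polymatroid (λ X → k ⊓ c X)
⊓-polymatroid k {c} pol = record
  { normalized = n≤0⇒n≡0 (≤-trans (m⊓n≤n k _) (≤-reflexive normalized))
  ; monotone   = λ X⊑Y → ⊓-monoʳ-≤ k (monotone X⊑Y)
  ; submodular = sub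
  }
  where
  open Polymatroid pol
  sub : ∀ X Y → k ⊓ c (X ∪ Y) + k ⊓ c (X ∩ Y) ≤ k ⊓ c X + k ⊓ c Y
  sub X Y with ⊓-sel k (c X) | ⊓-sel k (c Y)
  ... | inj₁ p | _ rewrite p = +-mono-≤ (m⊓n≤m k _)
    (⊓-monoʳ-≤ k (monotone {X ∩ Y} {Y} λ x e → proj₂ (∧-true (X x) e)))
    where
    ∧-true : ∀ b {b'} → b ∧ b' ≡ true → b ≡ true × b' ≡ true
    ∧-true true e = refl , e
  ... | inj₂ p | inj₁ q rewrite q = ≤-trans (+-mono-≤ (m⊓n≤m k _)
    (⊓-monoʳ-≤ k (monotone {X ∩ Y} {X} λ x e → ∧-trueˡ (X x) e))) (≤-reflexive (+-comm k _))
    where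
    ∧-trueˡ : ∀ b {b'} → b ∧ b' ≡ true → b ≡ true
    ∧-trueˡ true e = refl
  ... | inj₂ p | inj₂ q rewrite p | q = ≤-trans (+-mono-≤ (m⊓n≤n k _) (m⊓n≤n k _)) (submodular X Y)

S-polymatroid : ∀ (xs : List B) {c : B → (A → Bool) → ℕ} → (∀ b → Polymatroid (c b)) →
  Polymatroid (λ X → S xs (λ b → c b X))
S-polymatroid xs pol = record
  { normalized = S-zero xs (λ b → Polymatroid.normalized (pol b))
  ; monotone   = λ X⊑Y → S-mono xs (λ b → Polymatroid.monotone (pol b) X⊑Y)
  ; submodular = λ X Y → ≤-trans (≤-reflexive (sym (S-+ xs _ _)))
      (≤-trans (S-mono xs (λ b → Polymatroid.submodular (pol b) X Y)) (≤-reflexive (S-+ xs _ _)))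
  }

-- Rounding a matrix under nested caps

module _ {A Col G : Set} (finA : Finite A) (finC : Finite Col) (finG : Finite G) where
  private
    module FA = Finite finA
    module FC = Finite finC
    module FG = Finite finG
    as = FA.elems
    cs = FC.elems
    gs = FG.elems

  -- The groups are the classes of `g i`, so every column has its own partition of the rows.
  -- Compared with `y≤x`, the bound `y≤wx` adds something only for rows of weight zero, which must
  -- stay untouched.
  record Rounding (x : A → Col → ℕ) (w : A → ℕ) (ρ : A → ℕ) (d : Col → ℕ) (g : Col → A → G) (κ : Col → G → ℕ) : Set where
    field
      y         : A → Col → ℕ
      y≤x       : ∀ a i → y a i ≤ x a i
      y≤wx      : ∀ a i → y a i ≤ w a * x a i
      row-sum   : ∀ a → S cs (y a) ≡ ρ a
      col-sum   : ∀ i → S as (λ a → y a i) ≡ d i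
      group-sum : ∀ i ℓ → S as (λ a → FG.δ ℓ (g i a) * y a i) ≤ κ i ℓ

  -- The matrix w x / (1 + p) has integral row and column sums; it is rounded to an integral matrix
  -- with the same margins.
  rounding : ∀ x w p ρ d g κ →
    (∀ a → S cs (λ i → w a * x a i) ≡ suc p * ρ a) →
    (∀ i → S as (λ a → w a * x a i) ≡ suc p * d i) →
    (∀ a i → w a * x a i ≤ suc p * x a i) →
    (∀ i ℓ → S as (λ a → FG.δ ℓ (g i a) * (w a * x a i)) ≤ suc p * κ i ℓ) →
    Rounding x w ρ d g κ
  rounding x w p ρ d g κ rows cols wx≤px caps = record
    { y = y ; y≤x = λ a i → ≤-trans (y≤u a i) (m⊓n≤m _ _) ; y≤wx = λ a i → ≤-trans (y≤u a i) (m⊓n≤n (x a i) _)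
    ; row-sum = proj₁ (proj₂ sol)
    -- No column exceeds its prescribed sum and the grand totals agree, so every column attains it.
    ; col-sum = λ i → S-equality cs col≤ (≤-reflexive (sym totals)) (FC.complete i)
    ; group-sum = group≤ }
    where
    P = suc p
    open ≤-Reasoning
    u : A → Col → ℕ
    u a i = x a i ⊓ (w a * x a i)
    part : Col → G → (A → Bool) → ℕ
    part i ℓ = mass finA (λ a → FG.δ ℓ (g i a) * u a i)
    -- Entries are capped by `u`, groups by `κ`, the column by `d`. Truncations and sums of modular
    -- functions remain polymatroids.
    cap : Col → (A → Bool) → ℕ
    cap i X = d i ⊓ S gs (λ ℓ → κ i ℓ ⊓ part i ℓ X)
    pol : ∀ i → Polymatroid (cap i)
    pol i = ⊓-polymatroid (d i) (S-polymatroid gs (λ ℓ → ⊓-polymatroid (κ i ℓ) (mass-polymatroid finA _)))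
    wx≤Pu : ∀ a i → w a * x a i ≤ P * u a i
    wx≤Pu a i = ≤-trans (⊓-glb (wx≤px a i) (m≤n*m (w a * x a i) P)) (≤-reflexive (sym (*-distribˡ-⊓ P (x a i) _)))
    mass≤ : ∀ i X → mass finA (λ a → w a * x a i) X ≤ P * cap i X
    mass≤ i X = ≤-trans (⊓-glb all by-groups) (≤-reflexive (sym (*-distribˡ-⊓ P (d i) _)))
      where
      all : mass finA (λ a → w a * x a i) X ≤ P * d i
      all = ≤-trans (S-mono as (λ a → ⟦⟧*-≤ (X a) _)) (≤-reflexive (cols i))
      group : G → ℕ
      group ℓ = mass finA (λ a → FG.δ ℓ (g i a) * (w a * x a i)) X
      group≤part : ∀ ℓ → group ℓ ≤ P * (κ i ℓ ⊓ part i ℓ X)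
      group≤part ℓ = ≤-trans (⊓-glb
        (≤-trans (S-mono as (λ a → ⟦⟧*-≤ (X a) _)) (caps i ℓ))
        (≤-trans (S-mono as (λ a → ≤-trans (*-monoʳ-≤ ⟦ X a ⟧ (*-monoʳ-≤ (FG.δ ℓ (g i a)) (wx≤Pu a i)))
          (≤-reflexive (rearrange ⟦ X a ⟧ (FG.δ ℓ (g i a)) P (u a i))))) (≤-reflexive (S-*ˡ as P _))))
        (≤-reflexive (sym (*-distribˡ-⊓ P (κ i ℓ) _)))
        where
        rearrange : ∀ e f P u → e * (f * (P * u)) ≡ P * (e * (f * u))
        rearrange = solve-∀
      by-groups : mass finA (λ a → w a * x a i) X ≤ P * S gs (λ ℓ → κ i ℓ ⊓ part i ℓ X)
      by-groups = begin
        mass finA (λ a → w a * x a i) X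
          ≡⟨ S-cong as (λ a → sym (FG.S-δ-sym (g i a) (λ _ → ⟦ X a ⟧ * (w a * x a i)))) ⟩
        S as (λ a → S gs (λ ℓ → FG.δ ℓ (g i a) * (⟦ X a ⟧ * (w a * x a i))))
          ≡⟨ S-swap as gs _ ⟩
        S gs (λ ℓ → S as (λ a → FG.δ ℓ (g i a) * (⟦ X a ⟧ * (w a * x a i))))
          ≡⟨ S-cong gs (λ ℓ → S-cong as (λ a → *-swap (FG.δ ℓ (g i a)) ⟦ X a ⟧ (w a * x a i))) ⟩
        S gs group
          ≤⟨ S-mono gs group≤part ⟩
        S gs (λ ℓ → P * (κ i ℓ ⊓ part i ℓ X))
          ≡⟨ S-*ˡ gs P _ ⟩
        P * S gs (λ ℓ → κ i ℓ ⊓ part i ℓ X) ∎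
    -- The matrix w x / P has row sums `ρ` and obeys all caps; multiplied by P, this is Hall's
    -- condition.
    hall : Hall finA finC ρ cap
    hall X = *-cancelˡ-≤ P (begin
      P * mass finA ρ X                                      ≡⟨ sym (S-*ˡ as P _) ⟩
      S as (λ a → P * (⟦ X a ⟧ * ρ a))                       ≡⟨ S-cong as (λ a → *-swap P ⟦ X a ⟧ (ρ a)) ⟩
      S as (λ a → ⟦ X a ⟧ * (P * ρ a))                       ≡⟨ S-cong as (λ a → cong (⟦ X a ⟧ *_) (sym (rows a))) ⟩
      S as (λ a → ⟦ X a ⟧ * S cs (λ i → w a * x a i))        ≡⟨ S-cong as (λ a → sym (S-*ˡ cs ⟦ X a ⟧ _)) ⟩
      S as (λ a → S cs (λ i → ⟦ X a ⟧ * (w a * x a i)))      ≡⟨ S-swap as cs _ ⟩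
      S cs (λ i → mass finA (λ a → w a * x a i) X)           ≤⟨ S-mono cs (λ i → mass≤ i X) ⟩
      S cs (λ i → P * cap i X)                                 ≡⟨ S-*ˡ cs P _ ⟩
      P * S cs (λ i → cap i X) ∎)
    sol = rado finA finC (S as ρ) ρ cap refl pol hall
    y : A → Col → ℕ
    y = proj₁ sol
    single : A → A → Bool
    single a b = ⌊ b FA.== a ⌋
    y≤u : ∀ a i → y a i ≤ u a i
    y≤u a i = begin
      y a i                                                  ≡⟨ sym (FA.S-δ a (λ b → y b i)) ⟩
      mass finA (λ b → y b i) (single a)                     ≤⟨ proj₂ (proj₂ sol) i (single a) ⟩
      cap i (single a)                                         ≤⟨ m⊓n≤n (d i) _ ⟩
      S gs (λ ℓ → κ i ℓ ⊓ part i ℓ (single a))               ≤⟨ S-mono gs (λ ℓ → m⊓n≤n (κ i ℓ) _) ⟩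
      S gs (λ ℓ → part i ℓ (single a))                       ≡⟨ S-cong gs (λ ℓ → FA.S-δ a (λ b → FG.δ ℓ (g i b) * u b i)) ⟩
      S gs (λ ℓ → FG.δ ℓ (g i a) * u a i)                    ≡⟨ FG.S-δ-sym (g i a) (λ _ → u a i) ⟩
      u a i ∎
    col≤ : ∀ i → S as (λ a → y a i) ≤ d i
    col≤ i = begin
      S as (λ a → y a i)                    ≡⟨ S-cong as (λ a → sym (*-identityˡ (y a i))) ⟩
      mass finA (λ a → y a i) (λ _ → true)  ≤⟨ proj₂ (proj₂ sol) i (λ _ → true) ⟩
      cap i (λ _ → true)                      ≤⟨ m⊓n≤m (d i) _ ⟩
      d i ∎
    totals : S cs (λ i → S as (λ a → y a i)) ≡ S cs d
    totals = trans (sym (S-swap as cs y)) (trans (S-cong as (proj₁ (proj₂ sol))) (*-cancelˡ-≡ _ _ P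
      (trans (sym (S-*ˡ as P ρ)) (trans (S-cong as (λ a → sym (rows a))) (trans (S-swap as cs _)
        (trans (S-cong cs cols) (S-*ˡ cs P d)))))))
    group≤ : ∀ i ℓ → S as (λ a → FG.δ ℓ (g i a) * y a i) ≤ κ i ℓ
    group≤ i ℓ = begin
      mass finA (λ a → y a i) inℓ           ≤⟨ proj₂ (proj₂ sol) i inℓ ⟩
      cap i inℓ                               ≤⟨ m⊓n≤n (d i) _ ⟩
      S gs (λ ℓ' → κ i ℓ' ⊓ part i ℓ' inℓ)  ≤⟨ S-mono gs only ⟩
      S gs (λ ℓ' → FG.δ ℓ ℓ' * κ i ℓ')      ≡⟨ FG.S-δ ℓ (κ i) ⟩
      κ i ℓ ∎
      where
      inℓ : A → Bool
      inℓ a = ⌊ g i a FG.== ℓ ⌋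
      only : ∀ ℓ' → κ i ℓ' ⊓ part i ℓ' inℓ ≤ FG.δ ℓ ℓ' * κ i ℓ'
      only ℓ' with ℓ' FG.== ℓ
      ... | yes refl = ≤-trans (m⊓n≤m _ _) (≤-reflexive (sym (+-identityʳ _)))
      ... | no ne = ≤-trans (m⊓n≤n (κ i ℓ') _) (≤-reflexive (S-zero as zeros))
        where
        zeros : ∀ a → ⟦ inℓ a ⟧ * (FG.δ ℓ' (g i a) * u a i) ≡ 0
        zeros a with g i a FG.== ℓ
        ... | no _ = refl
        ... | yes refl rewrite FG.δ-≢ (λ e → ne (sym e)) = refl

-- Amalgams and detachments

S-tabulate : ∀ {n} (g : Fin n → A) (f : A → ℕ) → S (tabulate g) f ≡ ∑ (λ i → f (g i))
S-tabulate {n = zero}  g f = refl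
S-tabulate {n = suc n} g f = cong (f (g Fin.zero) +_) (S-tabulate (g ∘ Fin.suc) f)

S-allFin : ∀ n (f : Fin n → ℕ) → S (allFin n) f ≡ ∑ f
S-allFin n = S-tabulate id

⌊suc≟suc⌋ : ∀ {n} (v w : Fin n) → ⌊ Fin.suc v Finₚ.≟ Fin.suc w ⌋ ≡ ⌊ v Finₚ.≟ w ⌋
⌊suc≟suc⌋ v w = ⌊⌋-⇔ Finₚ.suc-injective (cong Fin.suc) (Fin.suc v Finₚ.≟ Fin.suc w) (v Finₚ.≟ w)

∑-cong : ∀ {n} {f g : Fin n → ℕ} → (∀ i → f i ≡ g i) → ∑ f ≡ ∑ g
∑-cong {zero}  e = refl
∑-cong {suc n} e = cong₂ _+_ (e Fin.zero) (∑-cong (e ∘ Fin.suc))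

finFin : ∀ n → Finite (Fin n)
finFin n = record
  { elems = allFin n
  ; _==_  = Finₚ._≟_
  ; once  = λ a → trans (S-allFin n _) (count a)
  }
  where
  none : ∀ n → ∑ {n} (λ _ → 0) ≡ 0
  none zero    = refl
  none (suc n) = none n
  count : ∀ {n} (a : Fin n) → ∑ (λ x → ⟦ ⌊ x Finₚ.≟ a ⌋ ⟧) ≡ 1
  count {suc n} Fin.zero    = cong suc (none n)
  count {suc n} (Fin.suc a) = trans (∑-cong (λ x → cong ⟦_⟧ (⌊suc≟suc⌋ x a))) (count a)

vecs : ∀ t → List (Vec Bool t)
vecs zero    = [] ∷ []
vecs (suc t) = map (true ∷_) (vecs t) ++ map (false ∷_) (vecs t)

S-vecs : ∀ t (f : Vec Bool (suc t) → ℕ) →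
  S (vecs (suc t)) f ≡ S (vecs t) (f ∘ (true ∷_)) + S (vecs t) (f ∘ (false ∷_))
S-vecs t f = trans (S-++ (map (true ∷_) (vecs t)) _ f) (cong₂ _+_ (S-map _ (vecs t) f) (S-map _ (vecs t) f))

finVec : ∀ t → Finite (Vec Bool t)
finVec t = record { elems = vecs t ; _==_ = ≡-dec Boolₚ._≟_ ; once = count t }
  where
  _≟ᵛ_ : ∀ {t} → DecidableEquality (Vec Bool t)
  _≟ᵛ_ = ≡-dec Boolₚ._≟_
  same : ∀ {t} b (x a : Vec Bool t) → ⟦ ⌊ (b ∷ x) ≟ᵛ (b ∷ a) ⌋ ⟧ ≡ ⟦ ⌊ x ≟ᵛ a ⌋ ⟧
  same b x a = cong ⟦_⟧ (⌊⌋-⇔ (λ { refl → refl }) (cong (b ∷_)) ((b ∷ x) ≟ᵛ (b ∷ a)) (x ≟ᵛ a))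
  differ : ∀ {t} b b' (x a : Vec Bool t) → b ≢ b' → ⟦ ⌊ (b ∷ x) ≟ᵛ (b' ∷ a) ⌋ ⟧ ≡ 0
  differ b b' x a ne = cong ⟦_⟧ (⌊⌋-no ((b ∷ x) ≟ᵛ (b' ∷ a)) (λ { refl → ne refl }))
  count : ∀ t (a : Vec Bool t) → S (vecs t) (λ x → ⟦ ⌊ x ≟ᵛ a ⌋ ⟧) ≡ 1
  count zero    []          = refl
  count (suc t) (true ∷ a)  = trans (S-vecs t _) (trans (cong₂ _+_
    (trans (S-cong (vecs t) (λ x → same true x a)) (count t a))
    (S-zero (vecs t) (λ x → differ false true x a λ ()))) refl)
  count (suc t) (false ∷ a) = trans (S-vecs t _) (cong₂ _+_
    (S-zero (vecs t) (λ x → differ true false x a λ ()))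
    (trans (S-cong (vecs t) (λ x → same false x a)) (count t a)))

fin⊤ : Finite ⊤
fin⊤ = record { elems = tt ∷ [] ; _==_ = λ _ _ → yes refl ; once = λ _ → refl }

finProduct : Finite A → Finite B → Finite (A × B)
finProduct finA finB = record
  { elems = cartesianProduct FA.elems FB.elems
  ; _==_  = ×-≡-dec FA._==_ FB._==_
  ; once  = λ (a , b) → trans (S-cartesianProduct FA.elems FB.elems _) (trans
      (S-cong FA.elems (λ x → trans (S-cong FB.elems (λ y → split x y a b))
        (trans (S-*ˡ FB.elems (FA.δ a x) (FB.δ b)) (cong (FA.δ a x *_) (FB.once b)))))
      (trans (S-*ʳ FA.elems 1 (FA.δ a)) (cong (_* 1) (FA.once a))))
  }
  where
  module FA = Finite finA
  module FB = Finite finB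
  ⌊×⌋ : ∀ {P Q : Set} (p : Dec P) (q : Dec Q) → ⟦ ⌊ p ×-dec q ⌋ ⟧ ≡ ⟦ ⌊ p ⌋ ⟧ * ⟦ ⌊ q ⌋ ⟧
  ⌊×⌋ (yes _) (yes _) = refl
  ⌊×⌋ (yes _) (no _)  = refl
  ⌊×⌋ (no _)  _       = refl
  split : ∀ x y a b → ⟦ ⌊ ×-≡-dec FA._==_ FB._==_ (x , y) (a , b) ⌋ ⟧ ≡ FA.δ a x * FB.δ b y
  split x y a b = trans (cong ⟦_⟧ (⌊⌋-⇔ (λ { refl → refl , refl }) (λ { (refl , refl) → refl })
    (×-≡-dec FA._==_ FB._==_ (x , y) (a , b)) ((x FA.== a) ×-dec (y FB.== b)))) (⌊×⌋ (x FA.== a) (y FB.== b))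

-- Counting the extensions of a set

card : ∀ {t} → Vec Bool t → ℕ
card []      = 0
card (b ∷ A) = ⟦ b ⟧ + card A

-- The number of ways to extend a set of size a to a set of size h by elements of a p-set.
bin : ℕ → ℕ → ℕ → ℕ
bin p h       zero    = p C h
bin p zero    (suc a) = 0
bin p (suc h) (suc a) = bin p h a

C-pascal : ∀ n k → suc n C suc k ≡ n C suc k + n C k
C-pascal n k = trans (sym (nCk+nC[k+1]≡[n+1]C[k+1] n k)) (+-comm (n C k) _)

C-absorb : ∀ n k → suc k * (suc n C suc k) ≡ suc n * (n C k)
C-absorb zero    zero    = refl
C-absorb zero    (suc k) = trans (cong (suc (suc k) *_) (k>n⇒nCk≡0 {1} {suc (suc k)} (s≤s (s≤s z≤n))))
  (trans (*-zeroʳ (suc (suc k))) (sym (trans (+-identityʳ _) (k>n⇒nCk≡0 {0} {suc k} (s≤s z≤n)))))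
C-absorb (suc n) zero    = trans (+-identityʳ _) (trans (nC1≡n (suc (suc n))) (sym (*-identityʳ (suc (suc n)))))
C-absorb (suc n) (suc k) = begin
  suc (suc k) * (suc (suc n) C suc (suc k))
    ≡⟨ cong (suc (suc k) *_) (C-pascal (suc n) (suc k)) ⟩
  suc (suc k) * (suc n C suc (suc k) + suc n C suc k)
    ≡⟨ expand (suc k) (suc n C suc (suc k)) (suc n C suc k) ⟩
  suc (suc k) * (suc n C suc (suc k)) + suc k * (suc n C suc k) + suc n C suc k
    ≡⟨ cong₂ (λ u v → u + v + suc n C suc k) (C-absorb n (suc k)) (C-absorb n k) ⟩
  suc n * (n C suc k) + suc n * (n C k) + suc n C suc k
    ≡⟨ cong (_+ suc n C suc k) (sym (*-distribˡ-+ (suc n) (n C suc k) (n C k))) ⟩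
  suc n * (n C suc k + n C k) + suc n C suc k
    ≡⟨ cong (λ u → suc n * u + suc n C suc k) (sym (C-pascal n k)) ⟩
  suc n * (suc n C suc k) + suc n C suc k
    ≡⟨ +-comm (suc n * (suc n C suc k)) _ ⟩
  suc (suc n) * (suc n C suc k) ∎
  where
  open ≡-Reasoning
  expand : ∀ k a b → (1 + k) * (a + b) ≡ (1 + k) * a + k * b + b
  expand = solve-∀

C0 : ∀ n → n C 0 ≡ 1
C0 zero    = refl
C0 (suc n) = refl

bin-pascal : ∀ p h a → bin (suc p) h a ≡ bin p h a + bin p h (suc a)
bin-pascal p zero    zero    = trans (C0 (suc p)) (sym (trans (+-identityʳ _) (C0 p)))
bin-pascal p (suc h) zero    = C-pascal p h
bin-pascal p zero    (suc a) = refl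
bin-pascal p (suc h) (suc a) = bin-pascal p h a

-- Double counting of pairs formed by an extension and one of its added elements. It makes the
-- fraction 1/(p+1) of a weighted row total an integer.
bin-absorb : ∀ p h a → (h ∸ a) * bin (suc p) h a ≡ suc p * bin p h (suc a)
bin-absorb p zero    zero    = sym (*-zeroʳ (suc p))
bin-absorb p (suc h) zero    = C-absorb p h
bin-absorb p zero    (suc a) = sym (*-zeroʳ (suc p))
bin-absorb p (suc h) (suc a) = bin-absorb p h a

bin-positive : ∀ p h a → 0 < bin p h a → h ∸ a ≤ p
bin-positive p h zero pos with h ≤? p
... | yes h≤p = h≤p
... | no  h≰p = contradiction (subst (0 <_) (k>n⇒nCk≡0 (≰⇒> h≰p)) pos) λ ()
bin-positive p (suc h) (suc a) pos = bin-positive p h a pos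

-- `bin 0 h a` is one for a = h and zero otherwise. Below, `bin 0 j (card A)` serves as the
-- indicator of the sets of size j.
bin0-positive : ∀ h a → 0 < bin 0 h a → a ≡ h
bin0-positive zero    zero    _ = refl
bin0-positive (suc h) zero    p = contradiction (subst (0 <_) (k>n⇒nCk≡0 {0} {suc h} (s≤s z≤n)) p) λ ()
bin0-positive (suc h) (suc a) p = cong suc (bin0-positive h a p)

positive-factorʳ : ∀ a {b} → 0 < a * b → 0 < b
positive-factorʳ a {zero}  pos = contradiction (subst (0 <_) (*-zeroʳ a) pos) λ ()
positive-factorʳ a {suc b} pos = s≤s z≤n

positive-factorˡ : ∀ {a} b → 0 < a * b → 0 < a
positive-factorˡ {suc a} b pos = s≤s z≤n

-- A partially detached hypergraph.  Its vertices are u positions together with an amalgam of p further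
-- vertices; an edge is recorded by its kind η, which fixes the number h η of its vertices under
-- consideration, and by the set A of positions that it contains, so that it meets the amalgam
-- h η ∸ card A times.  There are x η A i such edges of colour i.
module Amalgams {H Col : Set} (finH : Finite H) (finC : Finite Col) (h Λ : H → ℕ) (d : Col → ℕ) where
  private
    hs = Finite.elems finH
    cs = Finite.elems finC

  record Amalgam (u p : ℕ) (x : H → Vec Bool u → Col → ℕ) : Set where
    field
      multiplicity : ∀ η A → S cs (x η A) ≡ Λ η * bin p (h η) (card A)
      weight       : ∀ i → S hs (λ η → S (vecs u) (λ A → (h η ∸ card A) * x η A i)) ≡ p * d i
      degree       : ∀ i v → S hs (λ η → S (vecs u) (λ A → ⟦ lookup A v ⟧ * x η A i)) ≡ d i

  -- An edge counted by `y` trades one incidence with the amalgam for the new vertex, which becomes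
  -- position zero. Since `y` is at most `x`, no edge does so twice, and hence no edge repeats a
  -- detached vertex.
  split : ∀ {u} → (H → Vec Bool u → Col → ℕ) → (H × Vec Bool u → Col → ℕ) → H → Vec Bool (suc u) → Col → ℕ
  split x y η (true ∷ A)  i = y (η , A) i
  split x y η (false ∷ A) i = x η A i ∸ y (η , A) i

  module _ {u p : ℕ} {x : H → Vec Bool u → Col → ℕ} (am : Amalgam u (suc p) x) where
    open Amalgam am

    Detachment : {G : Set} → Finite G → (Col → H × Vec Bool u → G) → (Col → G → ℕ) → Set
    Detachment finG g κ = Rounding (finProduct finH (finVec u)) finC finG (λ (η , A) → x η A)
      (λ (η , A) → h η ∸ card A) (λ (η , A) → Λ η * bin p (h η) (suc (card A))) d g κ

    -- If an edge met the amalgam more often than it has vertices, its row total would contain a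
    -- vanishing binomial coefficient. Hence no row is asked to give away more than all its edges.
    x-positive : ∀ {η A i} → 0 < x η A i → h η ∸ card A ≤ suc p
    x-positive {η} {A} {i} pos = bin-positive (suc p) (h η) (card A) (positive-factorʳ (Λ η) (begin
      1                                        ≤⟨ pos ⟩
      x η A i                                  ≤⟨ Finite.S-term finC (x η A) i ⟩
      S cs (x η A)                             ≡⟨ multiplicity η A ⟩
      Λ η * bin (suc p) (h η) (card A) ∎))
      where
      open ≤-Reasoning

    abstract
      -- Integrality of the row sums is `bin-absorb`, that of the column sums is `weight`. Only the
      -- caps on the groups depend on the application.
      detach : {G : Set} (finG : Finite G) (g : Col → H × Vec Bool u → G) (κ : Col → G → ℕ) →
        (∀ i ℓ → S hs (λ η → S (vecs u) (λ A → Finite.δ finG ℓ (g i (η , A)) * ((h η ∸ card A) * x η A i)))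
          ≤ suc p * κ i ℓ) →
        Detachment finG g κ
      detach finG g κ caps = rounding (finProduct finH (finVec u)) finC finG
        (λ (η , A) → x η A) (λ (η , A) → h η ∸ card A) p (λ (η , A) → Λ η * bin p (h η) (suc (card A))) d g κ
        (λ (η , A) → trans (S-*ˡ cs (h η ∸ card A) (x η A)) (trans (cong ((h η ∸ card A) *_) (multiplicity η A))
          (trans (*-swap (h η ∸ card A) (Λ η) _) (trans (cong (Λ η *_) (bin-absorb p (h η) (card A)))
            (*-swap (Λ η) (suc p) _)))))
        (λ i → trans (S-cartesianProduct hs (vecs u) _) (weight i))
        (λ (η , A) i → bound η A i)
        (λ i ℓ → ≤-trans (≤-reflexive (S-cartesianProduct hs (vecs u) _)) (caps i ℓ))
        where
        bound : ∀ η A i → (h η ∸ card A) * x η A i ≤ suc p * x η A i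
        bound η A i with x η A i in eq
        ... | zero  = ≤-reflexive (trans (*-zeroʳ (h η ∸ card A)) (sym (*-zeroʳ (suc p))))
        ... | suc k = *-monoˡ-≤ (suc k) (x-positive (subst (0 <_) (sym eq) (s≤s z≤n)))

    module _ {G : Set} {finG : Finite G} {g : Col → H × Vec Bool u → G} {κ : Col → G → ℕ}
             (det : Detachment finG g κ) where
      open Rounding det

      y-total : ∀ i → S hs (λ η → S (vecs u) (λ A → y (η , A) i)) ≡ d i
      y-total i = trans (sym (S-cartesianProduct hs (vecs u) _)) (col-sum i)

      split-weight : ∀ η A i → (h η ∸ suc (card A)) * y (η , A) i
        + (h η ∸ card A) * (x η A i ∸ y (η , A) i) + y (η , A) i ≡ (h η ∸ card A) * x η A i
      split-weight η A i rewrite sym (pred[m∸n]≡m∸[1+n] (h η) (card A))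
        with h η ∸ card A | y≤wx (η , A) i
      -- The edges have no incidence with the amalgam left to trade. Only `y≤wx` excludes a transfer
      -- here, because the truncated difference would not.
      ... | zero  | y≤0 = n≤0⇒n≡0 y≤0
      ... | suc w | _   = trans (arith w (y (η , A) i) (x η A i ∸ y (η , A) i))
        (cong (suc w *_) (m∸n+n≡m (y≤x (η , A) i)))
        where
        arith : ∀ w y z → w * y + (1 + w) * z + y ≡ (1 + w) * (z + y)
        arith = solve-∀

      split-amalgam : Amalgam (suc u) p (split x y)
      split-amalgam = record { multiplicity = mult ; weight = wt ; degree = deg' }
        where
        mult : ∀ η A → S cs (split x y η A) ≡ Λ η * bin p (h η) (card A)
        mult η (true ∷ A)  = row-sum (η , A)
        mult η (false ∷ A) = +-cancelʳ-≡ (S cs (y (η , A))) _ _ (begin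
          S cs (λ i → x η A i ∸ y (η , A) i) + S cs (y (η , A))
            ≡⟨ sym (S-+ cs _ _) ⟩
          S cs (λ i → x η A i ∸ y (η , A) i + y (η , A) i)
            ≡⟨ S-cong cs (λ i → m∸n+n≡m (y≤x (η , A) i)) ⟩
          S cs (x η A)
            ≡⟨ multiplicity η A ⟩
          Λ η * bin (suc p) (h η) (card A)
            ≡⟨ cong (Λ η *_) (bin-pascal p (h η) (card A)) ⟩
          Λ η * (bin p (h η) (card A) + bin p (h η) (suc (card A)))
            ≡⟨ *-distribˡ-+ (Λ η) _ _ ⟩
          Λ η * bin p (h η) (card A) + Λ η * bin p (h η) (suc (card A))
            ≡⟨ cong (Λ η * bin p (h η) (card A) +_) (sym (row-sum (η , A))) ⟩
          Λ η * bin p (h η) (card A) + S cs (y (η , A)) ∎)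
          where open ≡-Reasoning
        wt : ∀ i → S hs (λ η → S (vecs (suc u)) (λ A → (h η ∸ card A) * split x y η A i)) ≡ p * d i
        wt i = +-cancelʳ-≡ (d i) _ _ (trans (trans (cong₂ _+_
            (S-cong hs (λ η → trans (S-vecs u _) (sym (S-+ (vecs u) _ _)))) (sym (y-total i)))
          (trans (sym (S-+ hs _ _)) (S-cong hs (λ η → trans (sym (S-+ (vecs u) _ _))
            (S-cong (vecs u) (λ A → split-weight η A i))))))
          (trans (weight i) (+-comm (d i) (p * d i))))
        deg' : ∀ i v → S hs (λ η → S (vecs (suc u)) (λ A → ⟦ lookup A v ⟧ * split x y η A i)) ≡ d i
        deg' i Fin.zero = trans (S-cong hs (λ η → trans (S-vecs u _) (trans (cong₂ _+_
          (S-cong (vecs u) (λ A → +-identityʳ _)) (S-zero (vecs u) (λ _ → refl))) (+-identityʳ _)))) (y-total i)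
        deg' i (Fin.suc v) = trans (S-cong hs (λ η → trans (S-vecs u _) (trans (sym (S-+ (vecs u) _ _))
          (S-cong (vecs u) (λ A → trans (sym (*-distribˡ-+ ⟦ lookup A v ⟧ _ _))
            (cong (⟦ lookup A v ⟧ *_) (m+[n∸m]≡n (y≤x (η , A) i)))))))) (degree i v)

      split-total : ∀ η i → S (vecs (suc u)) (λ A → split x y η A i) ≡ S (vecs u) (λ A → x η A i)
      split-total η i = trans (S-vecs u _) (trans (sym (S-+ (vecs u) _ _))
        (S-cong (vecs u) (λ A → m+[n∸m]≡n (y≤x (η , A) i))))

  -- A single group capped by the full degree restricts nothing. That splitting preserves the number
  -- of edges of each kind and colour is recorded because the weights of the next phase depend on
  -- it.
  complete-detachment : ∀ {m} {x₀ : H → Vec Bool 0 → Col → ℕ} → Amalgam 0 m x₀ → ∀ u p → u + p ≡ m →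
    ∃ λ x → Amalgam u p x × (∀ η i → S (vecs u) (λ A → x η A i) ≡ x₀ η [] i)
  complete-detachment {x₀ = x₀} am zero p refl = x₀ , am , λ η i → +-identityʳ _
  complete-detachment {m} {x₀} am (suc u) p e with complete-detachment am u (suc p) (trans (+-suc u p) e)
  ... | x , am' , tot = split x (Rounding.y det) , split-amalgam am' det ,
      λ η i → trans (split-total am' det η i) (tot η i)
    where
    det : Detachment am' fin⊤ (λ _ _ → tt) (λ i _ → d i)
    det = detach am' fin⊤ (λ _ _ → tt) (λ i _ → d i) λ i _ → ≤-reflexive (trans
      (S-cong hs (λ η → S-cong (vecs u) (λ A → +-identityʳ _))) (Amalgam.weight am' i))

-- Connected detachments

-- Label zero is kept for the empty set, that is, for edges inside the amalgam, which belong to no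
-- component. Otherwise the first member speaks for the whole set; this is sound when labels are
-- constant on edges.
lab : ∀ {u n} → (Fin u → Fin n) → Vec Bool u → Fin (suc n)
lab L []          = Fin.zero
lab L (true ∷ A)  = Fin.suc (L Fin.zero)
lab L (false ∷ A) = lab (L ∘ Fin.suc) A

lab-member : ∀ {u n} (L : Fin u → Fin n) A {ℓ} → lab L A ≡ Fin.suc ℓ → ∃ λ v → lookup A v ≡ true × L v ≡ ℓ
lab-member L (true ∷ A)  e = Fin.zero , refl , Finₚ.suc-injective e
lab-member L (false ∷ A) e with lab-member (L ∘ Fin.suc) A e
... | v , m , eq = Fin.suc v , m , eq

lab-empty : ∀ {u n} (L : Fin u → Fin n) A → lab L A ≡ Fin.zero → card A ≡ 0
lab-empty L []          e = refl
lab-empty L (false ∷ A) e = lab-empty (L ∘ Fin.suc) A e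

lift : ∀ {n k} → (Fin n → Fin k) → Fin (suc n) → Fin (suc k)
lift f Fin.zero    = Fin.zero
lift f (Fin.suc ℓ) = Fin.suc (f ℓ)

lab-∘ : ∀ {u n k} (f : Fin n → Fin k) (L : Fin u → Fin n) A → lab (f ∘ L) A ≡ lift f (lab L A)
lab-∘ f L []          = refl
lab-∘ f L (true ∷ A)  = refl
lab-∘ f L (false ∷ A) = lab-∘ f (L ∘ Fin.suc) A

⟦⟧-positive : ∀ {b n} → 0 < ⟦ b ⟧ * n → b ≡ true
⟦⟧-positive {true} _ = refl

abstract
  -- The first inequality keeps the fractional solution within the cap, and the second makes the cap
  -- small enough to leave part of a component behind.
  ceiling : ∀ W p → ∃ λ k → W ≤ suc p * k × suc p * k ≤ W + p
  ceiling W p = quo , +-cancelʳ-≤ p W _ (begin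
      W + p                                ≡⟨ division ⟩
      (W + p) % suc p + quo * suc p          ≤⟨ +-monoˡ-≤ _ (≤-pred (m%n<n (W + p) (suc p))) ⟩
      p + quo * suc p                        ≡⟨ +-comm p _ ⟩
      quo * suc p + p                        ≡⟨ cong (_+ p) (*-comm quo (suc p)) ⟩
      suc p * quo + p ∎) ,
    (begin
      suc p * quo                            ≡⟨ *-comm (suc p) quo ⟩
      quo * suc p                            ≤⟨ m≤n+m _ ((W + p) % suc p) ⟩
      (W + p) % suc p + quo * suc p          ≡⟨ sym division ⟩
      W + p ∎)
    where
    open ≤-Reasoning
    quo : ℕ
    quo = (W + p) / suc p
    division : W + p ≡ (W + p) % suc p + quo * suc p
    division = m≡m%n+[m/n]*n (W + p) (suc p)

-- New vertices enter at the head of the vector, so a set of old vertices reappears behind a block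
-- of `false`.
pad : ∀ j {m} → Vec Bool m → Vec Bool (j + m)
pad zero    A = A
pad (suc j) A = false ∷ pad j A

card-pad : ∀ j {m} (A : Vec Bool m) → card (pad j A) ≡ card A
card-pad zero    A = refl
card-pad (suc j) A = card-pad j A

card-sum : ∀ {t} (A : Vec Bool t) → ∑ (λ v → ⟦ lookup A v ⟧) ≡ card A
card-sum []      = refl
card-sum (b ∷ A) = cong (⟦ b ⟧ +_) (card-sum A)

card-positive : ∀ {t} (A : Vec Bool t) v → lookup A v ≡ true → 0 < card A
card-positive (true ∷ A)  _           e = s≤s z≤n
card-positive (false ∷ A) (Fin.suc v) e = card-positive A v e

-- Union-find: the sets are processed one after the other, and the labels met by a set are merged.
components : ∀ {u} (P : Vec Bool u → Set) → (∀ A → Dec (P A)) → ∃ λ (L : Fin u → Fin u) →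
  (∀ A → P A → ∀ v → lookup A v ≡ true → lab L A ≡ Fin.suc (L v)) ×
  (∀ v w → L v ≡ L w → Star (λ v w → ∃ λ A → P A × lookup A v ≡ true × lookup A w ≡ true) v w)
components {u} P P? = let L , uni , lnk = process (vecs u) in
  L , (λ A → uni (Finite.complete (finVec u) A)) , lnk
  where
  R : Fin u → Fin u → Set
  R v w = ∃ λ A → P A × lookup A v ≡ true × lookup A w ≡ true
  Uniform : (Fin u → Fin u) → Vec Bool u → Set
  Uniform L A = P A → ∀ v → lookup A v ≡ true → lab L A ≡ Fin.suc (L v)
  Result : List (Vec Bool u) → Set
  Result As = ∃ λ (L : Fin u → Fin u) → (∀ {A} → A ∈ As → Uniform L A) × (∀ v w → L v ≡ L w → Star R v w)
  join : ∀ A As → P A → Result As → Result (A ∷ As)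
  join A As pA (L , uni , lnk) with lab L A in eA
  ... | Fin.zero = L , (λ { (here refl) _ v e → contradiction (subst (0 <_) (lab-empty L A eA) (card-positive A v e)) (λ ())
                          ; (there p) → uni p }) , lnk
  ... | Fin.suc ℓ₀ = f ∘ L , uni' , lnk'
    where
    Meets : Fin u → Set
    Meets ℓ = ∃ λ w → lookup A w ≡ true × L w ≡ ℓ
    meets? : ∀ ℓ → Dec (Meets ℓ)
    meets? ℓ = Finₚ.any? (λ w → (lookup A w Boolₚ.≟ true) ×-dec (L w Finₚ.≟ ℓ))
    f : Fin u → Fin u
    f ℓ with meets? ℓ
    ... | yes _ = ℓ₀
    ... | no _  = ℓ
    f-meets : ∀ ℓ → Meets ℓ → f ℓ ≡ ℓ₀
    f-meets ℓ h with meets? ℓ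
    ... | yes _ = refl
    ... | no ¬h = contradiction h ¬h
    uni' : ∀ {B} → B ∈ A ∷ As → Uniform (f ∘ L) B
    uni' (here refl) _ v e = trans (lab-∘ f L A) (trans (cong (lift f) eA) (cong Fin.suc
      (trans (f-meets ℓ₀ (lab-member L A eA)) (sym (f-meets (L v) (v , e , refl))))))
    uni' {B} (there p) pB v e = trans (lab-∘ f L B) (cong (lift f) (uni p pB v e))
    lnk' : ∀ v w → f (L v) ≡ f (L w) → Star R v w
    lnk' v w e with meets? (L v) | meets? (L w)
    ... | yes (v₀ , v₀∈A , ev) | yes (w₀ , w₀∈A , ew) =
      lnk v v₀ (sym ev) ◅◅ (A , pA , v₀∈A , w₀∈A) ◅ lnk w₀ w ew
    ... | yes _ | no ¬h = contradiction (subst Meets e (lab-member L A eA)) ¬h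
    ... | no ¬h | yes _ = contradiction (subst Meets (sym e) (lab-member L A eA)) ¬h
    ... | no _  | no _  = lnk v w e
  process : ∀ As → Result As
  process []       = id , (λ ()) , λ { v .v refl → ε }
  process (A ∷ As) with P? A
  ... | yes pA = join A As pA (process As)
  ... | no ¬pA with process As
  ... | L , uni , lnk = L , (λ { (here refl) pA → contradiction pA ¬pA ; (there p) → uni p }) , lnk

-- Splitting off the new vertices

module _ {Col : Set} (finC : Finite Col) (l s : ℕ) (2≤s : 2 ≤ s) where
  private
    cs = Finite.elems finC

  open Amalgams fin⊤ finC (λ _ → 3) (λ _ → l) (λ _ → s)

  Triples : (u p : ℕ) → (Vec Bool u → Col → ℕ) → Set
  Triples u p x = Amalgam u p (λ _ → x)

  Linked : ∀ {u} → (Vec Bool u → Col → ℕ) → Col → Fin u → Fin u → Set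
  Linked x i v w = ∃ λ A → 0 < x A i × lookup A v ≡ true × lookup A w ≡ true

  labelδ : ∀ {n} → Fin n → Fin n → ℕ
  labelδ {n} = Finite.δ (finFin n)

  labelWeight : ∀ {u n} → (Vec Bool u → Col → ℕ) → (Fin u → Fin n) → Col → Fin (suc n) → ℕ
  labelWeight {u} x L i ℓ = S (vecs u) (λ A → labelδ ℓ (lab L A) * ((3 ∸ card A) * x A i))

  -- The labels are the components of a colour class after the amalgam is deleted.  The invariant behind
  -- connectedness is that every component meets the amalgam at least twice.
  record Labelling {u : ℕ} (x : Vec Bool u → Col → ℕ) (L : Col → Fin u → Fin u) : Set where
    field
      uniform : ∀ {A i v} → 0 < x A i → lookup A v ≡ true → lab (L i) A ≡ Fin.suc (L i v)
      linked  : ∀ {i v w} → L i v ≡ L i w → Star (Linked x i) v w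
      heavy   : ∀ i v → 2 ≤ labelWeight x (L i) i (Fin.suc (L i v))

  module Step {u p : ℕ} {x : Vec Bool u → Col → ℕ} {L : Col → Fin u → Fin u}
           (am : Triples u (suc p) x) (lbl : Labelling x L)
           {κ : Col → Fin (suc u) → ℕ}
           (det : Detachment am (finFin (suc u)) (λ i (_ , A) → lab (L i) A) κ) where
    open Amalgam am
    open Labelling lbl
    open Rounding det using (y≤x; row-sum; group-sum) renaming (y to ŷ)

    y : Vec Bool u → Col → ℕ
    y A i = ŷ (tt , A) i

    x⁺ : Vec Bool (suc u) → Col → ℕ
    x⁺ = split (λ _ → x) ŷ tt

    am⁺ : Triples (suc u) p x⁺
    am⁺ = split-amalgam am det

    taken : Col → Fin (suc u) → ℕ
    taken i ℓ = S (vecs u) (λ A → labelδ ℓ (lab (L i) A) * y A i)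

    taken≤κ : ∀ i ℓ → taken i ℓ ≤ κ i ℓ
    taken≤κ i ℓ = ≤-trans (≤-reflexive (sym (trans (S-cartesianProduct (tt ∷ []) (vecs u) _) (+-identityʳ _)))) (group-sum i ℓ)

    y-sum : ∀ i → S (vecs u) (λ A → y A i) ≡ s
    y-sum i = trans (sym (+-identityʳ _)) (y-total am det i)

    x-weight : ∀ i → S (vecs u) (λ A → (3 ∸ card A) * x A i) ≡ suc p * s
    x-weight i = trans (sym (+-identityʳ _)) (weight i)

    taken-positive : ∀ {i ℓ A} → lab (L i) A ≡ ℓ → 0 < y A i → 0 < taken i ℓ
    taken-positive {i} {ℓ} {A} refl pos = begin
      1                                   ≤⟨ pos ⟩
      y A i                               ≡⟨ sym (*-identityˡ (y A i)) ⟩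
      1 * y A i                           ≡⟨ cong (_* y A i) (sym (Finite.δ-refl (finFin (suc u)) ℓ)) ⟩
      labelδ ℓ (lab (L i) A) * y A i      ≤⟨ Finite.S-term (finVec u) (λ A → labelδ ℓ (lab (L i) A) * y A i) A ⟩
      taken i ℓ ∎
      where open ≤-Reasoning

    δ-positive : ∀ {n} (ℓ k : Fin n) {m} → 0 < labelδ ℓ k * m → k ≡ ℓ
    δ-positive ℓ k pos = ⌊⌋-true (k Finₚ.≟ ℓ) (⟦⟧-positive pos)

    taken-witness : ∀ {i ℓ} → 0 < taken i ℓ → ∃ λ A → lab (L i) A ≡ ℓ × 0 < y A i
    taken-witness {i} {ℓ} pos with S-positive (vecs u) _ pos
    ... | A , q = A , δ-positive ℓ _ q , positive-factorʳ (labelδ ℓ (lab (L i) A)) q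

    y⇒x : ∀ {A i} → 0 < y A i → 0 < x A i
    y⇒x pos = <-≤-trans pos (y≤x _ _)

    -- The set that witnesses a link may lose all its edges to the new vertex. If any edge moved,
    -- the enlarged set is a witness; otherwise the old set keeps its edges.
    linked⁺ : ∀ {i v w} → Star (Linked x i) v w → Star (Linked x⁺ i) (Fin.suc v) (Fin.suc w)
    linked⁺ ε = ε
    linked⁺ {i} ((A , pos , v∈A , w∈A) ◅ rest) with 1 ≤? y A i
    ... | yes 1≤y = (true ∷ A , 1≤y , v∈A , w∈A) ◅ linked⁺ rest
    ... | no  1≰y = (false ∷ A , subst (λ n → 0 < x A i ∸ n) (sym (n<1⇒n≡0 (≰⇒> 1≰y))) pos , v∈A , w∈A) ◅ linked⁺ rest

    to-new : ∀ {i v} → 0 < taken i (Fin.suc (L i v)) → Star (Linked x⁺ i) (Fin.suc v) Fin.zero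
    to-new {i} hit with taken-witness hit
    ... | A , e , pos with lab-member (L i) A e
    ... | w , w∈A , same = linked⁺ (linked (sym same)) ◅◅ (true ∷ A , pos , w∈A , refl) ◅ ε

    from-new : ∀ {i v} → 0 < taken i (Fin.suc (L i v)) → Star (Linked x⁺ i) Fin.zero (Fin.suc v)
    from-new {i} hit with taken-witness hit
    ... | A , e , pos with lab-member (L i) A e
    ... | w , w∈A , same = (true ∷ A , pos , refl , w∈A) ◅ linked⁺ (linked same)

    Hit : Col → Fin u → Set
    Hit i ℓ = 0 < taken i (Fin.suc ℓ)

    hit? : ∀ i ℓ → Dec (Hit i ℓ)
    hit? i ℓ = 1 ≤? taken i (Fin.suc ℓ)

    merge : Col → Fin u → Fin (suc u)
    merge i ℓ with hit? i ℓ
    ... | yes _ = Fin.zero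
    ... | no _  = Fin.suc ℓ

    merge-hit : ∀ {i ℓ} → Hit i ℓ → merge i ℓ ≡ Fin.zero
    merge-hit {i} {ℓ} h with hit? i ℓ
    ... | yes _ = refl
    ... | no ¬h = contradiction h ¬h

    merge-miss : ∀ {i ℓ} → ¬ Hit i ℓ → merge i ℓ ≡ Fin.suc ℓ
    merge-miss {i} {ℓ} ¬h with hit? i ℓ
    ... | yes h = contradiction h ¬h
    ... | no _  = refl

    L⁺ : Col → Fin (suc u) → Fin (suc u)
    L⁺ i Fin.zero    = Fin.zero
    L⁺ i (Fin.suc v) = merge i (L i v)

    uniform⁺ : ∀ {A i v} → 0 < x⁺ A i → lookup A v ≡ true → lab (L⁺ i) A ≡ Fin.suc (L⁺ i v)
    uniform⁺ {true ∷ A}  {i} {Fin.zero}  pos e = refl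
    uniform⁺ {true ∷ A}  {i} {Fin.suc v} pos e =
      cong Fin.suc (sym (merge-hit (taken-positive (uniform (y⇒x pos) e) pos)))
    uniform⁺ {false ∷ A} {i} {Fin.suc v} pos e = trans (lab-∘ (merge i) (L i) A)
      (cong (lift (merge i)) (uniform (<-≤-trans pos (m∸n≤m (x A i) (y A i))) e))

    linked-labels⁺ : ∀ {i v w} → L⁺ i v ≡ L⁺ i w → Star (Linked x⁺ i) v w
    linked-labels⁺ {i} {Fin.zero}  {Fin.zero}  e = ε
    linked-labels⁺ {i} {Fin.zero}  {Fin.suc w} e with hit? i (L i w)
    ... | yes h = from-new h
    linked-labels⁺ {i} {Fin.suc v} {Fin.zero}  e with hit? i (L i v)
    ... | yes h = to-new h
    linked-labels⁺ {i} {Fin.suc v} {Fin.suc w} e with hit? i (L i v) | hit? i (L i w)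
    ... | yes h | yes h' = to-new h ◅◅ from-new h'
    ... | no _  | no _   = linked⁺ (linked (Finₚ.suc-injective e))

    labelWeight⁺ : ∀ i ℓ → labelWeight x⁺ (L⁺ i) i (Fin.suc ℓ) ≡
      S (vecs u) (λ A → labelδ ℓ Fin.zero * ((3 ∸ suc (card A)) * y A i)
        + labelδ (Fin.suc ℓ) (lift (merge i) (lab (L i) A)) * ((3 ∸ card A) * (x A i ∸ y A i)))
    labelWeight⁺ i ℓ = trans (S-vecs u _) (trans (sym (S-+ (vecs u) _ _)) (S-cong (vecs u) (λ A →
      cong₂ _+_ (cong (λ b → ⟦ b ⟧ * ((3 ∸ suc (card A)) * y A i)) (⌊suc≟suc⌋ Fin.zero ℓ))
        (cong (λ k → labelδ (Fin.suc ℓ) k * ((3 ∸ card A) * (x A i ∸ y A i))) (lab-∘ (merge i) (L i) A)))))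

    -- A component that is not hit gives up no edge, so its weight is unchanged.
    heavy-miss : ∀ i v → ¬ Hit i (L i v) → 2 ≤ labelWeight x⁺ (L⁺ i) i (Fin.suc (Fin.suc (L i v)))
    heavy-miss i v miss = ≤-trans (heavy i v) (≤-trans (S-mono (vecs u) bound)
      (≤-reflexive (sym (labelWeight⁺ i (Fin.suc (L i v))))))
      where
      ℓ = L i v
      open ≤-Reasoning
      bound : ∀ A → labelδ (Fin.suc ℓ) (lab (L i) A) * ((3 ∸ card A) * x A i) ≤
        labelδ (Fin.suc ℓ) Fin.zero * ((3 ∸ suc (card A)) * y A i)
        + labelδ (Fin.suc (Fin.suc ℓ)) (lift (merge i) (lab (L i) A)) * ((3 ∸ card A) * (x A i ∸ y A i))
      bound A with lab (L i) A in eq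
      ... | k with k Finₚ.≟ Fin.suc ℓ
      ... | no _ = z≤n
      ... | yes refl = ≤-trans (≤-reflexive (cong (_+ 0) (cong ((3 ∸ card A) *_) x≡))) (≤-trans (≤-reflexive
            (cong (_* ((3 ∸ card A) * (x A i ∸ y A i))) (sym one))) (m≤n+m _ _))
        where
        y≡0 : y A i ≡ 0
        y≡0 = n<1⇒n≡0 (≰⇒> (λ pos → miss (taken-positive eq pos)))
        x≡ : x A i ≡ x A i ∸ y A i
        x≡ = cong (x A i ∸_) (sym y≡0)
        one : labelδ (Fin.suc (Fin.suc ℓ)) (Fin.suc (merge i ℓ)) ≡ 1
        one rewrite merge-miss miss = Finite.δ-refl (finFin _) (Fin.suc (Fin.suc ℓ))

    -- The weight that a set contributes to the component of the new vertex.
    new-weight : Col → Vec Bool u → ℕ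
    new-weight i A = (3 ∸ suc (card A)) * y A i
      + labelδ (Fin.suc Fin.zero) (lift (merge i) (lab (L i) A)) * ((3 ∸ card A) * (x A i ∸ y A i))

    new-weight-sum : ∀ i → labelWeight x⁺ (L⁺ i) i (Fin.suc Fin.zero) ≡ S (vecs u) (new-weight i)
    new-weight-sum i = trans (labelWeight⁺ i Fin.zero)
      (S-cong (vecs u) (λ A → cong (_+ labelδ (Fin.suc Fin.zero) (lift (merge i) (lab (L i) A)) * ((3 ∸ card A) * (x A i ∸ y A i)))
        (*-identityˡ ((3 ∸ suc (card A)) * y A i))))

    -- Every edge taken from the component gives up exactly one incidence with the amalgam; all
    -- remaining incidences pass to the component of the new vertex.
    new-weight-hit : ∀ i ℓ → Hit i ℓ →
      S (vecs u) (λ A → labelδ (Fin.suc ℓ) (lab (L i) A) * new-weight i A) + taken i (Fin.suc ℓ)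
        ≡ labelWeight x (L i) i (Fin.suc ℓ)
    new-weight-hit i ℓ hit = trans (sym (S-+ (vecs u) _ _)) (S-cong (vecs u) pointwise)
      where
      pointwise : ∀ A → labelδ (Fin.suc ℓ) (lab (L i) A) * new-weight i A + labelδ (Fin.suc ℓ) (lab (L i) A) * y A i
        ≡ labelδ (Fin.suc ℓ) (lab (L i) A) * ((3 ∸ card A) * x A i)
      pointwise A with lab (L i) A Finₚ.≟ Fin.suc ℓ
      ... | no _  = refl
      ... | yes e = begin
        1 * new-weight i A + 1 * y A i
          ≡⟨ cong₂ _+_ (*-identityˡ (new-weight i A)) (*-identityˡ (y A i)) ⟩
        new-weight i A + y A i
          ≡⟨ cong (λ n → (3 ∸ suc (card A)) * y A i + n * Z + y A i) one ⟩
        (3 ∸ suc (card A)) * y A i + 1 * Z + y A i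
          ≡⟨ cong (λ n → (3 ∸ suc (card A)) * y A i + n + y A i) (*-identityˡ Z) ⟩
        (3 ∸ suc (card A)) * y A i + Z + y A i
          ≡⟨ split-weight am det tt A i ⟩
        (3 ∸ card A) * x A i
          ≡⟨ sym (*-identityˡ _) ⟩
        1 * ((3 ∸ card A) * x A i) ∎
        where
        open ≡-Reasoning
        Z = (3 ∸ card A) * (x A i ∸ y A i)
        one : labelδ (Fin.suc Fin.zero) (lift (merge i) (lab (L i) A)) ≡ 1
        one rewrite e | merge-hit hit = refl

    all-hit⇒connected : (∀ i v → Hit i (L i v)) → ∀ i v w → Star (Linked x⁺ i) v w
    all-hit⇒connected hit i Fin.zero    Fin.zero    = ε
    all-hit⇒connected hit i Fin.zero    (Fin.suc w) = from-new (hit i w)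
    all-hit⇒connected hit i (Fin.suc v) Fin.zero    = to-new (hit i v)
    all-hit⇒connected hit i (Fin.suc v) (Fin.suc w) = to-new (hit i v) ◅◅ from-new (hit i w)

  -- Splits that leave an amalgamated vertex

  module LargeStep {u p : ℕ} {x : Vec Bool u → Col → ℕ} {L : Col → Fin u → Fin u}
           (am : Triples u (suc (suc p)) x) (lbl : Labelling x L)
           {κ : Col → Fin (suc u) → ℕ} (κ-small : ∀ i ℓ → suc (suc p) * κ i ℓ ≤ labelWeight x (L i) i ℓ + suc p)
           (det : Detachment am (finFin (suc u)) (λ i (_ , A) → lab (L i) A) κ) where
    open Labelling lbl
    open Step am lbl det

    private
      T : Col → ℕ
      T i = S (vecs u) (new-weight i)

    -- An edge inside the amalgam has three incidences with it and keeps two.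
    empty-hit : ∀ i A → lab (L i) A ≡ Fin.zero → 0 < y A i → 2 ≤ T i
    empty-hit i A e pos = ≤-trans (≤-trans (≤-trans (*-monoʳ-≤ 2 pos)
      (≤-reflexive (cong (λ n → (3 ∸ suc n) * y A i) (sym (lab-empty (L i) A e))))) (m≤m+n _ _))
      (Finite.S-term (finVec u) (new-weight i) A)

    restricted : Col → Fin u → ℕ
    restricted i ℓ = S (vecs u) (λ A → labelδ (Fin.suc ℓ) (lab (L i) A) * new-weight i A)

    witness-heavy : ∀ i A ℓ → lab (L i) A ≡ Fin.suc ℓ → 2 ≤ labelWeight x (L i) i (Fin.suc ℓ)
    witness-heavy i A ℓ e with lab-member (L i) A e
    ... | v , _ , refl = heavy i v

    restricted-positive : ∀ i A ℓ → lab (L i) A ≡ Fin.suc ℓ → 0 < y A i → 1 ≤ restricted i ℓ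
    restricted-positive i A ℓ e pos = +-cancelʳ-≤ (taken i (Fin.suc ℓ)) 1 _ (begin
      suc (taken i (Fin.suc ℓ))                     ≤⟨ taken<W ⟩
      W                                          ≡⟨ sym (new-weight-hit i ℓ (taken-positive e pos)) ⟩
      restricted i ℓ + taken i (Fin.suc ℓ) ∎)
      where
      open ≤-Reasoning
      W = labelWeight x (L i) i (Fin.suc ℓ)
      bound = κ i (Fin.suc ℓ)
      b<W : suc bound ≤ W
      b<W with suc bound ≤? W
      ... | yes q = q
      ... | no ¬q = contradiction (*-cancelˡ-≤ (suc p) (+-cancelˡ-≤ W _ _ (begin
          W + suc p * W              ≤⟨ *-monoʳ-≤ (suc (suc p)) (≤-pred (≰⇒> ¬q)) ⟩
          suc (suc p) * bound        ≤⟨ κ-small i (Fin.suc ℓ) ⟩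
          W + suc p                  ≡⟨ cong (W +_) (sym (*-identityʳ (suc p))) ⟩
          W + suc p * 1 ∎))) (<⇒≱ (witness-heavy i A ℓ e))
      taken<W : suc (taken i (Fin.suc ℓ)) ≤ W
      taken<W = ≤-trans (s≤s (taken≤κ i (Fin.suc ℓ))) b<W

    two-hits : ∀ i A B ℓ k → lab (L i) A ≡ Fin.suc ℓ → 0 < y A i → lab (L i) B ≡ Fin.suc k → 0 < y B i →
      k ≢ ℓ → 2 ≤ T i
    two-hits i A B ℓ k eA posA eB posB ne = ≤-trans
      (+-mono-≤ (restricted-positive i A ℓ eA posA) (restricted-positive i B k eB posB))
      (≤-trans (≤-reflexive (sym (S-+ (vecs u) _ _))) (S-mono (vecs u) disjoint))
      where
      disjoint : ∀ A → labelδ (Fin.suc ℓ) (lab (L i) A) * new-weight i A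
        + labelδ (Fin.suc k) (lab (L i) A) * new-weight i A ≤ new-weight i A
      disjoint A with lab (L i) A Finₚ.≟ Fin.suc ℓ | lab (L i) A Finₚ.≟ Fin.suc k
      ... | yes e | yes e' = contradiction (Finₚ.suc-injective (trans (sym e') e)) ne
      ... | yes _ | no _   = ≤-reflexive (trans (+-identityʳ _) (+-identityʳ _))
      ... | no _  | yes _  = ≤-reflexive (+-identityʳ _)
      ... | no _  | no _   = z≤n

    rest : Col → Fin u → ℕ
    rest i ℓ = S (vecs u) (λ A → ⟦ not ⌊ lab (L i) A Finₚ.≟ Fin.suc ℓ ⌋ ⟧ * ((3 ∸ card A) * x A i))

    not-true : ∀ {b} → not b ≡ true → b ≡ false
    not-true {false} _ = refl

    ⌊⌋-false : ∀ {P : Set} (p? : Dec P) → ⌊ p? ⌋ ≡ false → ¬ P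
    ⌊⌋-false (no ¬p) _ = ¬p

    -- What lies outside one component consists of whole components, each of weight at least two by
    -- `heavy`, and of edges inside the amalgam, each of weight three.
    rest≢1 : ∀ i ℓ → rest i ℓ ≢ 1
    rest≢1 i ℓ e with S-positive (vecs u) _ (subst (0 <_) (sym e) (s≤s z≤n))
    ... | A , pos = contradiction (subst (2 ≤_) e (two (lab (L i) A) refl)) λ { (s≤s ()) }
      where
      ¬e : lab (L i) A ≢ Fin.suc ℓ
      ¬e = ⌊⌋-false (lab (L i) A Finₚ.≟ Fin.suc ℓ) (not-true (⟦⟧-positive pos))
      posx : 0 < (3 ∸ card A) * x A i
      posx = positive-factorʳ ⟦ not ⌊ lab (L i) A Finₚ.≟ Fin.suc ℓ ⌋ ⟧ pos
      two : ∀ k → lab (L i) A ≡ k → 2 ≤ rest i ℓ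
      two Fin.zero ek = ≤-trans (≤-trans (m≤n+m 2 1) (≤-trans
        (≤-trans (*-monoʳ-≤ 3 (positive-factorʳ (3 ∸ card A) posx))
          (≤-reflexive (trans (cong (λ n → (3 ∸ n) * x A i) (sym (lab-empty (L i) A ek)))
            (sym (trans (cong (λ b → ⟦ not b ⟧ * ((3 ∸ card A) * x A i)) (⌊⌋-no (lab (L i) A Finₚ.≟ Fin.suc ℓ) ¬e))
              (+-identityʳ _))))))
          (Finite.S-term (finVec u) (λ A → ⟦ not ⌊ lab (L i) A Finₚ.≟ Fin.suc ℓ ⌋ ⟧ * ((3 ∸ card A) * x A i)) A))) ≤-refl
      two (Fin.suc k) ek = ≤-trans (witness-heavy i A k ek) (S-mono (vecs u) pointwise)
        where
        pointwise : ∀ B → labelδ (Fin.suc k) (lab (L i) B) * ((3 ∸ card B) * x B i)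
          ≤ ⟦ not ⌊ lab (L i) B Finₚ.≟ Fin.suc ℓ ⌋ ⟧ * ((3 ∸ card B) * x B i)
        pointwise B with lab (L i) B Finₚ.≟ Fin.suc k | lab (L i) B Finₚ.≟ Fin.suc ℓ
        ... | no _  | _      = z≤n
        ... | yes _ | no _   = ≤-refl
        ... | yes e | yes e' = contradiction (trans ek (trans (sym e) e')) ¬e

    rest-weight : ∀ i ℓ → labelWeight x (L i) i (Fin.suc ℓ) + rest i ℓ ≡ suc (suc p) * s
    rest-weight i ℓ = trans (sym (S-+ (vecs u) _ _)) (trans (S-cong (vecs u) (λ A →
      ⟦⟧-split ⌊ lab (L i) A Finₚ.≟ Fin.suc ℓ ⌋ _)) (x-weight i))

    -- The cap of the component is at least s, so its weight W is at least (p+2) s - (p+1). It has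
    -- to be at least s + 2, since s incidences are lost and two must remain. The bound suffices
    -- unless p = 0 and s = 2; there at most one unit of weight lies elsewhere, hence none by
    -- `rest≢1`.
    one-hit : ∀ i A ℓ → lab (L i) A ≡ Fin.suc ℓ → 0 < y A i → taken i (Fin.suc ℓ) ≡ s → 2 ≤ T i
    one-hit i A ℓ e pos all = ≤-trans (+-cancelʳ-≤ s 2 (restricted i ℓ)
        (≤-trans (arith p s W (rest i ℓ) 2≤s lower (rest-weight i ℓ) (rest≢1 i ℓ))
          (≤-reflexive (trans (sym (new-weight-hit i ℓ (taken-positive e pos)))
            (cong (restricted i ℓ +_) all)))))
      (S-mono (vecs u) (λ A → ⟦⟧*-≤ ⌊ lab (L i) A Finₚ.≟ Fin.suc ℓ ⌋ _))
      where
      W = labelWeight x (L i) i (Fin.suc ℓ)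
      lower : suc (suc p) * s ≤ W + suc p
      lower = ≤-trans (*-monoʳ-≤ (suc (suc p)) (≤-trans (≤-reflexive (sym all)) (taken≤κ i (Fin.suc ℓ))))
        (κ-small i (Fin.suc ℓ))
      arith : ∀ p s W R → 2 ≤ s → suc (suc p) * s ≤ W + suc p → W + R ≡ suc (suc p) * s → R ≢ 1 → 2 + s ≤ W
      arith p    (suc zero) W R (s≤s ()) low sum ne
      arith zero (suc (suc zero)) W R 2≤s low sum ne with R
      ... | zero        = ≤-reflexive (sym (trans (sym (+-identityʳ W)) sum))
      ... | suc zero    = contradiction refl ne
      ... | suc (suc R) = contradiction (≤-trans low (≤-reflexive (+-comm W 1)))
        (<⇒≱ (≤-trans (≤-trans (≤-reflexive (+-comm 2 W)) (+-monoʳ-≤ W (s≤s (s≤s z≤n)))) (≤-reflexive sum)))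
      arith zero (suc (suc (suc s))) W R 2≤s low sum ne = +-cancelʳ-≤ 1 _ _ (≤-trans
        (≤-trans (m≤m+n _ s) (≤-reflexive (eq s))) low)
        where
        eq : ∀ s → 2 + (3 + s) + 1 + s ≡ 2 * (3 + s)
        eq = solve-∀
      arith (suc p) (suc (suc s)) W R 2≤s low sum ne = +-cancelʳ-≤ (suc (suc p)) _ _ (≤-trans
        (≤-trans (m≤m+n _ (s + s + p + p * s)) (≤-reflexive (eq p s))) low)
        where
        eq : ∀ p s → 2 + (2 + s) + (2 + p) + (s + s + p + p * s) ≡ (3 + p) * (2 + s)
        eq = solve-∀

    heavy-new : ∀ i → 2 ≤ labelWeight (x⁺) (L⁺ i) i (Fin.suc Fin.zero)
    heavy-new i = subst (2 ≤_) (sym (new-weight-sum i)) (start (S-positive (vecs u) (λ A → y A i)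
      (subst (0 <_) (sym (y-sum i)) (≤-trans (s≤s z≤n) 2≤s))))
      where
      start : (∃ λ A → 0 < y A i) → 2 ≤ T i
      start (A , pos) with lab (L i) A in eA
      ... | Fin.zero  = empty-hit i A eA pos
      -- Either every edge taken carries the label of `A`, or some edge taken is empty or lies in a
      -- second component.
      ... | Fin.suc ℓ with 1 ≤? S (vecs u) (λ B → ⟦ not ⌊ lab (L i) B Finₚ.≟ Fin.suc ℓ ⌋ ⟧ * y B i)
      ... | no none = one-hit i A ℓ eA pos (trans (sym (+-identityʳ _)) (trans
          (cong (taken i (Fin.suc ℓ) +_) (sym (n<1⇒n≡0 (≰⇒> none)))) (trans (sym (S-+ (vecs u) _ _)) (trans
          (S-cong (vecs u) (λ B → ⟦⟧-split ⌊ lab (L i) B Finₚ.≟ Fin.suc ℓ ⌋ _)) (y-sum i)))))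
      ... | yes some with S-positive (vecs u) _ some
      ... | B , posB with lab (L i) B in eB
      ... | Fin.zero  = empty-hit i B eB (positive-factorʳ 1 posB)
      ... | Fin.suc k = two-hits i A B ℓ k eA pos eB
          (positive-factorʳ ⟦ not ⌊ Fin.suc k Finₚ.≟ Fin.suc ℓ ⌋ ⟧ posB)
          (λ e → ⌊⌋-false (Fin.suc k Finₚ.≟ Fin.suc ℓ) (not-true (⟦⟧-positive posB)) (cong Fin.suc e))

    labelling⁺ : Labelling (x⁺) (L⁺)
    labelling⁺ = record
      { uniform = λ {A} {i} {v} → uniform⁺ {A} {i} {v}
      ; linked  = λ {i} {v} {w} → linked-labels⁺ {i} {v} {w}
      ; heavy   = hv
      }
      where
      hv : ∀ i v → 2 ≤ labelWeight (x⁺) (L⁺ i) i (Fin.suc (L⁺ i v))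
      hv i Fin.zero = heavy-new i
      hv i (Fin.suc v) with hit? i (L i v)
      ... | yes h = heavy-new i
      ... | no ¬h = heavy-miss i v ¬h

  -- Every edge counted by `z` meets the amalgam, so two of them at `v` are enough. In the other
  -- alternative the component contains the three vertices of an old edge, each on an edge of `z`.
  -- Such an edge covers at most two of them, so twice the weight of the component is at least
  -- three.
  initial-labelling : ∀ {u} (x z : Vec Bool u → Col → ℕ) → (∀ A i → z A i ≤ x A i) →
    (∀ A i → 0 < z A i → card A ≤ 2) →
    (∀ i v → 2 ≤ S (vecs u) (λ A → ⟦ lookup A v ⟧ * z A i) ⊎
      ((∀ w → 1 ≤ S (vecs u) (λ A → ⟦ lookup A w ⟧ * z A i)) ×
       (∃ λ A → 3 ≤ card A × 0 < x A i × lookup A v ≡ true))) →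
    ∃ λ L → Labelling x L
  initial-labelling {u} x z z≤x z-small deg-z = (λ i → proj₁ (comp i)) , record
    { uniform = λ {A} {i} {v} pos → proj₁ (proj₂ (comp i)) A pos v
    ; linked  = λ {i} {v} {w} → proj₂ (proj₂ (comp i)) v w
    ; heavy   = λ i v → hv i v (deg-z i v)
    }
    where
    open ≤-Reasoning
    comp = λ i → components (λ A → 0 < x A i) (λ A → 1 ≤? x A i)
    L : Col → Fin u → Fin u
    L i = proj₁ (comp i)
    W : Col → Fin (suc u) → ℕ
    W i ℓ = labelWeight x (L i) i ℓ
    δ' : Fin (suc u) → Fin (suc u) → ℕ
    δ' = labelδ
    uniform : ∀ {A i v} → 0 < x A i → lookup A v ≡ true → lab (L i) A ≡ Fin.suc (L i v)
    uniform {A} {i} {v} pos = proj₁ (proj₂ (comp i)) A pos v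
    z-weight : ∀ A i → z A i ≤ (3 ∸ card A) * x A i
    z-weight A i with z A i in eq
    ... | zero  = z≤n
    ... | suc n = ≤-trans (≤-trans (≤-reflexive (sym eq)) (z≤x A i)) (≤-trans (≤-reflexive (sym (*-identityˡ _)))
      (*-monoˡ-≤ (x A i) (m<n⇒0<n∸m (s≤s (z-small A i (subst (0 <_) (sym eq) (s≤s z≤n)))))))
    hv : ∀ i v → _ → 2 ≤ W i (Fin.suc (L i v))
    hv i v (inj₁ two) = ≤-trans two (S-mono (vecs u) bound)
      where
      bound : ∀ A → ⟦ lookup A v ⟧ * z A i ≤ δ' (Fin.suc (L i v)) (lab (L i) A) * ((3 ∸ card A) * x A i)
      bound A with lookup A v in e | z A i in eq | z-weight A i
      ... | false | _     | _  = z≤n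
      ... | true  | zero  | _  = z≤n
      ... | true  | suc n | le = begin
        1 * suc n               ≤⟨ *-monoʳ-≤ 1 le ⟩
        1 * ((3 ∸ card A) * x A i)
          ≡⟨ cong (_* ((3 ∸ card A) * x A i)) (sym (trans (cong (δ' (Fin.suc (L i v)))
              (uniform (<-≤-trans (subst (0 <_) (sym eq) (s≤s z≤n)) (z≤x A i)) e)) (Finite.δ-refl (finFin (suc u)) _))) ⟩
        δ' (Fin.suc (L i v)) (lab (L i) A) * ((3 ∸ card A) * x A i) ∎
    hv i v (inj₂ (one , A₃ , 3≤c , posA₃ , v∈A₃)) = *-cancelˡ-< 2 1 _ (begin
      3                                                                  ≤⟨ 3≤c ⟩
      card A₃                                                            ≡⟨ sym (trans (S-allFin u _) (card-sum A₃)) ⟩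
      S vs (λ w → ⟦ lookup A₃ w ⟧)
        ≤⟨ S-mono vs (λ w → ≤-trans (≤-reflexive (sym (*-identityʳ _))) (*-monoʳ-≤ ⟦ lookup A₃ w ⟧ (one w))) ⟩
      S vs (λ w → ⟦ lookup A₃ w ⟧ * S (vecs u) (λ A → ⟦ lookup A w ⟧ * z A i))
        ≡⟨ S-cong vs (λ w → sym (S-*ˡ (vecs u) ⟦ lookup A₃ w ⟧ _)) ⟩
      S vs (λ w → S (vecs u) (λ A → ⟦ lookup A₃ w ⟧ * (⟦ lookup A w ⟧ * z A i)))
        ≡⟨ S-swap vs (vecs u) _ ⟩
      S (vecs u) (λ A → S vs (λ w → ⟦ lookup A₃ w ⟧ * (⟦ lookup A w ⟧ * z A i)))
        ≤⟨ S-mono (vecs u) (λ A → S-mono vs (bound A)) ⟩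
      S (vecs u) (λ A → S vs (λ w → ⟦ lookup A w ⟧ * (Δ A * z A i)))
        ≡⟨ S-cong (vecs u) (λ A → trans (S-*ʳ vs (Δ A * z A i) (λ w → ⟦ lookup A w ⟧))
            (cong (_* (Δ A * z A i)) (trans (S-allFin u _) (card-sum A)))) ⟩
      S (vecs u) (λ A → card A * (Δ A * z A i))
        ≤⟨ S-mono (vecs u) two ⟩
      S (vecs u) (λ A → 2 * (Δ A * ((3 ∸ card A) * x A i)))
        ≡⟨ S-*ˡ (vecs u) 2 _ ⟩
      2 * W i (Fin.suc (L i v)) ∎)
      where
      vs = allFin u
      Δ : Vec Bool u → ℕ
      Δ A = δ' (Fin.suc (L i v)) (lab (L i) A)
      bound : ∀ A w → ⟦ lookup A₃ w ⟧ * (⟦ lookup A w ⟧ * z A i) ≤ ⟦ lookup A w ⟧ * (Δ A * z A i)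
      bound A w with lookup A₃ w in e₃ | lookup A w in e | z A i in eq
      ... | false | _     | _     = z≤n
      ... | true  | false | _     = z≤n
      ... | true  | true  | zero  = z≤n
      ... | true  | true  | suc n = ≤-reflexive (cong (λ m → 1 * (m * suc n)) (sym (trans
          (cong (δ' (Fin.suc (L i v))) (trans (uniform (<-≤-trans (subst (0 <_) (sym eq) (s≤s z≤n)) (z≤x A i)) e)
            (trans (sym (uniform posA₃ e₃)) (uniform posA₃ v∈A₃)))) (Finite.δ-refl (finFin (suc u)) _))))
      two : ∀ A → card A * (Δ A * z A i) ≤ 2 * (Δ A * ((3 ∸ card A) * x A i))
      two A with z A i in eq
      ... | zero  = ≤-trans (≤-reflexive (trans (cong (card A *_) (*-zeroʳ (Δ A))) (*-zeroʳ (card A)))) z≤n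
      ... | suc n = *-mono-≤ (z-small A i (subst (0 <_) (sym eq) (s≤s z≤n)))
        (*-monoʳ-≤ (Δ A) (subst (_≤ _) eq (z-weight A i)))

  connected-detachment : ∀ {m q} (x₀ : Vec Bool m → Col → ℕ) L₀ → Triples m (suc q) x₀ →
    Labelling x₀ L₀ →
    ∃ λ (x : Vec Bool (suc q + m) → Col → ℕ) → Triples (suc q + m) 0 x ×
      (∀ A i → card A ≡ 3 → x (pad (suc q) A) i ≡ x₀ A i) × (∀ i v w → Star (Linked x i) v w)
  connected-detachment {m} {q} x₀ L₀ am₀ lbl₀ = last (build q 0 (+-comm q 1))
    where
    Stage : ℕ → ℕ → Set
    Stage j p = ∃ λ (x : Vec Bool (j + m) → Col → ℕ) → ∃ λ L → Triples (j + m) (suc p) x ×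
      Labelling x L × (∀ A i → card A ≡ 3 → x (pad j A) i ≡ x₀ A i)

    module Next {j p} (st : Stage j p) where
      x  = proj₁ st
      L  = proj₁ (proj₂ st)
      am = proj₁ (proj₂ (proj₂ st))
      lbl = proj₁ (proj₂ (proj₂ (proj₂ st)))
      κ : Col → Fin (suc (j + m)) → ℕ
      κ i ℓ = proj₁ (ceiling (labelWeight x (L i) i ℓ) p)
      det : Detachment am (finFin (suc (j + m))) (λ i (_ , A) → lab (L i) A) κ
      det = detach am (finFin (suc (j + m))) (λ i (_ , A) → lab (L i) A) κ
        (λ i ℓ → ≤-trans (≤-reflexive (+-identityʳ _)) (proj₁ (proj₂ (ceiling (labelWeight x (L i) i ℓ) p))))
      open Step am lbl det public
      keeps : ∀ A i → card A ≡ 3 → x⁺ (pad (suc j) A) i ≡ x₀ A i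
      keeps A i c≡3 = trans (cong (x (pad j A) i ∸_) none) (proj₂ (proj₂ (proj₂ (proj₂ st))) A i c≡3)
        where
        -- Sets of three old vertices have no incidence with the amalgam, so `y≤wx` freezes them.
        none : Rounding.y det (tt , pad j A) i ≡ 0
        none = n≤0⇒n≡0 (≤-trans (Rounding.y≤wx det (tt , pad j A) i) (≤-reflexive
          (cong (λ n → (3 ∸ n) * x (pad j A) i) (trans (card-pad j A) c≡3))))

    build : ∀ j p → j + suc p ≡ suc q → Stage j p
    build zero    p refl = x₀ , L₀ , am₀ , lbl₀ , λ _ _ _ → refl
    build (suc j) p e = x⁺ , L⁺ , am⁺ ,
      LargeStep.labelling⁺ am lbl
        (λ i ℓ → proj₂ (proj₂ (ceiling (labelWeight x (L i) i ℓ) (suc p)))) det ,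
      keeps
      where open Next (build j (suc p) (trans (+-suc j (suc p)) e))

    last : Stage q 0 → _
    last st = x⁺ , am⁺ , keeps , all-hit⇒connected hits
      where
      open Next st
      y' : Vec Bool (q + m) → Col → ℕ
      y' A i = Rounding.y det (tt , A) i
      -- With one vertex left, an edge meets the amalgam at most once, and the number of edges to be
      -- moved from such a set is its whole multiplicity.
      saturated : ∀ A i → 0 < 3 ∸ card A → 0 < x A i → y' A i ≡ x A i
      saturated A i 0<w 0<x = S-equality cs (Rounding.y≤x det (tt , A))
        (≤-reflexive (trans (Amalgam.multiplicity am tt A) (trans (cong (l *_) (bins (card A) 0<w w≤1)) (sym (Rounding.row-sum det (tt , A))))))
        (Finite.complete finC i)
        where
        w≤1 : 3 ∸ card A ≤ 1
        w≤1 = x-positive am 0<x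
        bins : ∀ c → 0 < 3 ∸ c → 3 ∸ c ≤ 1 → bin 1 3 c ≡ bin 0 3 (suc c)
        bins zero                0<w (s≤s ())
        bins (suc zero)          0<w (s≤s ())
        bins (suc (suc zero))    0<w w≤1 = refl
        bins (suc (suc (suc zero))) ()
        bins (suc (suc (suc (suc c)))) ()
      hits : ∀ i v → 0 < taken i (Fin.suc (L i v))
      hits i v = conclude (S-positive (vecs (q + m)) contribution (≤-trans (s≤s z≤n) (Labelling.heavy lbl i v)))
        where
        contribution : Vec Bool (q + m) → ℕ
        contribution A = labelδ (Fin.suc (L i v)) (lab (L i) A) * ((3 ∸ card A) * x A i)
        conclude : (∃ λ A → 0 < contribution A) → 0 < taken i (Fin.suc (L i v))
        conclude (A , pos) = taken-positive {A = A}
          (⌊⌋-true (lab (L i) A Finₚ.≟ Fin.suc (L i v)) (⟦⟧-positive pos)) 0<y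
          where
          0<wx : 0 < (3 ∸ card A) * x A i
          0<wx = positive-factorʳ (labelδ (Fin.suc (L i v)) (lab (L i) A)) pos
          0<y : 0 < y' A i
          0<y = subst (0 <_) (sym (saturated A i (positive-factorˡ (x A i) 0<wx) (positive-factorʳ (3 ∸ card A) 0<wx)))
            (positive-factorʳ (3 ∸ card A) 0<wx)

  -- Joining the two phases of detachment

  module _ {m q : ℕ} (d o : Col → ℕ) (old : Vec Bool m → Col → ℕ) (e : Fin 3 → Col → ℕ)
    (e-total : ∀ η → S cs (e η) ≡ l * (suc q C (3 ∸ toℕ η)) * (m C toℕ η))
    (e-degree : ∀ i → e (Fin.suc Fin.zero) i + 2 * e (Fin.suc (Fin.suc Fin.zero)) i ≡ m * d i)
    (e-weight : ∀ i → 3 * e Fin.zero i + (2 * e (Fin.suc Fin.zero) i + e (Fin.suc (Fin.suc Fin.zero)) i) ≡ suc q * s)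
    (d-positive : ∀ i → 1 ≤ d i) (d+o : ∀ i → d i + o i ≡ s)
    (old-total : ∀ A → S cs (old A) ≡ l * bin 0 3 (card A))
    (old-degree : ∀ i v → S (vecs m) (λ A → ⟦ lookup A v ⟧ * old A i) ≡ o i) where

    private
      -- The kind is the number of old vertices. During the first phase the new vertices stay
      -- amalgamated and enter only through the choices of the other 3 - η vertices. Kind three is
      -- absent, since those edges are given by `old`.
      Λ : Fin 3 → ℕ
      Λ η = l * (suc q C (3 ∸ toℕ η))
      fs = allFin 3

      old-support : ∀ A i → 0 < old A i → card A ≡ 3
      old-support A i pos = bin0-positive 3 (card A) (positive-factorʳ l (subst (0 <_) (old-total A)
        (<-≤-trans pos (Finite.S-term finC (old A) i))))

      amalgam₀ : Amalgams.Amalgam (finFin 3) finC toℕ Λ d 0 m (λ η _ i → e η i)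
      amalgam₀ = record
        { multiplicity = λ { η [] → e-total η }
        ; weight = λ i → trans (reshape (e Fin.zero i) (e (Fin.suc Fin.zero) i) (e (Fin.suc (Fin.suc Fin.zero)) i)) (e-degree i)
        ; degree = λ i ()
        }
        where
        reshape : ∀ a b c → (0 * a + 0) + ((1 * b + 0) + ((2 * c + 0) + 0)) ≡ b + 2 * c
        reshape = solve-∀

      first-phase = Amalgams.complete-detachment (finFin 3) finC toℕ Λ d amalgam₀ m 0 (+-identityʳ m)

      x₁ : Fin 3 → Vec Bool m → Col → ℕ
      x₁ = proj₁ first-phase

      open Amalgams.Amalgam (proj₁ (proj₂ first-phase)) renaming (multiplicity to mult₁; weight to weight₁; degree to degree₁)

      x₁-support : ∀ η A i → 0 < x₁ η A i → card A ≡ toℕ η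
      x₁-support η A i pos = bin0-positive (toℕ η) (card A) (positive-factorʳ (Λ η) (subst (0 <_) (mult₁ η A)
        (<-≤-trans pos (Finite.S-term finC (x₁ η A) i))))

      z x₂ : Vec Bool m → Col → ℕ
      z A i = S fs (λ η → x₁ η A i)
      x₂ A i = z A i + old A i

      -- Only the kind η = c contributes; the given edges supply the case c = 3.
      binomials : ∀ c → S fs (λ η → (suc q C (3 ∸ toℕ η)) * bin 0 (toℕ η) c) + bin 0 3 c ≡ bin (suc q) 3 c
      binomials 0 = reshape (suc q C 3) (suc q C 2) (suc q C 1)
        where
        reshape : ∀ a b c → (a * 1 + (b * 0 + (c * 0 + 0))) + 0 ≡ a
        reshape = solve-∀
      binomials 1 = reshape (suc q C 3) (suc q C 2) (suc q C 1)
        where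
        reshape : ∀ a b c → (a * 0 + (b * 1 + (c * 0 + 0))) + 0 ≡ b
        reshape = solve-∀
      binomials 2 = reshape (suc q C 3) (suc q C 2) (suc q C 1)
        where
        reshape : ∀ a b c → (a * 0 + (b * 0 + (c * 1 + 0))) + 0 ≡ c
        reshape = solve-∀
      binomials 3 = reshape (suc q C 3) (suc q C 2) (suc q C 1)
        where
        reshape : ∀ a b c → (a * 0 + (b * 0 + (c * 0 + 0))) + 1 ≡ 1
        reshape = solve-∀
      binomials (suc (suc (suc (suc c)))) = reshape (suc q C 3) (suc q C 2) (suc q C 1)
        where
        reshape : ∀ a b c → (a * 0 + (b * 0 + (c * 0 + 0))) + 0 ≡ 0
        reshape = solve-∀

      mult₂ : ∀ A → S cs (x₂ A) ≡ l * bin (suc q) 3 (card A)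
      mult₂ A = begin
        S cs (x₂ A)
          ≡⟨ S-+ cs (z A) (old A) ⟩
        S cs (z A) + S cs (old A)
          ≡⟨ cong₂ _+_ (trans (S-swap cs fs (λ i η → x₁ η A i)) (S-cong fs (λ η → mult₁ η A))) (old-total A) ⟩
        S fs (λ η → l * (suc q C (3 ∸ toℕ η)) * bin 0 (toℕ η) (card A)) + l * bin 0 3 (card A)
          ≡⟨ cong (_+ l * bin 0 3 (card A)) (trans (S-cong fs (λ η → *-assoc l (suc q C (3 ∸ toℕ η)) (bin 0 (toℕ η) (card A))))
               (S-*ˡ fs l (λ η → (suc q C (3 ∸ toℕ η)) * bin 0 (toℕ η) (card A)))) ⟩
        l * S fs (λ η → (suc q C (3 ∸ toℕ η)) * bin 0 (toℕ η) (card A)) + l * bin 0 3 (card A)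
          ≡⟨ sym (*-distribˡ-+ l _ _) ⟩
        l * (S fs (λ η → (suc q C (3 ∸ toℕ η)) * bin 0 (toℕ η) (card A)) + bin 0 3 (card A))
          ≡⟨ cong (l *_) (binomials (card A)) ⟩
        l * bin (suc q) 3 (card A) ∎
        where open ≡-Reasoning

      supported : ∀ (f : ℕ → ℕ) {c h} n → (0 < n → c ≡ h) → f c * n ≡ f h * n
      supported f {c} {h} zero    g = trans (*-zeroʳ (f c)) (sym (*-zeroʳ (f h)))
      supported f         (suc n) g = cong (λ t → f t * suc n) (g (s≤s z≤n))

      weight₂ : ∀ i → S (vecs m) (λ A → (3 ∸ card A) * x₂ A i) ≡ suc q * s
      weight₂ i = begin
        S (vecs m) (λ A → (3 ∸ card A) * x₂ A i)
          ≡⟨ S-cong (vecs m) (λ A → trans (*-distribˡ-+ (3 ∸ card A) (z A i) (old A i)) (trans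
               (cong ((3 ∸ card A) * z A i +_) (supported (3 ∸_) (old A i) (old-support A i)))
               (trans (+-identityʳ _) (trans (sym (S-*ˡ fs (3 ∸ card A) (λ η → x₁ η A i)))
                 (S-cong fs (λ η → supported (3 ∸_) (x₁ η A i) (x₁-support η A i))))))) ⟩
        S (vecs m) (λ A → S fs (λ η → (3 ∸ toℕ η) * x₁ η A i))
          ≡⟨ S-swap (vecs m) fs (λ A η → (3 ∸ toℕ η) * x₁ η A i) ⟩
        S fs (λ η → S (vecs m) (λ A → (3 ∸ toℕ η) * x₁ η A i))
          ≡⟨ S-cong fs (λ η → trans (S-*ˡ (vecs m) (3 ∸ toℕ η) (λ A → x₁ η A i)) (cong ((3 ∸ toℕ η) *_) (proj₂ (proj₂ first-phase) η i))) ⟩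
        S fs (λ η → (3 ∸ toℕ η) * e η i)
          ≡⟨ reshape (e Fin.zero i) (e (Fin.suc Fin.zero) i) (e (Fin.suc (Fin.suc Fin.zero)) i) ⟩
        3 * e Fin.zero i + (2 * e (Fin.suc Fin.zero) i + e (Fin.suc (Fin.suc Fin.zero)) i)
          ≡⟨ e-weight i ⟩
        suc q * s ∎
        where
        open ≡-Reasoning
        reshape : ∀ a b c → 3 * a + (2 * b + (1 * c + 0)) ≡ 3 * a + (2 * b + c)
        reshape = solve-∀

      z-degree : ∀ i v → S (vecs m) (λ A → ⟦ lookup A v ⟧ * z A i) ≡ d i
      z-degree i v = trans (S-cong (vecs m) (λ A → sym (S-*ˡ fs ⟦ lookup A v ⟧ (λ η → x₁ η A i))))
        (trans (S-swap (vecs m) fs (λ A η → ⟦ lookup A v ⟧ * x₁ η A i)) (degree₁ i v))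

      degree₂ : ∀ i v → S (vecs m) (λ A → ⟦ lookup A v ⟧ * x₂ A i) ≡ s
      degree₂ i v = trans (S-cong (vecs m) (λ A → *-distribˡ-+ ⟦ lookup A v ⟧ (z A i) (old A i)))
        (trans (S-+ (vecs m) _ _) (trans (cong₂ _+_ (z-degree i v) (old-degree i v)) (d+o i)))

      triples₂ : Triples m (suc q) x₂
      triples₂ = record
        { multiplicity = λ _ → mult₂
        ; weight = λ i → trans (+-identityʳ _) (weight₂ i)
        ; degree = λ i v → trans (+-identityʳ _) (degree₂ i v)
        }

      z-small : ∀ A i → 0 < z A i → card A ≤ 2
      z-small A i pos with S-positive fs (λ η → x₁ η A i) pos
      ... | η , pos' = subst (_≤ 2) (sym (x₁-support η A i pos')) (≤-pred (Finₚ.toℕ<n η))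

      -- In a colour without given edges the whole degree s ≥ 2 comes from `z`. In any other colour
      -- each old vertex lies on a given edge, and `d-positive` supplies an edge of `z` at every old
      -- vertex.
      degrees : ∀ i v → 2 ≤ S (vecs m) (λ A → ⟦ lookup A v ⟧ * z A i) ⊎
        ((∀ w → 1 ≤ S (vecs m) (λ A → ⟦ lookup A w ⟧ * z A i)) ×
         (∃ λ A → 3 ≤ card A × 0 < x₂ A i × lookup A v ≡ true))
      degrees i v with o i in eq
      ... | zero = inj₁ (≤-trans 2≤s (≤-reflexive (sym (trans (z-degree i v)
        (trans (sym (+-identityʳ (d i))) (trans (cong (d i +_) (sym eq)) (d+o i)))))))
      ... | suc _ with S-positive (vecs m) _ (subst (0 <_) (sym (trans (old-degree i v) eq)) (s≤s z≤n))
      ... | A , pos = inj₂ ((λ w → subst (1 ≤_) (sym (z-degree i w)) (d-positive i)) ,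
          A , ≤-reflexive (sym (old-support A i pos')) , ≤-trans pos' (m≤n+m _ _) , ⟦⟧-positive pos)
        where pos' = positive-factorʳ ⟦ lookup A v ⟧ pos

    abstract
      extension : ∃ λ (x : Vec Bool (suc q + m) → Col → ℕ) → Triples (suc q + m) 0 x ×
        (∀ A i → card A ≡ 3 → x (pad (suc q) A) i ≡ old A i) × (∀ i v w → Star (Linked x i) v w)
      extension with initial-labelling x₂ z (λ A i → m≤m+n _ _) z-small degrees
      ... | L , lbl with connected-detachment x₂ L triples₂ lbl
      ... | x , tr , keep , conn = x , tr , (λ A i c≡3 → trans (keep A i c≡3) (cong (_+ old A i) (z≡0 A i c≡3))) , conn
        where
        z≡0 : ∀ A i → card A ≡ 3 → z A i ≡ 0
        z≡0 A i c≡3 with z A i in eq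
        ... | zero  = refl
        ... | suc _ = contradiction (subst (_≤ 2) c≡3 (z-small A i (subst (0 <_) (sym eq) (s≤s z≤n)))) λ { (s≤s (s≤s ())) }

-- Sets of at most three vertices

-- Unlike the decision procedure, this order reduces by recursion on both arguments, as the
-- inductions over vectors below require.
lt : ∀ {n} → Fin n → Fin n → Bool
lt Fin.zero    Fin.zero    = false
lt Fin.zero    (Fin.suc w) = true
lt (Fin.suc v) Fin.zero    = false
lt (Fin.suc v) (Fin.suc w) = lt v w

lt-complete : ∀ {n} {v w : Fin n} → v Fin.< w → lt v w ≡ true
lt-complete {v = Fin.zero}  {Fin.suc w} p = refl
lt-complete {v = Fin.suc v} {Fin.suc w} p = lt-complete {v = v} (s≤s⁻¹ p)

lt-sound : ∀ {n} (v w : Fin n) → lt v w ≡ true → v Fin.< w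
lt-sound Fin.zero    (Fin.suc w) e = s≤s z≤n
lt-sound (Fin.suc v) (Fin.suc w) e = s≤s (lt-sound v w e)

true-⇔ : ∀ {b b'} → (b ≡ true → b' ≡ true) → (b' ≡ true → b ≡ true) → b ≡ b'
true-⇔ {true}  {b'}    f g = sym (f refl)
true-⇔ {false} {true}  f g = g refl
true-⇔ {false} {false} f g = refl

opposite-< : ∀ {n} {v w : Fin n} → v Fin.< w → opposite w Fin.< opposite v
opposite-< {n} {v} {w} p = subst₂ _<_ (sym (Finₚ.opposite-prop w)) (sym (Finₚ.opposite-prop v))
  (∸-monoʳ-< (s≤s p) (Finₚ.toℕ<n w))

lt-opposite : ∀ {n} (v w : Fin n) → lt (opposite v) (opposite w) ≡ lt w v
lt-opposite v w = true-⇔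
  (λ e → lt-complete (subst₂ Fin._<_ (Finₚ.opposite-involutive w) (Finₚ.opposite-involutive v)
    (opposite-< (lt-sound (opposite v) (opposite w) e))))
  (λ e → lt-complete (opposite-< (lt-sound w v e)))

∅ᵛ : ∀ {n} → Vec Bool n
∅ᵛ = Vec.replicate _ false

_∪ᵛ_ : ∀ {n} → Vec Bool n → Vec Bool n → Vec Bool n
_∪ᵛ_ = Vec.zipWith _∨_

∅-∪ : ∀ {n} (A : Vec Bool n) → ∅ᵛ ∪ᵛ A ≡ A
∅-∪ []      = refl
∅-∪ (b ∷ A) = cong (b ∷_) (∅-∪ A)

singleton : ∀ {n} → Fin n → Vec Bool n
singleton Fin.zero    = true ∷ ∅ᵛ
singleton (Fin.suc v) = false ∷ singleton v

pair : ∀ {n} → Fin n → Fin n → Vec Bool n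
pair v w = singleton v ∪ᵛ singleton w

triple : ∀ {n} → Fin n → Fin n → Fin n → Vec Bool n
triple v w t = singleton v ∪ᵛ pair w t

∑-zero : ∀ {n} {f : Fin n → ℕ} → (∀ i → f i ≡ 0) → ∑ f ≡ 0
∑-zero {zero}  e = refl
∑-zero {suc n} e = cong₂ _+_ (e Fin.zero) (∑-zero (e ∘ Fin.suc))

sum-0-sets : ∀ {n} (f : Vec Bool n → ℕ) → S (vecs n) (λ A → bin 0 0 (card A) * f A) ≡ f ∅ᵛ
sum-0-sets {zero}  f = trans (+-identityʳ _) (+-identityʳ _)
sum-0-sets {suc n} f = trans (S-vecs n _) (trans (cong (_+ S (vecs n) (λ A → bin 0 0 (card A) * f (false ∷ A))) (S-zero (vecs n) (λ _ → refl)))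
  (sum-0-sets (f ∘ (false ∷_))))

sum-1-sets : ∀ {n} (f : Vec Bool n → ℕ) → S (vecs n) (λ A → bin 0 1 (card A) * f A) ≡ ∑ (λ v → f (singleton v))
sum-1-sets {zero}  f = refl
sum-1-sets {suc n} f = trans (S-vecs n _) (cong₂ _+_ (sum-0-sets (f ∘ (true ∷_))) (sum-1-sets (f ∘ (false ∷_))))

sum-2-sets : ∀ {n} (f : Vec Bool n → ℕ) →
  S (vecs n) (λ A → bin 0 2 (card A) * f A) ≡ ∑ (λ v → ∑ (λ w → ⟦ lt v w ⟧ * f (pair v w)))
sum-2-sets {zero}  f = refl
sum-2-sets {suc n} f = trans (S-vecs n _) (cong₂ _+_
  (trans (sum-1-sets (f ∘ (true ∷_))) (∑-cong (λ w → trans (cong (λ A → f (true ∷ A)) (sym (∅-∪ (singleton w)))) (sym (+-identityʳ _)))))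
  (sum-2-sets (f ∘ (false ∷_))))

-- Induction on n: a set of three either contains position zero, leaving a pair, or avoids it. This
-- links sums over vectors to the threefold sums that define `deg`.
sum-3-sets : ∀ {n} (f : Vec Bool n → ℕ) →
  S (vecs n) (λ A → bin 0 3 (card A) * f A) ≡
  ∑ (λ v → ∑ (λ w → ∑ (λ t → ⟦ lt v w ⟧ * (⟦ lt w t ⟧ * f (triple v w t)))))
sum-3-sets {zero}  f = refl
sum-3-sets {suc n} f = trans (S-vecs n _) (cong₂ _+_
  (trans (trans (sum-2-sets (f ∘ (true ∷_))) (∑-cong (λ w → ∑-cong (λ t →
      trans (cong (λ A → ⟦ lt w t ⟧ * f (true ∷ A)) (sym (∅-∪ (pair w t)))) (sym (+-identityʳ _))))))
    (sym (cong₂ _+_ (∑-zero {suc n} (λ _ → refl)) (∑-cong {n} (λ w → refl)))))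
  (trans (sum-3-sets (f ∘ (false ∷_))) (∑-cong (λ v → sym
    (cong₂ _+_ (∑-zero {suc n} (λ _ → refl)) (∑-cong {n} (λ w → cong (_+ ∑ (λ t → ⟦ lt v w ⟧ * (⟦ lt w t ⟧ * f (false ∷ triple v w t)))) (*-zeroʳ ⟦ lt v w ⟧))))))))

S-involution : ∀ {A : Set} (finA : Finite A) (σ : A → A) → (∀ a → σ (σ a) ≡ a) → (f : A → ℕ) →
  S (Finite.elems finA) (f ∘ σ) ≡ S (Finite.elems finA) f
S-involution finA σ inv f = begin
  S elems (f ∘ σ)                                     ≡⟨ S-cong elems (λ a → sym (S-δ (σ a) f)) ⟩
  S elems (λ a → S elems (λ b → δ (σ a) b * f b))     ≡⟨ S-swap elems elems _ ⟩
  S elems (λ b → S elems (λ a → δ (σ a) b * f b))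
    ≡⟨ S-cong elems (λ b → trans (S-cong elems (λ a → cong (λ t → ⟦ t ⟧ * f b)
         (⌊⌋-⇔ (λ e → trans (sym (inv a)) (cong σ (sym e))) (λ e → trans (sym (inv b)) (cong σ (sym e))) (b == σ a) (a == σ b))))
       (S-δ (σ b) (λ _ → f b))) ⟩
  S elems f ∎
  where
  open ≡-Reasoning
  open Finite finA

∑-swap : ∀ {n k} (f : Fin n → Fin k → ℕ) → ∑ (λ v → ∑ (f v)) ≡ ∑ (λ w → ∑ (λ v → f v w))
∑-swap {n} {k} f = begin
  ∑ (λ v → ∑ (f v))                                  ≡⟨ sym (double f) ⟩
  S (allFin n) (λ v → S (allFin k) (f v))            ≡⟨ S-swap (allFin n) (allFin k) f ⟩
  S (allFin k) (λ w → S (allFin n) (λ v → f v w))    ≡⟨ double (λ w v → f v w) ⟩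
  ∑ (λ w → ∑ (λ v → f v w)) ∎
  where
  open ≡-Reasoning
  double : ∀ {n k} (f : Fin n → Fin k → ℕ) → S (allFin n) (λ v → S (allFin k) (f v)) ≡ ∑ (λ v → ∑ (f v))
  double {n} {k} f = trans (S-cong (allFin n) (λ v → S-allFin k (f v))) (S-allFin n (λ v → ∑ (f v)))

∑-opposite : ∀ {n} (f : Fin n → ℕ) → ∑ (f ∘ opposite) ≡ ∑ f
∑-opposite {n} f = trans (sym (S-allFin n _)) (trans (S-involution (finFin n) opposite Finₚ.opposite-involutive f) (S-allFin n f))

-- Vertex v occupies position opposite v, because the vertex detached last is at the head of the vector.
tset : ∀ {n} → Fin n → Fin n → Fin n → Vec Bool n
tset v w t = triple (opposite t) (opposite w) (opposite v)

sum-triples : ∀ {n} (f : Vec Bool n → ℕ) → S (vecs n) (λ A → bin 0 3 (card A) * f A) ≡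
  ∑ (λ v → ∑ (λ w → ∑ (λ t → ⟦ lt v w ⟧ * (⟦ lt w t ⟧ * f (tset v w t)))))
sum-triples {n} f = begin
  S (vecs n) (λ A → bin 0 3 (card A) * f A)
    ≡⟨ sum-3-sets f ⟩
  ∑ (λ v → ∑ (λ w → ∑ (G v w)))
    ≡⟨ sym (∑-opposite (λ v → ∑ (λ w → ∑ (G v w)))) ⟩
  ∑ (λ v → ∑ (λ w → ∑ (G (opposite v) w)))
    ≡⟨ sym (∑-cong (λ v → ∑-opposite (λ w → ∑ (G (opposite v) w)))) ⟩
  ∑ (λ v → ∑ (λ w → ∑ (G (opposite v) (opposite w))))
    ≡⟨ sym (∑-cong (λ v → ∑-cong (λ w → ∑-opposite (G (opposite v) (opposite w))))) ⟩
  ∑ (λ v → ∑ (λ w → ∑ (λ t → G (opposite v) (opposite w) (opposite t))))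
    ≡⟨ ∑-cong (λ v → ∑-cong (λ w → ∑-cong (λ t → trans
         (cong₂ (λ a b → ⟦ a ⟧ * (⟦ b ⟧ * f (tset t w v))) (lt-opposite v w) (lt-opposite w t))
         (*-swap ⟦ lt w v ⟧ ⟦ lt t w ⟧ (f (tset t w v)))))) ⟩
  ∑ (λ v → ∑ (λ w → ∑ (λ t → H t w v)))
    ≡⟨ ∑-swap (λ v w → ∑ (λ t → H t w v)) ⟩
  ∑ (λ w → ∑ (λ v → ∑ (λ t → H t w v)))
    ≡⟨ ∑-cong (λ w → ∑-swap (λ v t → H t w v)) ⟩
  ∑ (λ w → ∑ (λ t → ∑ (λ v → H t w v)))
    ≡⟨ ∑-swap (λ w t → ∑ (λ v → H t w v)) ⟩
  ∑ (λ t → ∑ (λ w → ∑ (λ v → H t w v))) ∎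
  where
  open ≡-Reasoning
  G H : Fin n → Fin n → Fin n → ℕ
  G v w t = ⟦ lt v w ⟧ * (⟦ lt w t ⟧ * f (triple v w t))
  H v w t = ⟦ lt v w ⟧ * (⟦ lt w t ⟧ * f (tset v w t))

-- A decoding of sets on which `count` can match to recover the three vertices of an edge.
positions : ∀ {n} → Vec Bool n → List (Fin n)
positions []          = []
positions (true ∷ A)  = Fin.zero ∷ map Fin.suc (positions A)
positions (false ∷ A) = map Fin.suc (positions A)

positions-∅ : ∀ n → positions (∅ᵛ {n}) ≡ []
positions-∅ zero    = refl
positions-∅ (suc n) = cong (map Fin.suc) (positions-∅ n)

positions-singleton : ∀ {n} (v : Fin n) → positions (singleton v) ≡ v ∷ []
positions-singleton {suc n} Fin.zero = cong (λ vs → Fin.zero ∷ map Fin.suc vs) (positions-∅ n)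
positions-singleton (Fin.suc v)      = cong (map Fin.suc) (positions-singleton v)

positions-pair : ∀ {n} (v w : Fin n) → lt v w ≡ true → positions (pair v w) ≡ v ∷ w ∷ []
positions-pair Fin.zero    (Fin.suc w) e = cong (λ vs → Fin.zero ∷ map Fin.suc vs)
  (trans (cong positions (∅-∪ (singleton w))) (positions-singleton w))
positions-pair (Fin.suc v) (Fin.suc w) e = cong (map Fin.suc) (positions-pair v w e)

positions-triple : ∀ {n} (v w t : Fin n) → lt v w ≡ true → lt w t ≡ true →
  positions (triple v w t) ≡ v ∷ w ∷ t ∷ []
positions-triple Fin.zero    (Fin.suc w) (Fin.suc t) e e' = cong (λ vs → Fin.zero ∷ map Fin.suc vs)
  (trans (cong positions (∅-∪ (pair w t))) (positions-pair w t e'))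
positions-triple (Fin.suc v) (Fin.suc w) (Fin.suc t) e e' = cong (map Fin.suc) (positions-triple v w t e e')

length-positions : ∀ {n} (A : Vec Bool n) → length (positions A) ≡ card A
length-positions []          = refl
length-positions (true ∷ A)  = cong suc (trans (length-map Fin.suc (positions A)) (length-positions A))
length-positions (false ∷ A) = trans (length-map Fin.suc (positions A)) (length-positions A)

tset-sorted : ∀ {n} {v w t : Fin n} → v Fin.< w → w Fin.< t →
  positions (tset v w t) ≡ opposite t ∷ opposite w ∷ opposite v ∷ []
tset-sorted p q = positions-triple _ _ _ (lt-complete (opposite-< q)) (lt-complete (opposite-< p))

card-tset : ∀ {n} {v w t : Fin n} → v Fin.< w → w Fin.< t → card (tset v w t) ≡ 3
card-tset {v = v} {w} {t} p q = trans (sym (length-positions (tset v w t))) (cong length (tset-sorted p q))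

⟦_∈_,_,_⟧ : ∀ {n} → Fin n → Fin n → Fin n → Fin n → Bool
⟦ u ∈ v , w , t ⟧ = ⌊ u Finₚ.≟ v ⌋ ∨ ⌊ u Finₚ.≟ w ⌋ ∨ ⌊ u Finₚ.≟ t ⌋

lookup-singleton : ∀ {n} (v u : Fin n) → lookup (singleton v) u ≡ ⌊ u Finₚ.≟ v ⌋
lookup-singleton Fin.zero    Fin.zero    = refl
lookup-singleton Fin.zero    (Fin.suc u) = lookup-replicate u false
lookup-singleton (Fin.suc v) Fin.zero    = refl
lookup-singleton (Fin.suc v) (Fin.suc u) = trans (lookup-singleton v u) (sym (⌊suc≟suc⌋ u v))

lookup-tset : ∀ {n} (v w t u : Fin n) → lookup (tset v w t) (opposite u) ≡ ⟦ u ∈ v , w , t ⟧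
lookup-tset v w t u = trans (lookup-zipWith _∨_ (opposite u) (singleton (opposite t)) (pair (opposite w) (opposite v))) (trans (cong₂ _∨_ (at t)
  (trans (lookup-zipWith _∨_ (opposite u) (singleton (opposite w)) (singleton (opposite v))) (cong₂ _∨_ (at w) (at v))))
  (reverse ⌊ u Finₚ.≟ t ⌋ ⌊ u Finₚ.≟ w ⌋ ⌊ u Finₚ.≟ v ⌋))
  where
  injective : ∀ {v} → opposite u ≡ opposite v → u ≡ v
  injective {v} e = trans (sym (Finₚ.opposite-involutive u)) (trans (cong opposite e) (Finₚ.opposite-involutive v))
  at : ∀ v → lookup (singleton (opposite v)) (opposite u) ≡ ⌊ u Finₚ.≟ v ⌋
  at v = trans (lookup-singleton (opposite v) (opposite u)) (⌊⌋-⇔ injective (cong opposite) (opposite u Finₚ.≟ opposite v) (u Finₚ.≟ v))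
  reverse : ∀ a b c → a ∨ b ∨ c ≡ c ∨ b ∨ a
  reverse true  true  true  = refl
  reverse true  true  false = refl
  reverse true  false true  = refl
  reverse true  false false = refl
  reverse false true  true  = refl
  reverse false true  false = refl
  reverse false false true  = refl
  reverse false false false = refl

∈-tset : ∀ {n} {v w t u : Fin n} → lookup (tset v w t) u ≡ true →
  (opposite u ≡ v) ⊎ ((opposite u ≡ w) ⊎ (opposite u ≡ t))
∈-tset {v = v} {w} {t} {u} e = decode (trans (sym (lookup-tset v w t (opposite u)))
  (trans (cong (lookup (tset v w t)) (Finₚ.opposite-involutive u)) e))
  where
  decode : ⟦ opposite u ∈ v , w , t ⟧ ≡ true → (opposite u ≡ v) ⊎ ((opposite u ≡ w) ⊎ (opposite u ≡ t))
  decode h with opposite u Finₚ.≟ v | opposite u Finₚ.≟ w | opposite u Finₚ.≟ t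
  ... | yes p | _     | _     = inj₁ p
  ... | no _  | yes p | _     = inj₂ (inj₁ p)
  ... | no _  | no _  | yes p = inj₂ (inj₂ p)

abstract
  -- The indicator of `A` summed over all sets of three is one. Rewritten by `sum-triples` as a sum
  -- over sorted triples, it must have a nonzero term.
  tset-surjective : ∀ {n} (A : Vec Bool n) → card A ≡ 3 →
    ∃ λ v → ∃ λ w → ∃ λ t → v Fin.< w × w Fin.< t × A ≡ tset v w t
  tset-surjective {n} A c≡3 = found
    where
    open Finite (finVec n)
    one : S (vecs n) (λ B → bin 0 3 (card B) * δ A B) ≡ 1
    one = trans (S-cong (vecs n) (λ B → *-comm (bin 0 3 (card B)) (δ A B)))
      (trans (S-δ A (λ B → bin 0 3 (card B))) (cong (bin 0 3) c≡3))
    ∑-positive : ∀ {n} (f : Fin n → ℕ) → 0 < ∑ f → ∃ λ i → 0 < f i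
    ∑-positive {n} f pos = S-positive (allFin n) f (subst (0 <_) (sym (S-allFin n f)) pos)
    found : ∃ λ v → ∃ λ w → ∃ λ t → v Fin.< w × w Fin.< t × A ≡ tset v w t
    found with ∑-positive _ (subst (0 <_) (trans (sym one) (sum-triples (δ A))) (s≤s z≤n))
    ... | v , pv with ∑-positive _ pv
    ... | w , pw with ∑-positive _ pw
    ... | t , pt = v , w , t , lt-sound v w (⟦⟧-positive pt) , lt-sound w t (⟦⟧-positive pt') ,
        sym (⌊⌋-true (tset v w t == A) (b-true (positive-factorʳ ⟦ lt w t ⟧ pt')))
      where
      pt' : 0 < ⟦ lt w t ⟧ * δ A (tset v w t)
      pt' = positive-factorʳ ⟦ lt v w ⟧ pt
      b-true : ∀ {b} → 0 < ⟦ b ⟧ → b ≡ true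
      b-true {true} _ = refl

lt-false : ∀ {n} (v w : Fin n) → ¬ (v Fin.< w) → lt v w ≡ false
lt-false v w ¬p with lt v w in e
... | true  = contradiction (lt-sound v w e) ¬p
... | false = refl

-- Colourings as multiplicities of vertex sets

module _ {n l k : ℕ} (χ : Edge n l → Fin k) where

  copies : Fin k → (v w t : Fin n) → v Fin.< w → w Fin.< t → ℕ
  copies i v w t p q = ∑ (λ j → ⟦ ⌊ χ (mkEdge v w t p q j) Finₚ.≟ i ⌋ ⟧)

  -- Total in the vertices, with the same case split as `ind`.
  copies? : Fin k → (v w t : Fin n) → ℕ
  copies? i v w t with v Finₚ.<? w | w Finₚ.<? t
  ... | yes p | yes q = copies i v w t p q
  ... | _     | _     = 0

  copies?-sorted : ∀ i {v w t} (p : v Fin.< w) (q : w Fin.< t) → copies? i v w t ≡ copies i v w t p q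
  copies?-sorted i {v} {w} {t} p q with v Finₚ.<? w | w Finₚ.<? t
  ... | yes p' | yes q' rewrite <-irrelevant p p' | <-irrelevant q q' = refl
  ... | yes _  | no ¬q  = contradiction q ¬q
  ... | no ¬p  | _      = contradiction p ¬p

  copies?-unsorted : ∀ i {v w t} → ¬ (v Fin.< w × w Fin.< t) → copies? i v w t ≡ 0
  copies?-unsorted i {v} {w} {t} ¬pq with v Finₚ.<? w | w Finₚ.<? t
  ... | yes p | yes q = contradiction (p , q) ¬pq
  ... | yes _ | no _  = refl
  ... | no _  | _     = refl

  sum-ind : ∀ i u v w t → ∑ (λ j → ind χ i u v w t j) ≡ ⟦ ⟦ u ∈ v , w , t ⟧ ⟧ * copies? i v w t
  sum-ind i u v w t with v Finₚ.<? w | w Finₚ.<? t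
  ... | yes p | yes q = trans (∑-cong (λ j → pointwise ⟦ u ∈ v , w , t ⟧ ⌊ χ (mkEdge v w t p q j) Finₚ.≟ i ⌋))
      (factor ⟦ ⟦ u ∈ v , w , t ⟧ ⟧ (λ j → ⟦ ⌊ χ (mkEdge v w t p q j) Finₚ.≟ i ⌋ ⟧))
    where
    pointwise : ∀ a b → (if a ∧ b then 1 else 0) ≡ ⟦ a ⟧ * ⟦ b ⟧
    pointwise true  true  = refl
    pointwise true  false = refl
    pointwise false _     = refl
    factor : ∀ {n} c (f : Fin n → ℕ) → ∑ (λ j → c * f j) ≡ c * ∑ f
    factor {zero}  c f = sym (*-zeroʳ c)
    factor {suc n} c f = trans (cong (c * f Fin.zero +_) (factor c (f ∘ Fin.suc))) (sym (*-distribˡ-+ c _ _))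
  ... | yes p | no _ = trans (∑-zero {l} (λ _ → refl)) (sym (*-zeroʳ ⟦ ⟦ u ∈ v , w , t ⟧ ⟧))
  ... | no _  | _    = trans (∑-zero {l} (λ _ → refl)) (sym (*-zeroʳ ⟦ ⟦ u ∈ v , w , t ⟧ ⟧))

  deg-triples : ∀ i u → deg χ i u ≡ ∑ (λ v → ∑ (λ w → ∑ (λ t → ⟦ ⟦ u ∈ v , w , t ⟧ ⟧ * copies? i v w t)))
  deg-triples i u = ∑-cong (λ v → ∑-cong (λ w → ∑-cong (λ t → sum-ind i u v w t)))

  -- Stated for any multiplicities that agree with the colouring, so that it serves `count` as well
  -- as the result of a detachment.
  deg-sets : (x : Vec Bool n → Fin k → ℕ) →
    (∀ i {v w t} (p : v Fin.< w) (q : w Fin.< t) → x (tset v w t) i ≡ copies i v w t p q) →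
    (∀ A i → 0 < x A i → card A ≡ 3) →
    ∀ i u → S (vecs n) (λ A → ⟦ lookup A u ⟧ * x A i) ≡ deg χ i (opposite u)
  deg-sets x agree support i u = begin
    S (vecs n) (λ A → ⟦ lookup A u ⟧ * x A i)
      ≡⟨ S-cong (vecs n) supported ⟩
    S (vecs n) (λ A → bin 0 3 (card A) * (⟦ lookup A u ⟧ * x A i))
      ≡⟨ sum-triples (λ A → ⟦ lookup A u ⟧ * x A i) ⟩
    ∑ (λ v → ∑ (λ w → ∑ (λ t → ⟦ lt v w ⟧ * (⟦ lt w t ⟧ * (⟦ lookup (tset v w t) u ⟧ * x (tset v w t) i)))))
      ≡⟨ ∑-cong (λ v → ∑-cong (λ w → ∑-cong (λ t → term v w t))) ⟩
    ∑ (λ v → ∑ (λ w → ∑ (λ t → ⟦ ⟦ opposite u ∈ v , w , t ⟧ ⟧ * copies? i v w t)))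
      ≡⟨ sym (deg-triples i (opposite u)) ⟩
    deg χ i (opposite u) ∎
    where
    open ≡-Reasoning
    supported : ∀ A → ⟦ lookup A u ⟧ * x A i ≡ bin 0 3 (card A) * (⟦ lookup A u ⟧ * x A i)
    supported A with x A i in eq
    ... | zero  = trans (*-zeroʳ ⟦ lookup A u ⟧) (sym (trans (cong (bin 0 3 (card A) *_) (*-zeroʳ ⟦ lookup A u ⟧)) (*-zeroʳ (bin 0 3 (card A)))))
    ... | suc _ rewrite support A i (subst (0 <_) (sym eq) (s≤s z≤n)) = sym (+-identityʳ _)
    value : Fin n → Fin n → Fin n → ℕ
    value v w t = ⟦ lookup (tset v w t) u ⟧ * x (tset v w t) i
    result : Fin n → Fin n → Fin n → ℕ
    result v w t = ⟦ ⟦ opposite u ∈ v , w , t ⟧ ⟧ * copies? i v w t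
    sorted : ∀ {v w t} (p : v Fin.< w) (q : w Fin.< t) → value v w t ≡ result v w t
    sorted {v} {w} {t} p q = cong₂ (λ b m → ⟦ b ⟧ * m)
      (trans (cong (lookup (tset v w t)) (sym (Finₚ.opposite-involutive u))) (lookup-tset v w t (opposite u)))
      (trans (agree i p q) (sym (copies?-sorted i p q)))
    term : ∀ v w t → ⟦ lt v w ⟧ * (⟦ lt w t ⟧ * value v w t) ≡ result v w t
    term v w t = cases (v Finₚ.<? w) (w Finₚ.<? t)
      where
      cases : Dec (v Fin.< w) → Dec (w Fin.< t) → ⟦ lt v w ⟧ * (⟦ lt w t ⟧ * value v w t) ≡ result v w t
      cases (yes p) (yes q) = trans (cong₂ (λ a b → ⟦ a ⟧ * (⟦ b ⟧ * value v w t)) (lt-complete p) (lt-complete q))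
        (trans (+-identityʳ _) (trans (+-identityʳ _) (sorted p q)))
      cases (no ¬p) _ = trans (cong (λ a → ⟦ a ⟧ * (⟦ lt w t ⟧ * value v w t)) (lt-false v w ¬p))
        (sym (trans (cong (⟦ ⟦ opposite u ∈ v , w , t ⟧ ⟧ *_) (copies?-unsorted i (¬p ∘ proj₁))) (*-zeroʳ ⟦ ⟦ opposite u ∈ v , w , t ⟧ ⟧)))
      cases (yes _) (no ¬q) = trans (cong (λ a → ⟦ lt v w ⟧ * (⟦ a ⟧ * value v w t)) (lt-false w t ¬q))
        (trans (*-zeroʳ ⟦ lt v w ⟧) (sym (trans (cong (⟦ ⟦ opposite u ∈ v , w , t ⟧ ⟧ *_) (copies?-unsorted i (¬q ∘ proj₂)))
          (*-zeroʳ ⟦ ⟦ opposite u ∈ v , w , t ⟧ ⟧))))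

  count : Vec Bool n → Fin k → ℕ
  count A i = onPositions (positions A)
    where
    onPositions : List (Fin n) → ℕ
    onPositions (t ∷ w ∷ v ∷ []) = copies? i (opposite v) (opposite w) (opposite t)
    onPositions _                = 0

  count-tset : ∀ i {v w t} (p : v Fin.< w) (q : w Fin.< t) → count (tset v w t) i ≡ copies i v w t p q
  count-tset i {v} {w} {t} p q rewrite tset-sorted p q | Finₚ.opposite-involutive v
    | Finₚ.opposite-involutive w | Finₚ.opposite-involutive t = copies?-sorted i p q

  count-support : ∀ A i → 0 < count A i → card A ≡ 3
  count-support A i pos with positions A | length-positions A
  ... | _ ∷ _ ∷ _ ∷ [] | e = sym e

  copies-total : ∀ {v w t} (p : v Fin.< w) (q : w Fin.< t) → S (allFin k) (λ i → copies i v w t p q) ≡ l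
  copies-total {v} {w} {t} p q = trans (S-cong (allFin k) (λ i → sym (S-allFin l (λ j → ⟦ ⌊ χ (mkEdge v w t p q j) Finₚ.≟ i ⌋ ⟧)))) (trans (S-swap (allFin k) (allFin l) (λ i j → ⟦ ⌊ χ (mkEdge v w t p q j) Finₚ.≟ i ⌋ ⟧))
    (trans (S-cong (allFin l) (λ j → trans (S-cong (allFin k) (λ i → cong ⟦_⟧
      (⌊⌋-⇔ sym sym (χ (mkEdge v w t p q j) Finₚ.≟ i) (i Finₚ.≟ χ (mkEdge v w t p q j)))))
      (Finite.once (finFin k) (χ (mkEdge v w t p q j))))) (trans (S-allFin l (λ _ → 1)) (ones l))))
    where
    ones : ∀ l → ∑ {l} (λ _ → 1) ≡ l
    ones zero    = refl
    ones (suc l) = cong suc (ones l)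

  count-total : ∀ A → S (allFin k) (count A) ≡ l * bin 0 3 (card A)
  count-total A = cases (card A ≟ 3)
    where
    on-tset : ∀ {v w t} → v Fin.< w → w Fin.< t → S (allFin k) (count (tset v w t)) ≡ l * bin 0 3 (card (tset v w t))
    on-tset p q = trans (S-cong (allFin k) (λ i → count-tset i p q)) (trans (copies-total p q)
      (trans (sym (*-identityʳ l)) (cong (λ c → l * bin 0 3 c) (sym (card-tset p q)))))
    cases : Dec (card A ≡ 3) → S (allFin k) (count A) ≡ l * bin 0 3 (card A)
    cases (yes c≡3) = let v , w , t , p , q , e = tset-surjective A c≡3 in
      subst (λ A → S (allFin k) (count A) ≡ l * bin 0 3 (card A)) (sym e) (on-tset p q)
    cases (no c≢3)  = trans (S-zero (allFin k) (λ i → n<1⇒n≡0 (≰⇒> (λ pos → c≢3 (count-support A i pos)))))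
      (sym (trans (cong (l *_) (n<1⇒n≡0 (≰⇒> (c≢3 ∘ bin0-positive 3 (card A))))) (*-zeroʳ l)))

  count-degree : ∀ i u → S (vecs n) (λ A → ⟦ lookup A u ⟧ * count A i) ≡ deg χ i (opposite u)
  count-degree = deg-sets count count-tset count-support

mkEdge-cong : ∀ {n l} {v v' w w' t t' : Fin n} {p : v Fin.< w} {p' : v' Fin.< w'} {q : w Fin.< t} {q' : w' Fin.< t'} {j : Fin l} →
  v ≡ v' → w ≡ w' → t ≡ t' → mkEdge v w t p q j ≡ mkEdge v' w' t' p' q' j
mkEdge-cong {p = p} {p'} {q} {q'} refl refl refl rewrite <-irrelevant p p' | <-irrelevant q q' = refl

singleton-↑ʳ : ∀ q {m} (v : Fin m) → singleton (q Fin.↑ʳ v) ≡ pad q (singleton v)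
singleton-↑ʳ zero    v = refl
singleton-↑ʳ (suc q) v = cong (false ∷_) (singleton-↑ʳ q v)

pad-∪ : ∀ q {m} (A B : Vec Bool m) → pad q (A ∪ᵛ B) ≡ pad q A ∪ᵛ pad q B
pad-∪ zero    A B = refl
pad-∪ (suc q) A B = cong (false ∷_) (pad-∪ q A B)

opposite-inject≤ : ∀ q {m} (v : Fin m) (m≤n : m ≤ q + m) → opposite (inject≤ v m≤n) ≡ q Fin.↑ʳ opposite v
opposite-inject≤ q {m} v m≤n = Finₚ.toℕ-injective (trans (Finₚ.opposite-prop (inject≤ v m≤n))
  (trans (cong (λ t → q + m ∸ suc t) (Finₚ.toℕ-inject≤ v m≤n)) (trans (+-∸-assoc q (Finₚ.toℕ<n v))
    (sym (trans (Finₚ.toℕ-↑ʳ q (opposite v)) (cong (q +_) (Finₚ.opposite-prop v)))))))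

tset-inject≤ : ∀ q {m} (m≤n : m ≤ q + m) (v w t : Fin m) →
  tset (inject≤ v m≤n) (inject≤ w m≤n) (inject≤ t m≤n) ≡ pad q (tset v w t)
tset-inject≤ q m≤n v w t = trans (cong₂ _∪ᵛ_ (one t) (trans (cong₂ _∪ᵛ_ (one w) (one v)) (sym (pad-∪ q _ _)))) (sym (pad-∪ q _ _))
  where
  one : ∀ v → singleton (opposite (inject≤ v m≤n)) ≡ pad q (singleton (opposite v))
  one v = trans (cong singleton (opposite-inject≤ q v m≤n)) (singleton-↑ʳ q (opposite v))

-- From multiplicities back to a colouring

distribute : ∀ {K} l (f : Fin K → ℕ) → S (allFin K) f ≡ l →
  ∃ λ (g : Fin l → Fin K) → ∀ i → ∑ (λ j → ⟦ ⌊ g j Finₚ.≟ i ⌋ ⟧) ≡ f i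
distribute {K} zero f total = (λ ()) , λ i → sym (S-none f total (Finite.complete (finFin K) i))
distribute {K} (suc l) f total with S-positive (allFin K) f (subst (0 <_) (sym total) (s≤s z≤n))
... | i₀ , pos with distribute l (λ i → f i ∸ Finite.δ (finFin K) i₀ i) total'
  where
  open Finite (finFin K)
  total' : S (allFin K) (λ i → f i ∸ δ i₀ i) ≡ l
  total' = suc-injective (trans (+-comm 1 _) (trans (cong (S (allFin K) (λ i → f i ∸ δ i₀ i) +_) (sym (once i₀)))
    (trans (sym (S-+ (allFin K) _ _)) (trans (S-cong (allFin K) (λ i → sym (remove-unit (finFin K) f pos i))) total))))
... | g , h = g' , λ i → trans (cong₂ _+_ (cong ⟦_⟧ (⌊⌋-⇔ sym sym (i₀ Finₚ.≟ i) (i Finₚ.≟ i₀))) (h i))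
    (trans (+-comm _ (f i ∸ Finite.δ (finFin K) i₀ i)) (sym (remove-unit (finFin K) f pos i)))
  where
  g' : Fin (suc l) → Fin K
  g' Fin.zero    = i₀
  g' (Fin.suc j) = g j

module _ {m q l K : ℕ} (m≤n : m ≤ q + m) (χ : Edge m l → Fin K)
  (x : Vec Bool (q + m) → Fin K → ℕ)
  (total : ∀ A → S (allFin K) (x A) ≡ l * bin 0 3 (card A))
  (keeps : ∀ A i → card A ≡ 3 → x (pad q A) i ≡ count χ A i) where

  private
    n = q + m

  fresh : ∀ {v w t : Fin n} → v Fin.< w → w Fin.< t → ∃ λ (g : Fin l → Fin K) →
    ∀ i → ∑ (λ j → ⟦ ⌊ g j Finₚ.≟ i ⌋ ⟧) ≡ x (tset v w t) i
  fresh {v} {w} {t} p q = distribute l (x (tset v w t))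
    (trans (total (tset v w t)) (trans (cong (λ c → l * bin 0 3 c) (card-tset p q)) (*-identityʳ l)))

  restrict : ∀ {v w t : Fin n} → v Fin.< w → w Fin.< t → toℕ t < m → Fin l → Edge m l
  restrict {v} {w} {t} p q t<m j = mkEdge (Fin.fromℕ< (<-trans (<-trans p q) t<m)) (Fin.fromℕ< (<-trans q t<m)) (Fin.fromℕ< t<m)
    (subst₂ _<_ (sym (Finₚ.toℕ-fromℕ< _)) (sym (Finₚ.toℕ-fromℕ< _)) p)
    (subst₂ _<_ (sym (Finₚ.toℕ-fromℕ< _)) (sym (Finₚ.toℕ-fromℕ< _)) q) j

  -- The decision is an explicit argument so that `agrees` can rewrite it to its known value.
  colour : ∀ {v w t : Fin n} → v Fin.< w → w Fin.< t → Fin l → Dec (toℕ t < m) → Fin K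
  colour p q j (yes t<m) = χ (restrict p q t<m j)
  colour p q j (no _)    = proj₁ (fresh p q) j

  χ⁺ : Edge n l → Fin K
  χ⁺ (mkEdge v w t p q j) = colour p q j (toℕ t <? m)

  χ⁺-inject≤ : ∀ {v w t : Fin m} (p : v Fin.< w) (q : w Fin.< t) j p' q' →
    χ⁺ (mkEdge (inject≤ v m≤n) (inject≤ w m≤n) (inject≤ t m≤n) p' q' j) ≡ χ (mkEdge v w t p q j)
  χ⁺-inject≤ {v} {w} {t} p q j p' q' with toℕ (inject≤ t m≤n) <? m
  ... | yes t<m = cong χ (mkEdge-cong (back v (<-trans (<-trans p' q') t<m)) (back w (<-trans q' t<m)) (back t t<m))
    where
    back : ∀ v (h : toℕ (inject≤ v m≤n) < m) → Fin.fromℕ< h ≡ v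
    back v h = Finₚ.toℕ-injective (trans (Finₚ.toℕ-fromℕ< h) (Finₚ.toℕ-inject≤ v m≤n))
  ... | no t≮m = contradiction (subst (_< m) (sym (Finₚ.toℕ-inject≤ t m≤n)) (Finₚ.toℕ<n t)) t≮m

  χ⁺-extends : ∀ e → χ⁺ (ι m≤n e) ≡ χ e
  χ⁺-extends (mkEdge v w t p q j) = χ⁺-inject≤ p q j _ _

  agrees-old : ∀ i {v w t : Fin m} (p : v Fin.< w) (q : w Fin.< t) p' q' →
    x (tset (inject≤ v m≤n) (inject≤ w m≤n) (inject≤ t m≤n)) i ≡
      copies χ⁺ i (inject≤ v m≤n) (inject≤ w m≤n) (inject≤ t m≤n) p' q'
  agrees-old i {v} {w} {t} p r p' r' = trans (cong (λ A → x A i) (tset-inject≤ q m≤n v w t))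
    (trans (keeps (tset v w t) i (card-tset p r)) (trans (count-tset χ i p r)
      (∑-cong (λ j → cong (λ c → ⟦ ⌊ c Finₚ.≟ i ⌋ ⟧) (sym (χ⁺-inject≤ p r j p' r'))))))

  agrees : ∀ i {v w t : Fin n} (p : v Fin.< w) (q : w Fin.< t) → x (tset v w t) i ≡ copies χ⁺ i v w t p q
  agrees i {v} {w} {t} p q = cases (toℕ t <? m) refl
    where
    forth : ∀ v (h : toℕ v < m) → inject≤ (Fin.fromℕ< h) m≤n ≡ v
    forth v h = Finₚ.toℕ-injective (trans (Finₚ.toℕ-inject≤ _ m≤n) (Finₚ.toℕ-fromℕ< h))
    transport : ∀ {v w t} {v' w' t' : Fin m} → inject≤ v' m≤n ≡ v → inject≤ w' m≤n ≡ w → inject≤ t' m≤n ≡ t →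
      (p : v Fin.< w) (q : w Fin.< t) → x (tset v w t) i ≡ copies χ⁺ i v w t p q
    transport refl refl refl p q = agrees-old i (subst₂ _<_ (Finₚ.toℕ-inject≤ _ m≤n) (Finₚ.toℕ-inject≤ _ m≤n) p)
      (subst₂ _<_ (Finₚ.toℕ-inject≤ _ m≤n) (Finₚ.toℕ-inject≤ _ m≤n) q) p q
    cases : (old? : Dec (toℕ t < m)) → (toℕ t <? m) ≡ old? → x (tset v w t) i ≡ copies χ⁺ i v w t p q
    cases (yes t<m) _ = transport (forth v (<-trans (<-trans p q) t<m)) (forth w (<-trans q t<m)) (forth t t<m) p q
    cases (no t≮m) eq = trans (sym (proj₂ (fresh p q) i)) (∑-cong (λ j →
      cong (λ d → ⟦ ⌊ colour p q j d Finₚ.≟ i ⌋ ⟧) (sym eq)))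

  x-support : ∀ A i → 0 < x A i → card A ≡ 3
  x-support A i pos = bin0-positive 3 (card A) (positive-factorʳ l (subst (0 <_) (total A)
    (<-≤-trans pos (Finite.S-term (finFin K) (x A) i))))

  χ⁺-degree : ∀ i u → S (vecs n) (λ A → ⟦ lookup A (opposite u) ⟧ * x A i) ≡ deg χ⁺ i u
  χ⁺-degree i u = trans (deg-sets χ⁺ x agrees x-support i (opposite u)) (cong (deg χ⁺ i) (Finₚ.opposite-involutive u))

  Linked⇒Adjacent : ∀ {i v w} → (∃ λ A → 0 < x A i × lookup A v ≡ true × lookup A w ≡ true) →
    Adjacent χ⁺ i (opposite v) (opposite w)
  Linked⇒Adjacent {i} (A , pos , v∈A , w∈A) with tset-surjective A (x-support A i pos)
  ... | a , b , c , p , q , refl with S-positive (allFin l) _ (subst (0 <_) (trans (agrees i p q) (sym (S-allFin l _))) pos)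
  ... | j , pos' = mkEdge a b c p q j , ⌊⌋-true (χ⁺ (mkEdge a b c p q j) Finₚ.≟ i) (⟦⟧-positive (subst (0 <_) (sym (*-identityʳ _)) pos')) ,
      ∈-tset v∈A , ∈-tset w∈A

  χ⁺-connected : (∀ i v w → Star (λ v w → ∃ λ A → 0 < x A i × lookup A v ≡ true × lookup A w ≡ true) v w) →
    ∀ i u v → Star (Adjacent χ⁺ i) u v
  χ⁺-connected conn i u v = subst₂ (Star (Adjacent χ⁺ i)) (Finₚ.opposite-involutive u) (Finₚ.opposite-involutive v)
    (gmap opposite Linked⇒Adjacent (conn i (opposite u) (opposite v)))

-- The numbers of edges of each kind

halve : ∀ D → ∃ λ h → ∃ λ ρ → D ≡ 2 * h + ρ × ρ ≤ 1
halve zero          = 0 , 0 , refl , z≤n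
halve (suc zero)    = 0 , 1 , refl , s≤s z≤n
halve (suc (suc D)) with halve D
... | h , ρ , e , ρ≤1 = suc h , ρ , trans (cong (λ t → suc (suc t)) e) (arith h ρ) , ρ≤1
  where
  arith : ∀ h ρ → 2 + (2 * h + ρ) ≡ 2 * (1 + h) + ρ
  arith = solve-∀

half-≤ : ∀ {x D h ρ} → D ≡ 2 * h + ρ → ρ ≤ 1 → 2 * x ≤ D → x ≤ h
half-≤ {x} {D} {h} {ρ} e ρ≤1 2x≤D with x ≤? h
... | yes p = p
... | no ¬p = contradiction (begin
    2 * h + 2   ≡⟨ arith h ⟩
    2 * suc h   ≤⟨ *-monoʳ-≤ 2 (≰⇒> ¬p) ⟩
    2 * x       ≤⟨ 2x≤D ⟩
    D           ≡⟨ e ⟩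
    2 * h + ρ   ≤⟨ +-monoʳ-≤ (2 * h) ρ≤1 ⟩
    2 * h + 1 ∎) (<⇒≱ (+-monoʳ-< (2 * h) (s≤s (s≤s z≤n))))
  where
  open ≤-Reasoning
  arith : ∀ h → 2 * h + 2 ≡ 2 * (1 + h)
  arith = solve-∀

parity-gap : ∀ h N → 2 * h + 1 ≤ 2 * N → 2 * h + 2 ≤ 2 * N
parity-gap h N le with suc h ≤? N
... | yes p = ≤-trans (≤-reflexive (arith h)) (*-monoʳ-≤ 2 p)
  where
  arith : ∀ h → 2 * h + 2 ≡ 2 * (1 + h)
  arith = solve-∀
... | no ¬p = contradiction (≤-trans (≤-reflexive (+-comm 1 (2 * h))) le) (<⇒≱ (s≤s (*-monoʳ-≤ 2 (≤-pred (≰⇒> ¬p)))))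

half-square-positive : ∀ {a} x → 3 ≤ a → 2 * x + a ≡ a * a → 1 ≤ x
half-square-positive {a} zero    3≤a e = contradiction (≤-trans (*-monoˡ-≤ a 3≤a) (≤-reflexive (sym e)))
  (<⇒≱ (m<m+n a (≤-trans (≤-trans (s≤s z≤n) 3≤a) (m≤m+n a _))))
half-square-positive     (suc x) _   _ = s≤s z≤n

-- In this module Q = suc q is the number of new vertices, m = suc a the number of old ones; there are k
-- old and k' new colours.  An old colour still needs degree d at the old vertices, and N resp. N' are the
-- numbers of further edges of an old resp. new colour.
module Counting
  (a q r s l k k' d N N' A B M₂ b₂ Q₂ Q₃ : ℕ)
  (hA : 2 * A + a ≡ a * a) (hM : M₂ ≡ A + a) (hb : 2 * b₂ + q ≡ q * q) (hQ₂ : Q₂ ≡ b₂ + q)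
  (hQ₃ : 3 * Q₃ ≡ suc q * b₂) (hB : B ≡ A + suc q * a + Q₂)
  (1≤r : 1 ≤ r) (1≤l : 1 ≤ l) (3≤a : 3 ≤ a) (d+r : d + r ≡ s) (1≤d : 1 ≤ d)
  (rk : r * k ≡ l * A) (sK : s * (k + k') ≡ l * B)
  (hN : 3 * N ≡ suc q * s + suc a * d) (hN' : 3 * N' ≡ suc q * s + suc a * s)
  (iii : s * A < r * B → suc a ≤ 2 * suc q)
  (iv : ∀ u v → 3 * suc a ≡ (suc q + suc a) + u → r * B ≡ s * A + v → u * v ≤ 3 * r * (suc q * M₂))
  where

  open ≤-Reasoning

  -- `E₂`, `E₁`, `E₀` are the numbers of edges with two, one and no old vertices. `D` and `D'` are
  -- the degree sums that an old and a new colour still need at the old vertices.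
  m Q E₂ E₁ E₀ D D' : ℕ
  m = suc a
  Q = suc q
  E₂ = l * (Q * M₂)
  E₁ = l * (m * Q₂)
  E₀ = l * Q₃
  D  = m * d
  D' = m * s

  2M₂ : 2 * M₂ ≡ a * m
  2M₂ = begin-equality
    2 * M₂            ≡⟨ cong (2 *_) hM ⟩
    2 * (A + a)       ≡⟨ one A a ⟩
    (2 * A + a) + a   ≡⟨ cong (_+ a) hA ⟩
    a * a + a         ≡⟨ two a ⟩
    a * m ∎
    where
    one : ∀ A a → 2 * (A + a) ≡ (2 * A + a) + a
    one = solve-∀
    two : ∀ a → a * a + a ≡ a * (1 + a)
    two = solve-∀

  2Q₂ : 2 * Q₂ ≡ q * Q
  2Q₂ = begin-equality
    2 * Q₂            ≡⟨ cong (2 *_) hQ₂ ⟩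
    2 * (b₂ + q)      ≡⟨ one b₂ q ⟩
    (2 * b₂ + q) + q  ≡⟨ cong (_+ q) hb ⟩
    q * q + q         ≡⟨ two q ⟩
    q * Q ∎
    where
    one : ∀ A a → 2 * (A + a) ≡ (2 * A + a) + a
    one = solve-∀
    two : ∀ a → a * a + a ≡ a * (1 + a)
    two = solve-∀

  -- Both sides count the incidences of old vertices with edges that also contain new vertices.
  degree-sum : k * D + k' * D' ≡ 2 * E₂ + E₁
  degree-sum = +-cancelʳ-≡ (m * (r * k)) _ _ (begin-equality
    k * (m * d) + k' * (m * s) + m * (r * k)     ≡⟨ one k k' m d s r ⟩
    m * ((d + r) * k + s * k')                   ≡⟨ cong (λ t → m * (t * k + s * k')) d+r ⟩
    m * (s * k + s * k')                         ≡⟨ cong (m *_) (trans (sym (*-distribˡ-+ s k k')) sK) ⟩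
    m * (l * B)                                  ≡⟨ cong (λ t → m * (l * t)) hB ⟩
    m * (l * (A + Q * a + Q₂))                   ≡⟨ two m l A Q a Q₂ ⟩
    l * (Q * (a * m)) + l * (m * Q₂) + m * (l * A)
      ≡⟨ cong₂ (λ t t' → l * (Q * t) + E₁ + m * t') (sym 2M₂) (sym rk) ⟩
    l * (Q * (2 * M₂)) + E₁ + m * (r * k)        ≡⟨ cong (λ t → t + E₁ + m * (r * k)) (three l Q M₂) ⟩
    2 * E₂ + E₁ + m * (r * k) ∎)
    where
    one : ∀ k k' m d s r → k * (m * d) + k' * (m * s) + m * (r * k) ≡ m * ((d + r) * k + s * k')
    one = solve-∀
    two : ∀ m l A Q a Q₂ → m * (l * (A + Q * a + Q₂)) ≡ l * (Q * (a * m)) + l * (m * Q₂) + m * (l * A)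
    two = solve-∀
    three : ∀ l Q M → l * (Q * (2 * M)) ≡ 2 * (l * (Q * M))
    three = solve-∀

  edge-sum : k * N + k' * N' ≡ E₂ + E₁ + E₀
  edge-sum = *-cancelˡ-≡ _ _ 3 (begin-equality
    3 * (k * N + k' * N')                            ≡⟨ one k k' N N' ⟩
    k * (3 * N) + k' * (3 * N')                      ≡⟨ cong₂ (λ t t' → k * t + k' * t') hN hN' ⟩
    k * (Q * s + D) + k' * (Q * s + D')              ≡⟨ two k k' Q s D D' ⟩
    Q * (s * (k + k')) + (k * D + k' * D')           ≡⟨ cong₂ (λ t t' → Q * t + t') sK degree-sum ⟩
    Q * (l * B) + (2 * E₂ + E₁)                      ≡⟨ cong (_+ (2 * E₂ + E₁)) (three Q l B) ⟩
    l * (Q * B) + (2 * E₂ + E₁)                      ≡⟨ cong (λ t → l * t + (2 * E₂ + E₁)) QB ⟩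
    l * (Q * M₂ + 2 * (m * Q₂) + 3 * Q₃) + (2 * E₂ + E₁) ≡⟨ four l (Q * M₂) (m * Q₂) Q₃ ⟩
    3 * (E₂ + E₁ + E₀) ∎)
    where
    one : ∀ k k' N N' → 3 * (k * N + k' * N') ≡ k * (3 * N) + k' * (3 * N')
    one = solve-∀
    two : ∀ k k' Q s D D' → k * (Q * s + D) + k' * (Q * s + D') ≡ Q * (s * (k + k')) + (k * D + k' * D')
    two = solve-∀
    three : ∀ Q l B → Q * (l * B) ≡ l * (Q * B)
    three = solve-∀
    four : ∀ l x y z → l * (x + 2 * y + 3 * z) + (2 * (l * x) + l * y) ≡ 3 * (l * x + l * y + l * z)
    four = solve-∀
    QB : Q * B ≡ Q * M₂ + 2 * (m * Q₂) + 3 * Q₃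
    QB = begin-equality
      Q * B                                            ≡⟨ cong (Q *_) (trans hB (cong (A + Q * a +_) hQ₂)) ⟩
      Q * (A + Q * a + (b₂ + q))                       ≡⟨ five A a b₂ q ⟩
      Q * (A + a) + m * (q * Q) + Q * b₂               ≡⟨ cong₂ (λ t t' → Q * t + m * t' + Q * b₂) (sym hM) (sym 2Q₂) ⟩
      Q * M₂ + m * (2 * Q₂) + Q * b₂                   ≡⟨ cong₂ (λ t t' → Q * M₂ + t + t') (six m Q₂) (sym hQ₃) ⟩
      Q * M₂ + 2 * (m * Q₂) + 3 * Q₃ ∎
      where
      five : ∀ A a b q → (1 + q) * (A + (1 + q) * a + (b + q)) ≡ (1 + q) * (A + a) + (1 + a) * (q * (1 + q)) + (1 + q) * b
      five = solve-∀
      six : ∀ m Q → m * (2 * Q) ≡ 2 * (m * Q)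
      six = solve-∀

  d≤s : d ≤ s
  d≤s = ≤-trans (m≤m+n d r) (≤-reflexive d+r)

  2≤s : 2 ≤ s
  2≤s = ≤-trans (+-mono-≤ 1≤d 1≤r) (≤-reflexive d+r)

  1≤A : 1 ≤ A
  1≤A = half-square-positive A 3≤a hA

  instance
    l≢0 : NonZero l
    l≢0 = >-nonZero 1≤l
    r≢0 : NonZero r
    r≢0 = >-nonZero 1≤r
    s≢0 : NonZero s
    s≢0 = >-nonZero (≤-trans (s≤s z≤n) 2≤s)

  1≤k : 1 ≤ k
  1≤k = positive-factorʳ r (subst (0 <_) (sym rk) (*-mono-≤ 1≤l 1≤A))

  -- (n-1 choose 2) r - (m-1 choose 2) s, up to the factor l, counts the new colours.
  excess : r * (k' * s) + l * (s * A) ≡ l * (r * B)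
  excess = begin-equality
    r * (k' * s) + l * (s * A)      ≡⟨ one r k' s l A ⟩
    r * (k' * s) + s * (l * A)      ≡⟨ cong (λ t → r * (k' * s) + s * t) (sym rk) ⟩
    r * (k' * s) + s * (r * k)      ≡⟨ two r k' s k ⟩
    r * (s * (k + k'))              ≡⟨ cong (r *_) sK ⟩
    r * (l * B)                     ≡⟨ three r l B ⟩
    l * (r * B) ∎
    where
    one : ∀ r k' s l A → r * (k' * s) + l * (s * A) ≡ r * (k' * s) + s * (l * A)
    one = solve-∀
    two : ∀ r k' s k → r * (k' * s) + s * (r * k) ≡ r * (s * (k + k'))
    two = solve-∀
    three : ∀ r l B → r * (l * B) ≡ l * (r * B)
    three = solve-∀

  m≤2Q : 1 ≤ k' → m ≤ 2 * Q
  m≤2Q 1≤k' = iii (*-cancelˡ-< l _ _ (begin-strict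
    l * (s * A)                   <⟨ m<n+m (l * (s * A)) (*-mono-≤ 1≤r (*-mono-≤ 1≤k' (≤-trans (s≤s z≤n) 2≤s))) ⟩
    r * (k' * s) + l * (s * A)    ≡⟨ excess ⟩
    l * (r * B) ∎))

  -- This is what makes the interval from D - N to D/2 nonempty. After multiplication by three it
  -- follows from m ≤ 2Q and t ≤ s. The general `t` covers the old colours too, as long as a new
  -- colour exists.
  D≤2N-new : ∀ t M → t ≤ s → 1 ≤ k' → 3 * M ≡ Q * s + m * t → m * t ≤ 2 * M
  D≤2N-new t M t≤s 1≤k' hM = *-cancelˡ-≤ 3 (begin
    3 * (m * t)                       ≡⟨ one (m * t) ⟩
    m * t + 2 * (m * t)               ≤⟨ +-monoˡ-≤ (2 * (m * t)) (*-mono-≤ (m≤2Q 1≤k') t≤s) ⟩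
    2 * Q * s + 2 * (m * t)           ≡⟨ two Q s (m * t) ⟩
    2 * (Q * s + m * t)               ≡⟨ cong (2 *_) (sym hM) ⟩
    2 * (3 * M)                       ≡⟨ three M ⟩
    3 * (2 * M) ∎)
    where
    one : ∀ x → 3 * x ≡ x + 2 * x
    one = solve-∀
    two : ∀ Q s x → 2 * Q * s + 2 * x ≡ 2 * (Q * s + x)
    two = solve-∀
    three : ∀ x → 2 * (3 * x) ≡ 3 * (2 * x)
    three = solve-∀

  kD-only : k' ≡ 0 → k * D ≡ 2 * E₂ + E₁
  kD-only e = trans (sym (trans (cong (λ t → k * D + t * D') e) (+-identityʳ _))) degree-sum

  kN-only : k' ≡ 0 → k * N ≡ E₂ + E₁ + E₀
  kN-only e = trans (sym (trans (cong (λ t → k * N + t * N') e) (+-identityʳ _))) edge-sum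

  -- Without new colours (iii) is silent, but then the old colours share all edges evenly and the
  -- inequality may be checked on the totals.
  D≤2N : D ≤ 2 * N
  D≤2N with 1 ≤? k'
  ... | yes 1≤k' = D≤2N-new d N d≤s 1≤k' hN
  ... | no ¬1≤k' = *-cancelˡ-≤ k {{>-nonZero 1≤k}} (begin
      k * D                       ≡⟨ kD-only (n<1⇒n≡0 (≰⇒> ¬1≤k')) ⟩
      2 * E₂ + E₁                 ≤⟨ m≤m+n _ (E₁ + 2 * E₀) ⟩
      2 * E₂ + E₁ + (E₁ + 2 * E₀) ≡⟨ one E₂ E₁ E₀ ⟩
      2 * (E₂ + E₁ + E₀)          ≡⟨ cong (2 *_) (sym (kN-only (n<1⇒n≡0 (≰⇒> ¬1≤k')))) ⟩
      2 * (k * N)                 ≡⟨ two k N ⟩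
      k * (2 * N) ∎)
    where
    one : ∀ x y z → 2 * x + y + (y + 2 * z) ≡ 2 * (x + y + z)
    one = solve-∀
    two : ∀ x y → 2 * (x * y) ≡ x * (2 * y)
    two = solve-∀

  -- (iv) is the case in which only the new colours force edges with two old vertices. If the new
  -- colours force none, neither do the old ones, because d ≤ s. If both force some, no subtraction
  -- truncates and the sum is E₂ - E₀.
  lower : k * (D ∸ N) + k' * (D' ∸ N') ≤ E₂
  lower with D' ≤? N' | D ≤? N
  ... | yes D'≤N' | _ = ≤-trans (≤-reflexive (cong₂ _+_
      (trans (cong (k *_) (m≤n⇒m∸n≡0 D≤N)) (*-zeroʳ k))
      (trans (cong (k' *_) (m≤n⇒m∸n≡0 D'≤N')) (*-zeroʳ k')))) z≤n
    where
    2D'≤Qs : 2 * D' ≤ Q * s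
    2D'≤Qs = +-cancelʳ-≤ D' _ _ (≤-trans (≤-reflexive (+-comm (2 * D') D')) (≤-trans (*-monoʳ-≤ 3 D'≤N') (≤-reflexive hN')))
    D≤N : D ≤ N
    D≤N = *-cancelˡ-≤ 3 (begin
      D + 2 * D        ≡⟨ +-comm D _ ⟩
      2 * D + D        ≤⟨ +-monoˡ-≤ D (≤-trans (*-monoʳ-≤ 2 (*-monoʳ-≤ m d≤s)) 2D'≤Qs) ⟩
      Q * s + D        ≡⟨ sym hN ⟩
      3 * N ∎)
  ... | no D'≰N' | yes D≤N rewrite m≤n⇒m∸n≡0 D≤N | *-zeroʳ k = *-cancelˡ-≤ (3 * r) {{m*n≢0 3 r}} (begin
      3 * r * (k' * (D' ∸ N'))        ≡⟨ one r k' (D' ∸ N') ⟩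
      r * (k' * (3 * (D' ∸ N')))      ≡⟨ cong (λ t → r * (k' * t)) gap ⟩
      r * (k' * (s * u))              ≡⟨ two r k' s u ⟩
      u * (r * (k' * s))              ≡⟨ cong (u *_) new-colours ⟩
      u * (l * v)                     ≡⟨ three u l v ⟩
      l * (u * v)                     ≤⟨ *-monoʳ-≤ l (iv u v hu hv) ⟩
      l * (3 * r * (Q * M₂))          ≡⟨ three l (3 * r) (Q * M₂) ⟩
      3 * r * E₂ ∎)
    where
    n+m≤3m : Q + m ≤ 3 * m
    n+m≤3m = *-cancelʳ-≤ (Q + m) (3 * m) s (begin
      (Q + m) * s       ≡⟨ *-distribʳ-+ s Q m ⟩
      Q * s + m * s     ≡⟨ sym hN' ⟩
      3 * N'            ≤⟨ *-monoʳ-≤ 3 (<⇒≤ (≰⇒> D'≰N')) ⟩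
      3 * D'            ≡⟨ sym (*-assoc 3 m s) ⟩
      3 * m * s ∎)
    sA≤rB : s * A ≤ r * B
    sA≤rB = *-cancelˡ-≤ l (≤-trans (m≤n+m _ (r * (k' * s))) (≤-reflexive excess))
    u v : ℕ
    u = 3 * m ∸ (Q + m)
    v = r * B ∸ s * A
    hu : 3 * m ≡ (Q + m) + u
    hu = sym (m+[n∸m]≡n n+m≤3m)
    hv : r * B ≡ s * A + v
    hv = sym (m+[n∸m]≡n sA≤rB)
    new-colours : r * (k' * s) ≡ l * v
    new-colours = +-cancelʳ-≡ (l * (s * A)) _ _ (trans excess (trans (cong (l *_) hv)
      (trans (*-distribˡ-+ l _ v) (+-comm _ (l * v)))))
    gap : 3 * (D' ∸ N') ≡ s * u
    gap = +-cancelʳ-≡ (3 * N') _ _ (begin-equality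
      3 * (D' ∸ N') + 3 * N'        ≡⟨ sym (*-distribˡ-+ 3 (D' ∸ N') N') ⟩
      3 * (D' ∸ N' + N')            ≡⟨ cong (3 *_) (m∸n+n≡m (<⇒≤ (≰⇒> D'≰N'))) ⟩
      3 * (m * s)                   ≡⟨ sym (*-assoc 3 m s) ⟩
      3 * m * s                     ≡⟨ cong (_* s) hu ⟩
      ((Q + m) + u) * s             ≡⟨ four Q m u s ⟩
      s * u + (Q * s + m * s)       ≡⟨ cong (s * u +_) (sym hN') ⟩
      s * u + 3 * N' ∎)
      where
      four : ∀ Q m u s → ((Q + m) + u) * s ≡ s * u + (Q * s + m * s)
      four = solve-∀
    one : ∀ r k x → 3 * r * (k * x) ≡ r * (k * (3 * x))
    one = solve-∀
    two : ∀ r k s u → r * (k * (s * u)) ≡ u * (r * (k * s))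
    two = solve-∀
    three : ∀ u l v → u * (l * v) ≡ l * (u * v)
    three = solve-∀
  ... | no D'≰N' | no D≰N = +-cancelʳ-≤ (k * N + k' * N') _ _ (begin
      k * (D ∸ N) + k' * (D' ∸ N') + (k * N + k' * N')     ≡⟨ one k k' (D ∸ N) (D' ∸ N') N N' ⟩
      k * (D ∸ N + N) + k' * (D' ∸ N' + N')
        ≡⟨ cong₂ (λ x y → k * x + k' * y) (m∸n+n≡m (<⇒≤ (≰⇒> D≰N))) (m∸n+n≡m (<⇒≤ (≰⇒> D'≰N'))) ⟩
      k * D + k' * D'                                      ≡⟨ degree-sum ⟩
      2 * E₂ + E₁                                          ≤⟨ m≤m+n _ E₀ ⟩
      2 * E₂ + E₁ + E₀                                     ≡⟨ two E₂ E₁ E₀ ⟩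
      E₂ + (E₂ + E₁ + E₀)                                  ≡⟨ cong (E₂ +_) (sym edge-sum) ⟩
      E₂ + (k * N + k' * N') ∎)
    where
    one : ∀ k k' x y N N' → k * x + k' * y + (k * N + k' * N') ≡ k * (x + N) + k' * (y + N')
    one = solve-∀
    two : ∀ x y z → 2 * x + y + z ≡ x + (x + y + z)
    two = solve-∀

  B≤mQq : 5 ≤ m → m ≤ 2 * Q → B ≤ m * (Q * q)
  B≤mQq 5≤m m≤2Q = *-cancelˡ-≤ 2 (begin
    2 * B                                 ≡⟨ cong (2 *_) hB ⟩
    2 * (A + Q * a + Q₂)                  ≡⟨ one A Q a Q₂ ⟩
    2 * A + 2 * (Q * a) + 2 * Q₂          ≡⟨ cong (2 * A + 2 * (Q * a) +_) 2Q₂ ⟩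
    2 * A + 2 * (Q * a) + q * Q           ≤⟨ +-cancelʳ-≤ (Q + a) _ _ square ⟩
    10 * (Q * q)                          ≤⟨ *-monoˡ-≤ (Q * q) (*-monoʳ-≤ 2 5≤m) ⟩
    2 * m * (Q * q)                       ≡⟨ *-assoc 2 m (Q * q) ⟩
    2 * (m * (Q * q)) ∎)
    where
    one : ∀ A Q a Q₂ → 2 * (A + Q * a + Q₂) ≡ 2 * A + 2 * (Q * a) + 2 * Q₂
    one = solve-∀
    1≤q : 1 ≤ q
    1≤q = positive q (≤-trans 5≤m m≤2Q)
      where
      positive : ∀ q → 5 ≤ 2 * suc q → 1 ≤ q
      positive zero    (s≤s (s≤s ()))
      positive (suc q) _ = s≤s z≤n
    -- The left-hand side is increasing in a, so a = 2 q + 1 is the extreme case.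
    square : 2 * A + 2 * (Q * a) + q * Q + (Q + a) ≤ 10 * (Q * q) + (Q + a)
    square = begin
      2 * A + 2 * (Q * a) + q * Q + (Q + a)        ≡⟨ two A a q ⟩
      (2 * A + a) + 2 * (Q * a) + Q * Q            ≡⟨ cong (λ t → t + 2 * (Q * a) + Q * Q) hA ⟩
      a * a + 2 * (Q * a) + Q * Q                  ≡⟨ three a q ⟩
      (a + Q) * (a + q) + (a + Q)                  ≤⟨ +-monoˡ-≤ (a + Q) (*-mono-≤ (+-monoˡ-≤ Q a≤) (+-monoˡ-≤ q a≤)) ⟩
      (2 * q + 1 + Q) * (2 * q + 1 + q) + (a + Q)  ≤⟨ +-monoˡ-≤ (a + Q) (final q 1≤q) ⟩
      10 * (Q * q) + (a + Q)                       ≡⟨ cong (10 * (Q * q) +_) (+-comm a Q) ⟩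
      10 * (Q * q) + (Q + a) ∎
      where
      a≤ : a ≤ 2 * q + 1
      a≤ = ≤-pred (≤-trans m≤2Q (≤-reflexive (four q)))
        where
        four : ∀ q → 2 * (1 + q) ≡ 1 + (2 * q + 1)
        four = solve-∀
      two : ∀ A a q → 2 * A + 2 * ((1 + q) * a) + q * (1 + q) + ((1 + q) + a) ≡ (2 * A + a) + 2 * ((1 + q) * a) + (1 + q) * (1 + q)
      two = solve-∀
      three : ∀ a q → a * a + 2 * ((1 + q) * a) + (1 + q) * (1 + q) ≡ (a + (1 + q)) * (a + q) + (a + (1 + q))
      three = solve-∀
      final : ∀ q → 1 ≤ q → (2 * q + 1 + suc q) * (2 * q + 1 + q) ≤ 10 * (suc q * q)
      final (suc q) _ = ≤-trans (m≤m+n _ (q * q + 3 * q)) (≤-reflexive (five q))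
        where
        five : ∀ q → (2 * (1 + q) + 1 + (1 + (1 + q))) * (2 * (1 + q) + 1 + (1 + q)) + (q * q + 3 * q) ≡ 10 * ((1 + (1 + q)) * (1 + q))
        five = solve-∀

  -- At worst every colour has an odd degree sum. The colours number l B / s, and 2 E₁ = l m Q q;
  -- the factor two is absorbed by s ≥ 2.
  all-odd : 1 ≤ k' → 5 ≤ m → k + k' ≤ E₁
  all-odd 1≤k' 5≤m = *-cancelˡ-≤ s (begin
    s * (k + k')             ≡⟨ sK ⟩
    l * B                    ≤⟨ *-monoʳ-≤ l (B≤mQq 5≤m (m≤2Q 1≤k')) ⟩
    l * (m * (Q * q))        ≡⟨ cong (λ t → l * (m * t)) (trans (*-comm Q q) (sym 2Q₂)) ⟩
    l * (m * (2 * Q₂))       ≡⟨ one l m Q₂ ⟩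
    2 * (l * (m * Q₂))       ≤⟨ *-monoˡ-≤ E₁ 2≤s ⟩
    s * E₁ ∎)
    where
    one : ∀ l m Q → l * (m * (2 * Q)) ≡ 2 * (l * (m * Q))
    one = solve-∀

  -- For q ≥ 2, the equality s A = r B with s > r bounds A by r m Q₂. For q ≤ 1 no edge has three
  -- new vertices, so k (2N - D) = E₁; an odd D makes 2N - D at least one.
  old-odd : k' ≡ 0 → ∀ h → D ≡ 2 * h + 1 → k ≤ E₁
  old-odd k'≡0 h odd with 2 ≤? q
  ... | yes 2≤q = *-cancelˡ-≤ r (begin
      r * k                     ≡⟨ rk ⟩
      l * A                     ≤⟨ *-monoʳ-≤ l A≤ ⟩
      l * (r * (m * Q₂))        ≡⟨ one l r (m * Q₂) ⟩
      r * E₁ ∎)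
    where
    one : ∀ l r x → l * (r * x) ≡ r * (l * x)
    one = solve-∀
    sA≡rB : s * A ≡ r * B
    sA≡rB = *-cancelˡ-≡ _ _ l (trans (cong (_+ l * (s * A)) (sym (trans (cong (λ t → r * (t * s)) k'≡0) (*-zeroʳ r)))) excess)
    Q≤Q₂ : Q ≤ Q₂
    Q≤Q₂ = *-cancelˡ-≤ 2 (≤-trans (*-monoˡ-≤ Q 2≤q) (≤-reflexive (sym 2Q₂)))
    A≤ : A ≤ r * (m * Q₂)
    A≤ = +-cancelʳ-≤ (r * A) _ _ (begin
      A + r * A                         ≤⟨ *-monoˡ-≤ A (≤-trans (+-monoˡ-≤ r 1≤d) (≤-reflexive d+r)) ⟩
      s * A                             ≡⟨ trans sA≡rB (cong (r *_) hB) ⟩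
      r * (A + Q * a + Q₂)              ≤⟨ *-monoʳ-≤ r (+-monoˡ-≤ Q₂ (+-monoʳ-≤ A (*-monoˡ-≤ a Q≤Q₂))) ⟩
      r * (A + Q₂ * a + Q₂)             ≡⟨ two r A Q₂ a ⟩
      r * (m * Q₂) + r * A ∎)
      where
      two : ∀ r A Q a → r * (A + Q * a + Q) ≡ r * ((1 + a) * Q) + r * A
      two = solve-∀
  ... | no 2≰q = +-cancelʳ-≤ (k * D) _ _ (begin
      k + k * D                   ≡⟨ cong (λ t → k + k * t) odd ⟩
      k + k * (2 * h + 1)         ≡⟨ one k h ⟩
      k * (2 * h + 2)             ≤⟨ *-monoʳ-≤ k (parity-gap h N (≤-trans (≤-reflexive (sym odd)) D≤2N)) ⟩
      k * (2 * N)                 ≡⟨ two k N ⟩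
      2 * (k * N)                 ≡⟨ cong (2 *_) (kN-only k'≡0) ⟩
      2 * (E₂ + E₁ + E₀)          ≡⟨ cong (λ t → 2 * (E₂ + E₁ + t)) E₀≡0 ⟩
      2 * (E₂ + E₁ + 0)           ≡⟨ three E₂ E₁ ⟩
      E₁ + (2 * E₂ + E₁)          ≡⟨ cong (E₁ +_) (sym (kD-only k'≡0)) ⟩
      E₁ + k * D ∎)
    where
    one : ∀ k h → k + k * (2 * h + 1) ≡ k * (2 * h + 2)
    one = solve-∀
    two : ∀ k N → k * (2 * N) ≡ 2 * (k * N)
    two = solve-∀
    three : ∀ x y → 2 * (x + y + 0) ≡ y + (2 * x + y)
    three = solve-∀
    small : ∀ q → q ≤ 1 → ∀ b → 2 * b + q ≡ q * q → b ≡ 0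
    small q q≤1 zero    e = refl
    small zero    q≤1 (suc b) ()
    small (suc zero) q≤1 (suc b) e = contradiction (trans (sym (one' b)) e) λ ()
      where
      one' : ∀ b → 2 * (1 + b) + 1 ≡ 3 + 2 * b
      one' = solve-∀
    small (suc (suc q)) (s≤s ()) (suc b) e
    E₀≡0 : E₀ ≡ 0
    E₀≡0 = trans (cong (l *_) (m+n≡0⇒m≡0 Q₃ (trans hQ₃ (trans (cong (Q *_) (small q (≤-pred (≰⇒> 2≰q)) b₂ hb)) (*-zeroʳ Q))))) (*-zeroʳ l)

  -- The degree sums add up to 2 E₂ + E₁, and rounding their halves down loses one half per odd sum.
  -- So at most E₁ odd sums are harmless. An even m yields none; an odd m is at least five because m
  -- > 3.
  upper : ∀ h ρ h' ρ' → D ≡ 2 * h + ρ → ρ ≤ 1 → D' ≡ 2 * h' + ρ' → ρ' ≤ 1 → E₂ ≤ k * h + k' * h'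
  upper h ρ h' ρ' e ρ≤1 e' ρ'≤1 = *-cancelˡ-≤ 2 (+-cancelʳ-≤ E₁ _ _ (begin
    2 * E₂ + E₁                                       ≡⟨ sym degree-sum ⟩
    k * D + k' * D'                                   ≡⟨ cong₂ (λ x y → k * x + k' * y) e e' ⟩
    k * (2 * h + ρ) + k' * (2 * h' + ρ')              ≡⟨ one k k' h h' ρ ρ' ⟩
    2 * (k * h + k' * h') + (k * ρ + k' * ρ')         ≤⟨ +-monoʳ-≤ (2 * (k * h + k' * h')) odd-colours ⟩
    2 * (k * h + k' * h') + E₁ ∎))
    where
    one : ∀ k k' h h' ρ ρ' → k * (2 * h + ρ) + k' * (2 * h' + ρ') ≡ 2 * (k * h + k' * h') + (k * ρ + k' * ρ')
    one = solve-∀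
    even-mod : ∀ x h ρ → 2 * x ≡ 2 * h + ρ → ρ ≤ 1 → ρ ≡ 0
    even-mod x h zero       eq _ = refl
    even-mod x h (suc zero) eq _ = contradiction (parity-gap h x (≤-reflexive (sym eq)))
      (<⇒≱ (≤-trans (≤-reflexive (cong suc eq)) (≤-reflexive (sym (+-suc (2 * h) 1)))))
    even-mod x h (suc (suc ρ)) eq (s≤s ())
    odd-colours : k * ρ + k' * ρ' ≤ E₁
    odd-colours with 1 ≤? k'
    ... | no ¬1≤k' = ≤-trans (≤-reflexive (trans (cong (λ t → k * ρ + t * ρ') k'≡0) (+-identityʳ _))) (old ρ e ρ≤1)
      where
      k'≡0 : k' ≡ 0
      k'≡0 = n<1⇒n≡0 (≰⇒> ¬1≤k')
      old : ∀ ρ → D ≡ 2 * h + ρ → ρ ≤ 1 → k * ρ ≤ E₁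
      old zero          eq _        = ≤-trans (≤-reflexive (*-zeroʳ k)) z≤n
      old (suc zero)    eq _        = ≤-trans (≤-reflexive (*-identityʳ k)) (old-odd k'≡0 h eq)
      old (suc (suc ρ)) eq (s≤s ())
    ... | yes 1≤k' with halve m
    ... | g , zero , m-even , _ = ≤-trans (≤-reflexive (cong₂ _+_
        (trans (cong (k *_) (even-mod (g * d) h ρ (trans (even d) e) ρ≤1)) (*-zeroʳ k))
        (trans (cong (k' *_) (even-mod (g * s) h' ρ' (trans (even s) e') ρ'≤1)) (*-zeroʳ k')))) z≤n
      where
      even : ∀ t → 2 * (g * t) ≡ m * t
      even t = trans (sym (*-assoc 2 g t)) (cong (_* t) (sym (trans m-even (+-identityʳ _))))
    ... | g , suc zero , m-odd , _ = ≤-trans (+-mono-≤ (≤-trans (*-monoʳ-≤ k ρ≤1) (≤-reflexive (*-identityʳ k)))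
        (≤-trans (*-monoʳ-≤ k' ρ'≤1) (≤-reflexive (*-identityʳ k')))) (all-odd 1≤k' (five g m-odd))
      where
      five : ∀ g → m ≡ 2 * g + 1 → 5 ≤ m
      five zero          eq = contradiction (≤-trans (s≤s 3≤a) (≤-reflexive eq)) λ { (s≤s ()) }
      five (suc zero)    eq = contradiction (≤-trans (s≤s 3≤a) (≤-reflexive eq)) λ { (s≤s (s≤s (s≤s ()))) }
      five (suc (suc g)) eq = ≤-trans (m≤m+n 5 (2 * g)) (≤-reflexive (trans (six g) (sym eq)))
        where
        six : ∀ g → 5 + 2 * g ≡ 2 * (2 + g) + 1
        six = solve-∀
    ... | g , suc (suc _) , _ , s≤s ()

-- Counting sets and factors

number-of-sets : ∀ t j → S (vecs t) (λ A → bin 0 j (card A)) ≡ t C j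
number-of-sets zero    j       = +-identityʳ _
number-of-sets (suc t) zero    = trans (S-vecs t _) (trans (cong₂ _+_ (S-zero (vecs t) (λ _ → refl)) (number-of-sets t zero))
  (trans (C0 t) (sym (C0 (suc t)))))
number-of-sets (suc t) (suc j) = trans (S-vecs t _) (trans (cong₂ _+_ (number-of-sets t j) (number-of-sets t (suc j)))
  (trans (+-comm (t C j) _) (sym (C-pascal t j))))

C2-double : ∀ t → 2 * (t C 2) + t ≡ t * t
C2-double zero    = refl
C2-double (suc t) = trans (cong (_+ suc t) (trans (C-absorb t 1) (cong (suc t *_) (nC1≡n t)))) (arith t)
  where
  arith : ∀ t → (1 + t) * t + (1 + t) ≡ (1 + t) * (1 + t)
  arith = solve-∀

C2-suc : ∀ t → suc t C 2 ≡ t C 2 + t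
C2-suc t = trans (C-pascal t 1) (cong (t C 2 +_) (nC1≡n t))

C2-+ : ∀ x y → (x + y) C 2 ≡ y C 2 + x * y + x C 2
C2-+ x y = *-cancelˡ-≡ _ _ 2 (+-cancelʳ-≡ (x + y) _ _ (begin
  2 * ((x + y) C 2) + (x + y)                        ≡⟨ C2-double (x + y) ⟩
  (x + y) * (x + y)                                  ≡⟨ one x y ⟩
  y * y + 2 * (x * y) + x * x                        ≡⟨ cong₂ (λ a b → a + 2 * (x * y) + b) (sym (C2-double y)) (sym (C2-double x)) ⟩
  (2 * (y C 2) + y) + 2 * (x * y) + (2 * (x C 2) + x) ≡⟨ two (y C 2) y (x * y) (x C 2) x ⟩
  2 * (y C 2 + x * y + x C 2) + (x + y) ∎))
  where
  open ≡-Reasoning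
  one : ∀ x y → (x + y) * (x + y) ≡ y * y + 2 * (x * y) + x * x
  one = solve-∀
  two : ∀ a y b c x → (2 * a + y) + 2 * b + (2 * c + x) ≡ 2 * (a + b + c) + (x + y)
  two = solve-∀

∑-const : ∀ K n → ∑ {K} (λ _ → n) ≡ K * n
∑-const zero    n = refl
∑-const (suc K) n = cong (n +_) (∑-const K n)

-- Double counting of the edges at one vertex: it has degree r in every class and lies on l times (a
-- choose 2) edges.
factor-count : ∀ {a l r} (F : Factorization (suc a) l r) → r * k F ≡ l * (a C 2)
factor-count {a} {l} {r} F = begin
  r * k F
    ≡⟨ trans (*-comm r (k F)) (sym (trans (S-allFin (k F) (λ _ → r)) (∑-const (k F) r))) ⟩
  S cs (λ _ → r)
    ≡⟨ S-cong cs (λ i → sym (trans (count-degree (col F) i Fin.zero) (regular F i _))) ⟩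
  S cs (λ i → S (vecs (suc a)) (λ A → ⟦ lookup A Fin.zero ⟧ * count (col F) A i))
    ≡⟨ S-swap cs (vecs (suc a)) (λ i A → ⟦ lookup A Fin.zero ⟧ * count (col F) A i) ⟩
  S (vecs (suc a)) (λ A → S cs (λ i → ⟦ lookup A Fin.zero ⟧ * count (col F) A i))
    ≡⟨ S-cong (vecs (suc a)) (λ A → trans (S-*ˡ cs ⟦ lookup A Fin.zero ⟧ (count (col F) A))
         (cong (⟦ lookup A Fin.zero ⟧ *_) (count-total (col F) A))) ⟩
  S (vecs (suc a)) (λ A → ⟦ lookup A Fin.zero ⟧ * (l * bin 0 3 (card A)))
    ≡⟨ S-vecs a (λ A → ⟦ lookup A Fin.zero ⟧ * (l * bin 0 3 (card A))) ⟩
  S (vecs a) (λ A → 1 * (l * bin 0 2 (card A))) + S (vecs a) (λ A → 0)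
    ≡⟨ cong₂ _+_ (trans (S-cong (vecs a) (λ A → *-identityˡ (l * bin 0 2 (card A)))) (S-*ˡ (vecs a) l (λ A → bin 0 2 (card A)))) (S-zero (vecs a) (λ _ → refl)) ⟩
  l * S (vecs a) (λ A → bin 0 2 (card A)) + 0
    ≡⟨ trans (+-identityʳ _) (cong (l *_) (number-of-sets a 2)) ⟩
  l * (a C 2) ∎
  where
  open ≡-Reasoning
  cs = allFin (k F)

-- Old and new colours

isOld : ∀ k {k'} → Fin (k + k') → Bool
isOld zero    i           = false
isOld (suc k) Fin.zero    = true
isOld (suc k) (Fin.suc i) = isOld k i

isOld-sum : ∀ k {k'} (g : Bool → ℕ) → ∑ (λ (i : Fin (k + k')) → g (isOld k i)) ≡ k * g true + k' * g false
isOld-sum zero    {k'} g = ∑-const k' (g false)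
isOld-sum (suc k) {k'} g = trans (cong (g true +_) (isOld-sum k g)) (sym (+-assoc (g true) _ _))

isOld-↑ˡ : ∀ {k k'} (j : Fin k) → isOld k (j Fin.↑ˡ k') ≡ true
isOld-↑ˡ Fin.zero    = refl
isOld-↑ˡ (Fin.suc j) = isOld-↑ˡ j

isOld-image : ∀ k {k'} (i : Fin (k + k')) → isOld k i ≡ true → ∃ λ j → j Fin.↑ˡ k' ≡ i
isOld-image (suc k) Fin.zero    e = Fin.zero , refl
isOld-image (suc k) (Fin.suc i) e with isOld-image k i e
... | j , eq = Fin.suc j , cong Fin.suc eq

isOld-new : ∀ k {k'} (i : Fin (k + k')) → isOld k i ≡ false → 1 ≤ k'
isOld-new zero    {suc k'} i e = s≤s z≤n
isOld-new (suc k) (Fin.suc i) e = isOld-new k i e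

-- Greedy choice: each entry is as large as its upper bound allows while the later ones can still
-- reach their lower bounds.
between : ∀ {K} (lo hi : Fin K → ℕ) E → (∀ i → lo i ≤ hi i) → ∑ lo ≤ E → E ≤ ∑ hi →
  ∃ λ (e : Fin K → ℕ) → (∀ i → lo i ≤ e i) × (∀ i → e i ≤ hi i) × ∑ e ≡ E
between {zero}  lo hi E lo≤hi lo≤E E≤hi = (λ ()) , (λ ()) , (λ ()) , sym (n≤0⇒n≡0 E≤hi)
between {suc K} lo hi E lo≤hi lo≤E E≤hi
  with between (lo ∘ Fin.suc) (hi ∘ Fin.suc) (E ∸ e₀) (lo≤hi ∘ Fin.suc) lo' hi'
  where
  tail = ∑ (lo ∘ Fin.suc)
  e₀ = hi Fin.zero ⊓ (E ∸ tail)
  tail≤E : tail ≤ E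
  tail≤E = ≤-trans (m≤n+m tail (lo Fin.zero)) lo≤E
  ∑-mono : ∀ {K} {f g : Fin K → ℕ} → (∀ i → f i ≤ g i) → ∑ f ≤ ∑ g
  ∑-mono {zero}  le = z≤n
  ∑-mono {suc K} le = +-mono-≤ (le Fin.zero) (∑-mono (le ∘ Fin.suc))
  lo' : tail ≤ E ∸ e₀
  lo' = ≤-trans (≤-reflexive (sym (m∸[m∸n]≡n tail≤E))) (∸-monoʳ-≤ E (m⊓n≤n (hi Fin.zero) (E ∸ tail)))
  hi' : E ∸ e₀ ≤ ∑ (hi ∘ Fin.suc)
  hi' with ⊓-sel (hi Fin.zero) (E ∸ tail)
  ... | inj₁ p rewrite p = m≤n+o⇒m∸n≤o E (hi Fin.zero) E≤hi
  ... | inj₂ p rewrite p = ≤-trans (≤-reflexive (m∸[m∸n]≡n tail≤E)) (∑-mono (lo≤hi ∘ Fin.suc))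
... | e' , le , ge , tot = e , le' , ge' , trans (cong (e₀ +_) tot) (m+[n∸m]≡n e₀≤E)
  where
  tail = ∑ (lo ∘ Fin.suc)
  e₀ = hi Fin.zero ⊓ (E ∸ tail)
  e₀≤E : e₀ ≤ E
  e₀≤E = ≤-trans (m⊓n≤n (hi Fin.zero) _) (m∸n≤m E tail)
  e : Fin (suc K) → ℕ
  e Fin.zero    = e₀
  e (Fin.suc i) = e' i
  le' : ∀ i → lo i ≤ e i
  le' Fin.zero    = ⊓-glb (lo≤hi Fin.zero) (m+n≤o⇒m≤o∸n (lo Fin.zero) lo≤E)
  le' (Fin.suc i) = le i
  ge' : ∀ i → e i ≤ hi i
  ge' Fin.zero    = m⊓n≤m (hi Fin.zero) _
  ge' (Fin.suc i) = ge i

copies?-0 : ∀ {n l K} (χ : Edge n l → Fin K) {i} → (∀ e → χ e ≢ i) → ∀ v w t → copies? χ i v w t ≡ 0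
copies?-0 χ {i} ne v w t with v Finₚ.<? w | w Finₚ.<? t
... | yes p | yes q = ∑-zero (λ j → cong ⟦_⟧ (⌊⌋-no (χ (mkEdge v w t p q j) Finₚ.≟ i) (ne _)))
... | yes _ | no _  = refl
... | no _  | _     = refl

copies?-∘ : ∀ {n l k K} (χ : Edge n l → Fin k) (φ : Fin k → Fin K) → Injective _≡_ _≡_ φ →
  ∀ j v w t → copies? (φ ∘ χ) (φ j) v w t ≡ copies? χ j v w t
copies?-∘ χ φ inj j v w t with v Finₚ.<? w | w Finₚ.<? t
... | yes p | yes q = ∑-cong (λ c → cong ⟦_⟧ (⌊⌋-⇔ inj (cong φ) (φ (χ (mkEdge v w t p q c)) Finₚ.≟ φ j) (χ (mkEdge v w t p q c) Finₚ.≟ j)))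
... | yes _ | no _  = refl
... | no _  | _     = refl

deg-cong : ∀ {n l k k'} (χ : Edge n l → Fin k) (χ' : Edge n l → Fin k') {i i'} →
  (∀ v w t → copies? χ i v w t ≡ copies? χ' i' v w t) → ∀ u → deg χ i u ≡ deg χ' i' u
deg-cong χ χ' {i} {i'} eq u = trans (deg-triples χ i u) (trans (∑-cong (λ v → ∑-cong (λ w → ∑-cong (λ t →
  cong (⟦ ⟦ u ∈ v , w , t ⟧ ⟧ *_) (eq v w t))))) (sym (deg-triples χ' i' u)))

deg-0 : ∀ {n l k} (χ : Edge n l → Fin k) {i} → (∀ e → χ e ≢ i) → ∀ u → deg χ i u ≡ 0
deg-0 χ {i} ne u = trans (deg-triples χ i u) (∑-zero (λ v → ∑-zero (λ w → ∑-zero (λ t →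
  trans (cong (⟦ ⟦ u ∈ v , w , t ⟧ ⟧ *_) (copies?-0 χ ne v w t)) (*-zeroʳ ⟦ ⟦ u ∈ v , w , t ⟧ ⟧)))))

-- Sufficiency

pos-∸ : ∀ x u → ℤ._-_ (ℤ.+ (x + u)) (ℤ.+ x) ≡ ℤ.+ u
pos-∸ x u = trans (ℤₚ.m-n≡m⊖n (x + u) x) (trans (ℤₚ.⊖-≥ (m≤m+n x u)) (cong ℤ.+_ (m+n∸m≡n x u)))

module Sufficiency {a q r s l : ℕ} (F : Factorization (suc a) l r)
  (1≤r : 1 ≤ r) (1≤s : 1 ≤ s) (1≤l : 1 ≤ l) (3≤a : 3 ≤ a)
  (m≤n : suc a ≤ suc q + suc a) (cond : Conditions (suc a) (suc q + suc a) r s l) where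

  private
    m n Aₘ Bₙ : ℕ
    m = suc a
    n = suc q + suc a
    Aₘ = a C 2
    Bₙ = (q + suc a) C 2

    divides-m : 3 ∣ r * m
    divides-m = proj₁ (proj₁ (proj₁ cond))
    divides-n : 3 ∣ s * n
    divides-n = proj₁ (proj₂ (proj₁ cond))
    r<s : r < s
    r<s = proj₁ (proj₁ (proj₂ cond))
    sA≤rB : s * Aₘ ≤ r * Bₙ
    sA≤rB = proj₂ (proj₁ (proj₂ cond))
    K : ℕ
    K = _∣_.quotient (proj₂ (proj₂ (proj₁ cond)))
    lB≡Ks : l * Bₙ ≡ K * s
    lB≡Ks = _∣_.equality (proj₂ (proj₂ (proj₁ cond)))

    rk : r * k F ≡ l * Aₘ
    rk = factor-count F

    instance
      rs≢0 : NonZero (r * s)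
      rs≢0 = >-nonZero (*-mono-≤ 1≤r 1≤s)

    -- `K` is the number of s-factors dictated by (i). With r k = l A and s K = l B, the second
    -- inequality of (ii) is k ≤ K.
    k≤K : k F ≤ K
    k≤K = *-cancelˡ-≤ (r * s) (begin
      r * s * k F        ≡⟨ one r s (k F) ⟩
      s * (r * k F)      ≡⟨ cong (s *_) rk ⟩
      s * (l * Aₘ)        ≡⟨ two s l Aₘ ⟩
      l * (s * Aₘ)        ≤⟨ *-monoʳ-≤ l sA≤rB ⟩
      l * (r * Bₙ)        ≡⟨ two l r Bₙ ⟩
      r * (l * Bₙ)        ≡⟨ cong (r *_) lB≡Ks ⟩
      r * (K * s)        ≡⟨ three r K s ⟩
      r * s * K ∎)
      where
      open ≤-Reasoning
      one : ∀ r s k → r * s * k ≡ s * (r * k)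
      one = solve-∀
      two : ∀ s l Aₘ → s * (l * Aₘ) ≡ l * (s * Aₘ)
      two = solve-∀
      three : ∀ r k s → r * (k * s) ≡ r * s * k
      three = solve-∀

    k' d : ℕ
    k' = K ∸ k F
    d = s ∸ r

    sK : s * (k F + k') ≡ l * Bₙ
    sK = trans (cong (s *_) (m+[n∸m]≡n k≤K)) (trans (*-comm s K) (sym lB≡Ks))

    d+r : d + r ≡ s
    d+r = m∸n+n≡m (<⇒≤ r<s)

    divides-new : 3 ∣ suc q * s + m * s
    divides-new = subst (3 ∣_) (one s (suc q) m) divides-n
      where
      one : ∀ s q m → s * (q + m) ≡ q * s + m * s
      one = solve-∀

    -- The degree sum s n of a whole factor minus r m, the degree sum of the given r-factor; both
    -- are multiples of three by (i).
    divides-old : 3 ∣ suc q * s + m * d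
    divides-old = ∣m+n∣m⇒∣n (subst (3 ∣_) (trans (cong (λ t → suc q * s + m * t) (sym d+r)) (one r m (suc q * s) d)) divides-new) divides-m
      where
      one : ∀ r m x d → x + m * (d + r) ≡ r * m + (x + m * d)
      one = solve-∀

    N N' : ℕ
    N  = _∣_.quotient divides-old
    N' = _∣_.quotient divides-new

    iii : s * Aₘ < r * Bₙ → m ≤ 2 * suc q
    iii lt = +-cancelʳ-≤ (2 * m) _ _ (begin
      m + 2 * m           ≡⟨⟩
      3 * m               ≤⟨ proj₁ (proj₂ (proj₂ cond)) lt ⟩
      2 * (suc q + m)     ≡⟨ *-distribˡ-+ 2 (suc q) m ⟩
      2 * suc q + 2 * m ∎)
      where open ≤-Reasoning

    iv : ∀ u v → 3 * m ≡ (suc q + m) + u → r * Bₙ ≡ s * Aₘ + v → u * v ≤ 3 * r * (suc q * (m C 2))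
    iv u v hu hv = ℤₚ.drop‿+≤+ (subst₂ ℤ._≤_ left (cong (λ t → ℤ.+ (3 * r * (t * (m C 2)))) (m+n∸n≡m (suc q) m))
        (proj₂ (proj₂ (proj₂ cond))))
      where
      left : ℤ._*_ (ℤ._-_ (ℤ.+ (3 * m)) (ℤ.+ n)) (ℤ._-_ (ℤ.+ (r * Bₙ)) (ℤ.+ (s * Aₘ))) ≡ ℤ.+ (u * v)
      left = trans (cong₂ ℤ._*_
          (trans (cong (λ t → ℤ._-_ (ℤ.+ t) (ℤ.+ n)) hu) (pos-∸ n u))
          (trans (cong (λ t → ℤ._-_ (ℤ.+ t) (ℤ.+ (s * Aₘ))) hv) (pos-∸ (s * Aₘ) v)))
        (sym (ℤₚ.pos-* u v))

    hB : Bₙ ≡ Aₘ + suc q * a + suc q C 2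
    hB = trans (cong (_C 2) (+-suc q a)) (C2-+ (suc q) a)

    open Counting a q r s l (k F) k' d N N' Aₘ Bₙ (m C 2) (q C 2) (suc q C 2) (suc q C 3)
      (C2-double a) (C2-suc a) (C2-double q) (C2-suc q) (C-absorb q 2) hB
      1≤r 1≤l 3≤a d+r (m<n⇒0<n∸m r<s) rk sK
      (trans (*-comm 3 N) (sym (_∣_.equality divides-old)))
      (trans (*-comm 3 N') (sym (_∣_.equality divides-new)))
      iii iv
      using (E₂; E₁; E₀; D; D'; 2≤s; D≤2N; D≤2N-new; lower; upper; degree-sum; edge-sum)

    Cols : ℕ
    Cols = k F + k'

    old? : Fin Cols → Bool
    old? = isOld (k F)

    by : ℕ → ℕ → Bool → ℕ
    by x y b = if b then x else y

    by-sum : ∀ x y → ∑ (λ i → by x y (old? i)) ≡ k F * x + k' * y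
    by-sum x y = isOld-sum (k F) (by x y)

    half-D  = halve D
    half-D' = halve D'
    h h' : ℕ
    h  = proj₁ half-D
    h' = proj₁ half-D'

    double-gap : ∀ D N → D ≤ 2 * N → 2 * (D ∸ N) ≤ D
    double-gap D N le with D ≤? N
    ... | yes D≤N rewrite m≤n⇒m∸n≡0 D≤N = z≤n
    ... | no D≰N = +-cancelʳ-≤ (2 * N) _ _ (begin
        2 * (D ∸ N) + 2 * N      ≡⟨ sym (*-distribˡ-+ 2 (D ∸ N) N) ⟩
        2 * (D ∸ N + N)          ≡⟨ cong (2 *_) (m∸n+n≡m (<⇒≤ (≰⇒> D≰N))) ⟩
        2 * D                    ≡⟨ cong (D +_) (+-identityʳ D) ⟩
        D + D                    ≤⟨ +-monoʳ-≤ D le ⟩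
        D + 2 * N ∎)
      where open ≤-Reasoning

    hN' : 3 * N' ≡ suc q * s + m * s
    hN' = trans (*-comm 3 N') (sym (_∣_.equality divides-new))

    lo≤hi : ∀ i → by (D ∸ N) (D' ∸ N') (old? i) ≤ by h h' (old? i)
    lo≤hi i = cases (old? i) refl
      where
      cases : ∀ b → old? i ≡ b → by (D ∸ N) (D' ∸ N') b ≤ by h h' b
      cases true  _  = half-≤ (proj₁ (proj₂ (proj₂ half-D))) (proj₂ (proj₂ (proj₂ half-D))) (double-gap D N D≤2N)
      cases false eq = half-≤ (proj₁ (proj₂ (proj₂ half-D'))) (proj₂ (proj₂ (proj₂ half-D')))
        (double-gap D' N' (D≤2N-new s N' ≤-refl (isOld-new (k F) i eq) hN'))

    -- e₁ = D - 2 e₂ and e₀ = N - D + e₂ must not be negative, which gives the two ends of the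
    -- interval. The totals of e₁ and e₀ then come out right by `degree-sum` and `edge-sum`.
    choice = between (λ i → by (D ∸ N) (D' ∸ N') (old? i)) (λ i → by h h' (old? i)) E₂ lo≤hi
      (≤-trans (≤-reflexive (by-sum (D ∸ N) (D' ∸ N'))) lower)
      (≤-trans (upper h _ h' _ (proj₁ (proj₂ (proj₂ half-D))) (proj₂ (proj₂ (proj₂ half-D)))
        (proj₁ (proj₂ (proj₂ half-D'))) (proj₂ (proj₂ (proj₂ half-D')))) (≤-reflexive (sym (by-sum h h'))))

    e₂ : Fin Cols → ℕ
    e₂ = proj₁ choice

    δd δD δN : Fin Cols → ℕ
    δd i = by d s (old? i)
    δD i = by D D' (old? i)
    δN i = by N N' (old? i)

    2h≤D : ∀ b → 2 * by h h' b ≤ by D D' b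
    2h≤D true  = ≤-trans (m≤m+n _ _) (≤-reflexive (sym (proj₁ (proj₂ (proj₂ half-D)))))
    2h≤D false = ≤-trans (m≤m+n _ _) (≤-reflexive (sym (proj₁ (proj₂ (proj₂ half-D')))))

    2e₂≤D : ∀ i → 2 * e₂ i ≤ δD i
    2e₂≤D i = ≤-trans (*-monoʳ-≤ 2 (proj₁ (proj₂ (proj₂ choice)) i)) (2h≤D (old? i))

    D≤N+e₂ : ∀ i → δD i ≤ δN i + e₂ i
    D≤N+e₂ i = ≤-trans (m≤n+m∸n (δD i) (δN i)) (+-monoʳ-≤ (δN i) (≤-trans (≤-reflexive (gap (old? i))) (proj₁ (proj₂ choice) i)))
      where
      gap : ∀ b → by D D' b ∸ by N N' b ≡ by (D ∸ N) (D' ∸ N') b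
      gap true  = refl
      gap false = refl

    e₁ e₀ : Fin Cols → ℕ
    e₁ i = δD i ∸ 2 * e₂ i
    e₀ i = δN i + e₂ i ∸ δD i

    e : Fin 3 → Fin Cols → ℕ
    e Fin.zero                     = e₀
    e (Fin.suc Fin.zero)           = e₁
    e (Fin.suc (Fin.suc Fin.zero)) = e₂

    ∑-+ : ∀ {K} (f g : Fin K → ℕ) → ∑ (λ i → f i + g i) ≡ ∑ f + ∑ g
    ∑-+ {K} f g = trans (sym (S-allFin K _)) (trans (S-+ (allFin K) f g) (cong₂ _+_ (S-allFin K f) (S-allFin K g)))

    total₂ : ∑ e₂ ≡ E₂
    total₂ = proj₂ (proj₂ (proj₂ choice))

    total₁ : ∑ e₁ ≡ E₁
    total₁ = +-cancelʳ-≡ (2 * E₂) _ _ (begin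
      ∑ e₁ + 2 * E₂                           ≡⟨ cong (λ t → ∑ e₁ + 2 * t) (sym total₂) ⟩
      ∑ e₁ + 2 * ∑ e₂                         ≡⟨ cong (∑ e₁ +_) (cong (∑ e₂ +_) (+-identityʳ _)) ⟩
      ∑ e₁ + (∑ e₂ + ∑ e₂)                    ≡⟨ cong (∑ e₁ +_) (sym (∑-+ e₂ e₂)) ⟩
      ∑ e₁ + ∑ (λ i → e₂ i + e₂ i)            ≡⟨ sym (∑-+ e₁ _) ⟩
      ∑ (λ i → e₁ i + (e₂ i + e₂ i))          ≡⟨ ∑-cong (λ i → trans (cong (e₁ i +_) (cong (e₂ i +_) (sym (+-identityʳ _)))) (m∸n+n≡m (2e₂≤D i))) ⟩
      ∑ δD                                    ≡⟨ trans (by-sum D D') degree-sum ⟩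
      2 * E₂ + E₁                             ≡⟨ +-comm _ E₁ ⟩
      E₁ + 2 * E₂ ∎)
      where open ≡-Reasoning

    total₀ : ∑ e₀ ≡ E₀
    total₀ = +-cancelʳ-≡ (2 * E₂ + E₁) _ _ (begin
      ∑ e₀ + (2 * E₂ + E₁)          ≡⟨ cong (∑ e₀ +_) (sym (trans (by-sum D D') degree-sum)) ⟩
      ∑ e₀ + ∑ δD                   ≡⟨ sym (∑-+ e₀ δD) ⟩
      ∑ (λ i → e₀ i + δD i)         ≡⟨ ∑-cong (λ i → m∸n+n≡m (D≤N+e₂ i)) ⟩
      ∑ (λ i → δN i + e₂ i)         ≡⟨ ∑-+ δN e₂ ⟩
      ∑ δN + ∑ e₂                   ≡⟨ cong₂ _+_ (trans (by-sum N N') edge-sum) total₂ ⟩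
      E₂ + E₁ + E₀ + E₂             ≡⟨ one E₂ E₁ E₀ ⟩
      E₀ + (2 * E₂ + E₁) ∎)
      where
      open ≡-Reasoning
      one : ∀ x y z → x + y + z + x ≡ z + (2 * x + y)
      one = solve-∀

    e-total : ∀ η → S (allFin Cols) (e η) ≡ l * (suc q C (3 ∸ toℕ η)) * (m C toℕ η)
    e-total Fin.zero = trans (S-allFin Cols e₀) (trans total₀ (sym (trans (cong (l * (suc q C 3) *_) (C0 m)) (*-identityʳ _))))
    e-total (Fin.suc Fin.zero) = trans (S-allFin Cols e₁) (trans total₁ (trans (one l m (suc q C 2))
      (cong (l * (suc q C 2) *_) (sym (nC1≡n m)))))
      where
      one : ∀ l m x → l * (m * x) ≡ l * x * m
      one = solve-∀
    e-total (Fin.suc (Fin.suc Fin.zero)) = trans (S-allFin Cols e₂) (trans total₂ (trans (sym (*-assoc l (suc q) (m C 2)))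
      (cong (λ t → l * t * (m C 2)) (sym (nC1≡n (suc q))))))

    e-degree : ∀ i → e₁ i + 2 * e₂ i ≡ m * δd i
    e-degree i = trans (m∸n+n≡m (2e₂≤D i)) (D≡ (old? i))
      where
      D≡ : ∀ b → by D D' b ≡ m * by d s b
      D≡ true  = refl
      D≡ false = refl

    e-weight : ∀ i → 3 * e₀ i + (2 * e₁ i + e₂ i) ≡ suc q * s
    -- The added terms are chosen to undo the truncated subtractions inside e₀ and e₁.
    e-weight i = +-cancelʳ-≡ (δD i + (3 * δD i + 4 * e₂ i)) _ _ (begin
      3 * e₀ i + (2 * e₁ i + e₂ i) + (δD i + (3 * δD i + 4 * e₂ i))
        ≡⟨ one (e₀ i) (e₁ i) (e₂ i) (δD i) ⟩
      3 * (e₀ i + δD i) + 2 * (e₁ i + 2 * e₂ i) + (e₂ i + δD i)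
        ≡⟨ cong₂ (λ x y → 3 * x + 2 * y + (e₂ i + δD i)) (m∸n+n≡m (D≤N+e₂ i)) (m∸n+n≡m (2e₂≤D i)) ⟩
      3 * (δN i + e₂ i) + 2 * δD i + (e₂ i + δD i)
        ≡⟨ two (δN i) (e₂ i) (δD i) ⟩
      3 * δN i + (3 * δD i + 4 * e₂ i)
        ≡⟨ cong (_+ (3 * δD i + 4 * e₂ i)) (N≡ (old? i)) ⟩
      suc q * s + δD i + (3 * δD i + 4 * e₂ i)
        ≡⟨ +-assoc (suc q * s) (δD i) _ ⟩
      suc q * s + (δD i + (3 * δD i + 4 * e₂ i)) ∎)
      where
      open ≡-Reasoning
      one : ∀ x y z D → 3 * x + (2 * y + z) + (D + (3 * D + 4 * z)) ≡ 3 * (x + D) + 2 * (y + 2 * z) + (z + D)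
      one = solve-∀
      two : ∀ N z D → 3 * (N + z) + 2 * D + (z + D) ≡ 3 * N + (3 * D + 4 * z)
      two = solve-∀
      N≡ : ∀ b → 3 * by N N' b ≡ suc q * s + by D D' b
      N≡ true  = trans (*-comm 3 N) (sym (_∣_.equality divides-old))
      N≡ false = hN'

    φ : Fin (k F) → Fin Cols
    φ j = j Fin.↑ˡ k'

    φ-injective : Injective _≡_ _≡_ φ
    φ-injective {i} {j} e = Finₚ.↑ˡ-injective k' i j e

    -- The given factorization with the new colours present but empty, so that old and new edges
    -- share one set of colours.
    χ : Edge m l → Fin Cols
    χ e = φ (col F e)

    o : Fin Cols → ℕ
    o i = by r 0 (old? i)

    χ-degree : ∀ i u → deg χ i u ≡ o i
    χ-degree i u with old? i in eq
    ... | true with isOld-image (k F) i eq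
    ... | j , refl = trans (deg-cong χ (col F) (copies?-∘ (col F) φ φ-injective j) u) (regular F j u)
    χ-degree i u | false = deg-0 χ (λ e e≡i → contradiction (trans (sym (isOld-↑ˡ (col F e))) (trans (cong old? e≡i) eq)) λ ()) u

    1≤d : ∀ b → 1 ≤ by d s b
    1≤d true  = m<n⇒0<n∸m r<s
    1≤d false = 1≤s

    d+o : ∀ b → by d s b + by r 0 b ≡ s
    d+o true  = d+r
    d+o false = +-identityʳ s

    solution = extension (finFin Cols) l s 2≤s {m} {q} δd o (count χ) e e-total e-degree e-weight (λ i → 1≤d (old? i)) (λ i → d+o (old? i))
      (count-total χ) (λ i v → trans (count-degree χ i v) (χ-degree i (opposite v)))

    x : Vec Bool (suc q + m) → Fin Cols → ℕ
    x = proj₁ solution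

    x-total : ∀ A → S (allFin Cols) (x A) ≡ l * bin 0 3 (card A)
    x-total A = Amalgams.Amalgam.multiplicity (proj₁ (proj₂ solution)) tt A

    x-keeps : ∀ A i → card A ≡ 3 → x (pad (suc q) A) i ≡ count χ A i
    x-keeps = proj₁ (proj₂ (proj₂ solution))

    G : Edge n l → Fin Cols
    G = χ⁺ {q = suc q} m≤n χ x x-total x-keeps

    G-regular : ∀ i u → deg G i u ≡ s
    G-regular i u = trans (sym (χ⁺-degree {q = suc q} m≤n χ x x-total x-keeps i u))
      (trans (sym (+-identityʳ _)) (Amalgams.Amalgam.degree (proj₁ (proj₂ solution)) i (opposite u)))

  embedding : Embeds s m≤n F
  embedding = record { k = Cols ; col = G ; regular = G-regular } ,
    χ⁺-connected {q = suc q} m≤n χ x x-total x-keeps (proj₂ (proj₂ (proj₂ solution))) ,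
    φ , φ-injective , χ⁺-extends {q = suc q} m≤n χ x x-total x-keeps

-- Necessity

-- By the reversed numbering of positions, the new vertices form the head of the vector and the old
-- ones its tail.
high : ∀ q {m} → Vec Bool (q + m) → ℕ
high zero    A       = 0
high (suc q) (b ∷ A) = ⟦ b ⟧ + high q A

low : ∀ q {m} → Vec Bool (q + m) → Vec Bool m
low zero    A       = A
low (suc q) (b ∷ A) = low q A

card-high-low : ∀ q {m} (A : Vec Bool (q + m)) → card A ≡ high q A + card (low q A)
card-high-low zero    A       = refl
card-high-low (suc q) (b ∷ A) = trans (cong (⟦ b ⟧ +_) (card-high-low q A)) (sym (+-assoc ⟦ b ⟧ _ _))

lookup-low : ∀ q {m} (A : Vec Bool (q + m)) w → lookup A (q Fin.↑ʳ w) ≡ lookup (low q A) w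
lookup-low zero    A       w = refl
lookup-low (suc q) (b ∷ A) w = lookup-low q A w

high-zero : ∀ q {m} (A : Vec Bool (q + m)) → high q A ≡ 0 → A ≡ pad q (low q A)
high-zero zero    A           e = refl
high-zero (suc q) (false ∷ A) e = cong (false ∷_) (high-zero q A e)

member-low : ∀ q {m} (A : Vec Bool (q + m)) → high q A ≡ 0 → ∀ p → lookup A p ≡ true → ∃ λ w → p ≡ q Fin.↑ʳ w
member-low zero    A           e p           _ = p , refl
member-low (suc q) (false ∷ A) e (Fin.suc p) h with member-low q A e p h
... | w , eq = w , cong Fin.suc eq

sum-high-low : ∀ q {m} j (g : Vec Bool m → ℕ) →
  S (vecs (q + m)) (λ A → bin 0 j (high q A) * g (low q A)) ≡ (q C j) * S (vecs m) g
sum-high-low zero    {m} j g = S-*ˡ (vecs m) (0 C j) g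
sum-high-low (suc q) {m} zero g = trans (S-vecs (q + m) _) (trans
  (cong₂ _+_ (S-zero (vecs (q + m)) (λ _ → refl)) (sum-high-low q zero g))
  (cong (_* S (vecs m) g) (trans (C0 q) (sym (C0 (suc q))))))
sum-high-low (suc q) {m} (suc j) g = trans (S-vecs (q + m) _) (trans
  (cong₂ _+_ (sum-high-low q j g) (sum-high-low q (suc j) g))
  (trans (sym (*-distribʳ-+ (S (vecs m) g) (q C j) (q C suc j)))
    (cong (_* S (vecs m) g) (trans (+-comm (q C j) _) (sym (C-pascal q j))))))

copies-ι : ∀ {m n l k} (m≤n : m ≤ n) (χ : Edge n l → Fin k) i {v w t : Fin m} (p : v Fin.< w) (q : w Fin.< t) p' q' →
  copies χ i (inject≤ v m≤n) (inject≤ w m≤n) (inject≤ t m≤n) p' q' ≡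
  ∑ (λ j → ⟦ ⌊ χ (ι m≤n (mkEdge v w t p q j)) Finₚ.≟ i ⌋ ⟧)
copies-ι m≤n χ i {v} {w} {t} p q p' q' = ∑-cong (λ j → cong₂
  (λ a b → ⟦ ⌊ χ (mkEdge (inject≤ v m≤n) (inject≤ w m≤n) (inject≤ t m≤n) a b j) Finₚ.≟ i ⌋ ⟧)
  (<-irrelevant p' _) (<-irrelevant q' _))

count-pad : ∀ {m q l k} (m≤n : m ≤ q + m) (χ : Edge (q + m) l → Fin k) i {v w t : Fin m} (p : v Fin.< w) (r : w Fin.< t) →
  count χ (pad q (tset v w t)) i ≡ ∑ (λ j → ⟦ ⌊ χ (ι m≤n (mkEdge v w t p r j)) Finₚ.≟ i ⌋ ⟧)
count-pad {q = q} m≤n χ i {v} {w} {t} p r = trans (cong (λ A → count χ A i) (sym (tset-inject≤ q m≤n v w t)))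
  (trans (count-tset χ i p' r') (copies-ι m≤n χ i p r p' r'))
  where
  p' = subst₂ _<_ (sym (Finₚ.toℕ-inject≤ v m≤n)) (sym (Finₚ.toℕ-inject≤ w m≤n)) p
  r' = subst₂ _<_ (sym (Finₚ.toℕ-inject≤ w m≤n)) (sym (Finₚ.toℕ-inject≤ t m≤n)) r

card-allFin : ∀ {t} (A : Vec Bool t) → S (allFin t) (λ v → ⟦ lookup A v ⟧) ≡ card A
card-allFin {t} A = trans (S-allFin t (λ v → ⟦ lookup A v ⟧)) (card-sum A)

handshake : ∀ {n l r} (F : Factorization n l r) i → 3 * S (vecs n) (λ A → count (col F) A i) ≡ r * n
handshake {n} {l} {r} F i = begin
  3 * S (vecs n) (λ A → X A)
    ≡⟨ sym (S-*ˡ (vecs n) 3 X) ⟩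
  S (vecs n) (λ A → 3 * X A)
    ≡⟨ S-cong (vecs n) supported ⟩
  S (vecs n) (λ A → card A * X A)
    ≡⟨ S-cong (vecs n) (λ A → trans (cong (_* X A) (sym (card-allFin A))) (sym (S-*ʳ (allFin n) (X A) (λ v → ⟦ lookup A v ⟧)))) ⟩
  S (vecs n) (λ A → S (allFin n) (λ v → ⟦ lookup A v ⟧ * X A))
    ≡⟨ S-swap (vecs n) (allFin n) (λ A v → ⟦ lookup A v ⟧ * X A) ⟩
  S (allFin n) (λ v → S (vecs n) (λ A → ⟦ lookup A v ⟧ * X A))
    ≡⟨ S-cong (allFin n) (λ v → trans (count-degree (col F) i v) (regular F i (opposite v))) ⟩
  S (allFin n) (λ v → r)
    ≡⟨ trans (S-allFin n (λ _ → r)) (trans (∑-const n r) (*-comm n r)) ⟩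
  r * n ∎
  where
  open ≡-Reasoning
  X : Vec Bool n → ℕ
  X A = count (col F) A i
  supported : ∀ A → 3 * X A ≡ card A * X A
  supported A with X A in eq
  ... | zero  = sym (*-zeroʳ (card A))
  ... | suc x = cong (_* suc x) (sym (count-support (col F) A i (subst (0 <_) (sym eq) (s≤s z≤n))))

module Necessity {a q r s l : ℕ} (F : Factorization (suc a) l r)
  (1≤r : 1 ≤ r) (1≤s : 1 ≤ s) (1≤l : 1 ≤ l) (3≤a : 3 ≤ a)
  (m≤n : suc a ≤ suc q + suc a) (emb : Embeds s m≤n F) where

  private
    m n Q Aₘ Bₙ : ℕ
    m = suc a
    n = suc q + suc a
    Q = suc q
    Aₘ = a C 2
    Bₙ = (q + suc a) C 2

    G : Factorization n l s
    G = proj₁ emb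
    connected : AllConnected G
    connected = proj₁ (proj₂ emb)
    φ : Fin (k F) → Fin (k G)
    φ = proj₁ (proj₂ (proj₂ emb))
    φ-injective : Injective _≡_ _≡_ φ
    φ-injective = proj₁ (proj₂ (proj₂ (proj₂ emb)))
    extends : ∀ e → col G (ι m≤n e) ≡ φ (col F e)
    extends = proj₂ (proj₂ (proj₂ (proj₂ emb)))

    X : Vec Bool n → Fin (k G) → ℕ
    X = count (col G)

    rk : r * k F ≡ l * Aₘ
    rk = factor-count F
    sk : s * k G ≡ l * Bₙ
    sk = factor-count G

    1≤Aₘ : 1 ≤ Aₘ
    1≤Aₘ = half-square-positive Aₘ 3≤a (C2-double a)

    someColour : ∀ {k} → 1 ≤ k → Fin k
    someColour {suc k} _ = Fin.zero

    -- Divisibility is read off the size of an actual factor. One exists since l ≥ 1 and m > 3 give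
    -- every old vertex an edge.
    i₀ : Fin (k F)
    i₀ = someColour (positive-factorʳ r (subst (0 <_) (sym rk) (*-mono-≤ 1≤l 1≤Aₘ)))

    admissible-m : Admissible3 m r l
    admissible-m = divides size (trans (sym (handshake F i₀)) (*-comm 3 size)) , divides (k F) (trans (sym rk) (*-comm r (k F)))
      where
      size : ℕ
      size = S (vecs m) (λ A → count (col F) A i₀)

    admissible-n : Admissible3 n s l
    admissible-n = divides size (trans (sym (handshake G (φ i₀))) (*-comm 3 size)) , divides (k G) (trans (sym sk) (*-comm s (k G)))
      where
      size : ℕ
      size = S (vecs n) (λ A → count (col G) A (φ i₀))

    position-degree : ∀ i p → S (vecs n) (λ A → ⟦ lookup A p ⟧ * X A i) ≡ s
    position-degree i p = trans (count-degree (col G) i p) (regular G i (opposite p))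

    old-counts : ∀ A₀ i → count (col F) A₀ i ≤ X (pad Q A₀) (φ i)
    old-counts A₀ i with count (col F) A₀ i in eq
    ... | zero  = z≤n
    ... | suc c = via (tset-surjective A₀ (count-support (col F) A₀ i (subst (0 <_) (sym eq) (s≤s z≤n))))
      where
      via : (∃ λ v → ∃ λ w → ∃ λ t → v Fin.< w × w Fin.< t × A₀ ≡ tset v w t) → suc c ≤ X (pad Q A₀) (φ i)
      via (v , w , t , p , p' , refl) = ≤-reflexive (trans (sym eq) (trans (count-tset (col F) i p p')
        (trans (∑-cong (λ j → cong ⟦_⟧ (⌊⌋-⇔ (λ e → trans (extends _) (cong φ e)) (λ e → φ-injective (trans (sym (extends _)) e))
          (col F (mkEdge v w t p p' j) Finₚ.≟ i) (col G (ι m≤n (mkEdge v w t p p' j)) Finₚ.≟ φ i))))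
          (sym (count-pad {q = Q} m≤n (col G) (φ i) p p')))))

    -- The contribution of `A` to the degree of `w` within one embedded r-factor; sets with new
    -- vertices contribute nothing.
    inner : Fin m → Vec Bool n → ℕ
    inner w A = bin 0 0 (high Q A) * (⟦ lookup (low Q A) w ⟧ * count (col F) (low Q A) i₀)

    inner-sum : ∀ w → S (vecs n) (inner w) ≡ r
    inner-sum w = trans (sum-high-low Q 0 (λ A₀ → ⟦ lookup A₀ w ⟧ * count (col F) A₀ i₀))
      (trans (*-identityˡ _) (trans (count-degree (col F) i₀ w) (regular F i₀ (opposite w))))

    inner≤ : ∀ w A → inner w A ≤ ⟦ lookup A (Q Fin.↑ʳ w) ⟧ * X A (φ i₀)
    inner≤ w A = cases (high Q A) refl
      where
      open ≤-Reasoning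
      cases : ∀ h → high Q A ≡ h → bin 0 0 h * (⟦ lookup (low Q A) w ⟧ * count (col F) (low Q A) i₀) ≤
        ⟦ lookup A (Q Fin.↑ʳ w) ⟧ * X A (φ i₀)
      cases (suc _) _ = z≤n
      cases zero    e = begin
        1 * (⟦ lookup (low Q A) w ⟧ * count (col F) (low Q A) i₀)
          ≡⟨ *-identityˡ (⟦ lookup (low Q A) w ⟧ * count (col F) (low Q A) i₀) ⟩
        ⟦ lookup (low Q A) w ⟧ * count (col F) (low Q A) i₀
          ≤⟨ *-monoʳ-≤ ⟦ lookup (low Q A) w ⟧ (old-counts (low Q A) i₀) ⟩
        ⟦ lookup (low Q A) w ⟧ * X (pad Q (low Q A)) (φ i₀)
          ≡⟨ cong₂ (λ b B → ⟦ b ⟧ * X B (φ i₀)) (sym (lookup-low Q A w)) (sym (high-zero Q A e)) ⟩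
        ⟦ lookup A (Q Fin.↑ʳ w) ⟧ * X A (φ i₀) ∎

    r≤s : r ≤ s
    r≤s = ≤-trans (≤-reflexive (sym (inner-sum Fin.zero))) (≤-trans (S-mono (vecs n) (inner≤ Fin.zero))
      (≤-reflexive (position-degree (φ i₀) (Q Fin.↑ʳ Fin.zero))))

    Old : Fin n → Set
    Old v = ∃ λ w → opposite v ≡ Q Fin.↑ʳ w

    -- If r = s, the embedded r-factor already uses up the degree of every old vertex.
    closed : r ≡ s → ∀ {u v} → Adjacent (col G) (φ i₀) u v → Old u → Old v
    closed r≡s {u} {v} (mkEdge x y z p p' j , c≡ , u∈ , v∈) (w , eu) =
      member-low Q V (high≡0 (high Q V) refl) (opposite v) (member v∈)
      where
      V = tset x y z
      member : ∀ {t} → t ∈ₑ mkEdge x y z p p' j → lookup V (opposite t) ≡ true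
      member {t} t∈ = trans (lookup-tset x y z t) (decide t∈)
        where
        decide : t ∈ₑ mkEdge x y z p p' j → ⟦ t ∈ x , y , z ⟧ ≡ true
        decide h with t Finₚ.≟ x | t Finₚ.≟ y | t Finₚ.≟ z | h
        ... | yes _ | _     | _     | _ = refl
        ... | no _  | yes _ | _     | _ = refl
        ... | no _  | no _  | yes _ | _ = refl
        ... | no ¬p | no ¬q | no ¬r | inj₁ e        = contradiction e ¬p
        ... | no ¬p | no ¬q | no ¬r | inj₂ (inj₁ e) = contradiction e ¬q
        ... | no ¬p | no ¬q | no ¬r | inj₂ (inj₂ e) = contradiction e ¬r
      positive : 1 ≤ X V (φ i₀)
      positive = ≤-trans (≤-trans (≤-reflexive (cong ⟦_⟧ (sym (⌊⌋-yes (col G (mkEdge x y z p p' j) Finₚ.≟ φ i₀) c≡))))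
        (≤-trans (Finite.S-term (finFin l) (λ j → ⟦ ⌊ col G (mkEdge x y z p p' j) Finₚ.≟ φ i₀ ⌋ ⟧) j) (≤-reflexive (S-allFin l _))))
        (≤-reflexive (sym (count-tset (col G) (φ i₀) p p')))
      tight : inner w V ≡ ⟦ lookup V (Q Fin.↑ʳ w) ⟧ * X V (φ i₀)
      tight = S-equality (vecs n) (inner≤ w) (≤-reflexive (trans (position-degree (φ i₀) (Q Fin.↑ʳ w)) (trans (sym r≡s) (sym (inner-sum w)))))
        (Finite.complete (finVec n) V)
      0<inner : 0 < inner w V
      0<inner = subst (0 <_) (sym tight) (≤-trans positive (≤-reflexive (trans (sym (*-identityˡ _))
        (cong (λ b → ⟦ b ⟧ * X V (φ i₀)) (sym (trans (cong (lookup V) (sym eu)) (member u∈)))))))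
      high≡0 : ∀ h → high Q V ≡ h → high Q V ≡ 0
      high≡0 zero    e = e
      high≡0 (suc h) e = contradiction (subst (λ t → 0 < bin 0 0 t * (⟦ lookup (low Q V) w ⟧ * count (col F) (low Q V) i₀)) e 0<inner) λ ()

    r≢s : r ≢ s
    r≢s r≡s = escape (walk (connected (φ i₀) (opposite (Q Fin.↑ʳ Fin.zero)) (opposite Fin.zero))
      (Fin.zero , Finₚ.opposite-involutive (Q Fin.↑ʳ Fin.zero)))
      where
      walk : ∀ {u v} → Star (Adjacent (col G) (φ i₀)) u v → Old u → Old v
      walk ε          o = o
      walk (e ◅ rest) o = walk rest (closed r≡s e o)
      escape : Old (opposite (Fin.zero {q + suc a})) → ⊥
      escape (w , e) = contradiction (trans (sym (Finₚ.opposite-involutive Fin.zero)) e) λ ()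

    r<s : r < s
    r<s = ≤∧≢⇒< r≤s r≢s

    instance
      l≢0 : NonZero l
      l≢0 = >-nonZero 1≤l
      s≢0 : NonZero s
      s≢0 = >-nonZero 1≤s

    lsA : l * (s * Aₘ) ≡ r * s * k F
    lsA = trans (one l s Aₘ) (trans (cong (s *_) (sym rk)) (two s r (k F)))
      where
      one : ∀ l s A → l * (s * A) ≡ s * (l * A)
      one = solve-∀
      two : ∀ s r k → s * (r * k) ≡ r * s * k
      two = solve-∀

    lrB : l * (r * Bₙ) ≡ r * s * k G
    lrB = trans (one l r Bₙ) (trans (cong (r *_) (sym sk)) (sym (*-assoc r s (k G))))
      where
      one : ∀ l s A → l * (s * A) ≡ s * (l * A)
      one = solve-∀

    sA≤rB : s * Aₘ ≤ r * Bₙ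
    sA≤rB = *-cancelˡ-≤ l (≤-trans (≤-reflexive lsA) (≤-trans (*-monoʳ-≤ (r * s) (Finₚ.injective⇒≤ φ-injective)) (≤-reflexive (sym lrB))))

    image : Fin (k G) → ℕ
    image i = S (allFin (k F)) (λ j → ⟦ ⌊ φ j Finₚ.≟ i ⌋ ⟧)

    -- The indicator of the colours outside the image of `φ`, kept as a number so that it can be
    -- summed and used as a factor.
    new : Fin (k G) → ℕ
    new i = 1 ∸ image i

    new-total : ℕ
    new-total = S (allFin (k G)) new

    image-total : S (allFin (k G)) image ≡ k F
    image-total = trans (S-swap (allFin (k G)) (allFin (k F)) (λ i j → ⟦ ⌊ φ j Finₚ.≟ i ⌋ ⟧))
      (trans (S-cong (allFin (k F)) (λ j → trans (S-cong (allFin (k G)) (λ i → cong ⟦_⟧ (⌊⌋-⇔ sym sym (φ j Finₚ.≟ i) (i Finₚ.≟ φ j))))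
        (Finite.once (finFin (k G)) (φ j)))) (trans (S-allFin (k F) (λ _ → 1)) (trans (∑-const (k F) 1) (*-identityʳ _))))

    k≤ : k G ≤ k F + new-total
    k≤ = begin
      k G                                        ≡⟨ sym (trans (S-allFin (k G) (λ _ → 1)) (trans (∑-const (k G) 1) (*-identityʳ _))) ⟩
      S (allFin (k G)) (λ _ → 1)                 ≤⟨ S-mono (allFin (k G)) (λ i → m≤n+m∸n 1 (image i)) ⟩
      S (allFin (k G)) (λ i → image i + new i)   ≡⟨ S-+ (allFin (k G)) image new ⟩
      S (allFin (k G)) image + new-total         ≡⟨ cong (_+ new-total) image-total ⟩
      k F + new-total ∎
      where open ≤-Reasoning

    new-avoids : ∀ i → 0 < new i → ∀ j → φ j ≢ i
    new-avoids i pos j e = contradiction (≤-trans pos (≤-reflexive (m≤n⇒m∸n≡0 1≤image))) λ ()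
      where
      1≤image : 1 ≤ image i
      1≤image = ≤-trans (≤-reflexive (cong ⟦_⟧ (sym (⌊⌋-yes (φ j Finₚ.≟ i) e))))
        (Finite.S-term (finFin (k F)) (λ j → ⟦ ⌊ φ j Finₚ.≟ i ⌋ ⟧) j)

    -- An edge with three old vertices inherits its colour through `φ`, so its colour is not new.
    new-low : ∀ i → 0 < new i → ∀ A → 0 < X A i → card (low Q A) ≤ 2
    new-low i new-i A pos = cases (card (low Q A)) refl
      where
      three : high Q A + card (low Q A) ≡ 3
      three = trans (sym (card-high-low Q A)) (count-support (col G) A i pos)
      cases : ∀ c → card (low Q A) ≡ c → card (low Q A) ≤ 2
      cases 0 e = ≤-trans (≤-reflexive e) z≤n
      cases 1 e = ≤-trans (≤-reflexive e) (s≤s z≤n)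
      cases 2 e = ≤-reflexive e
      cases (suc (suc (suc c))) e = contradiction (full (tset-surjective (low Q A) low≡3)) (λ z → contradiction (subst (0 <_) z pos) λ ())
        where
        3≤low : 3 ≤ card (low Q A)
        3≤low = ≤-trans (s≤s (s≤s (s≤s z≤n))) (≤-reflexive (sym e))
        low≡3 : card (low Q A) ≡ 3
        low≡3 = ≤-antisym (≤-trans (m≤n+m _ (high Q A)) (≤-reflexive three)) 3≤low
        high≡0 : high Q A ≡ 0
        high≡0 = +-cancelʳ-≡ 3 _ _ (trans (cong (high Q A +_) (sym low≡3)) three)
        full : (∃ λ v → ∃ λ w → ∃ λ t → v Fin.< w × w Fin.< t × low Q A ≡ tset v w t) → X A i ≡ 0
        full (v , w , t , p , p' , e) = trans (cong (λ B → X B i) (trans (high-zero Q A high≡0) (cong (pad Q) e)))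
          (trans (count-pad {q = Q} m≤n (col G) i p p') (∑-zero (λ j → cong ⟦_⟧ (⌊⌋-no (col G (ι m≤n (mkEdge v w t p p' j)) Finₚ.≟ i)
            (λ h → new-avoids i new-i _ (trans (sym (extends _)) h))))))

    edges doubles : Fin (k G) → ℕ
    edges i   = S (vecs n) (λ A → X A i)
    doubles i = S (vecs n) (λ A → bin 0 2 (card (low Q A)) * X A i)

    low-degrees : ∀ i → S (vecs n) (λ A → card (low Q A) * X A i) ≡ m * s
    low-degrees i = begin
      S (vecs n) (λ A → card (low Q A) * X A i)
        ≡⟨ S-cong (vecs n) (λ A → trans (cong (_* X A i) (sym (card-allFin (low Q A))))
             (sym (S-*ʳ (allFin m) (X A i) (λ w → ⟦ lookup (low Q A) w ⟧)))) ⟩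
      S (vecs n) (λ A → S (allFin m) (λ w → ⟦ lookup (low Q A) w ⟧ * X A i))
        ≡⟨ S-swap (vecs n) (allFin m) (λ A w → ⟦ lookup (low Q A) w ⟧ * X A i) ⟩
      S (allFin m) (λ w → S (vecs n) (λ A → ⟦ lookup (low Q A) w ⟧ * X A i))
        ≡⟨ S-cong (allFin m) (λ w → trans (S-cong (vecs n) (λ A → cong (λ b → ⟦ b ⟧ * X A i) (sym (lookup-low Q A w))))
             (position-degree i (Q Fin.↑ʳ w))) ⟩
      S (allFin m) (λ _ → s)
        ≡⟨ trans (S-allFin m (λ _ → s)) (∑-const m s) ⟩
      m * s ∎
      where open ≡-Reasoning

    -- The function `g` is where the two conditions part: the constant two leads to (iii), and one
    -- plus the indicator of exactly two old vertices leads to (iv).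
    new-bound : ∀ i → 0 < new i → (g : ℕ → ℕ) → (∀ c → c ≤ 2 → c ≤ g c) →
      m * s ≤ S (vecs n) (λ A → g (card (low Q A)) * X A i)
    new-bound i new-i g c≤g = ≤-trans (≤-reflexive (sym (low-degrees i))) (S-mono (vecs n) bound)
      where
      bound : ∀ A → card (low Q A) * X A i ≤ g (card (low Q A)) * X A i
      bound A with X A i in eq
      ... | zero  = ≤-trans (≤-reflexive (*-zeroʳ (card (low Q A)))) z≤n
      ... | suc x = *-monoˡ-≤ (suc x) (c≤g _ (new-low i new-i A (subst (0 <_) (sym eq) (s≤s z≤n))))

    iii : s * Aₘ < r * Bₙ → 3 * m ≤ 2 * n
    iii lt = conclude (S-positive (allFin (k G)) new 0<new-total)
      where
      kF<kG : k F < k G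
      kF<kG = *-cancelˡ-< (r * s) _ _ (≤-trans (≤-reflexive (cong suc (sym lsA))) (≤-trans (*-monoʳ-< l lt) (≤-reflexive lrB)))
      0<new-total : 0 < new-total
      0<new-total = +-cancelˡ-< (k F) _ _ (≤-trans (≤-reflexive (cong suc (+-identityʳ (k F)))) (≤-trans kF<kG k≤))
      conclude : (∃ λ i → 0 < new i) → 3 * m ≤ 2 * n
      conclude (i , new-i) = *-cancelʳ-≤ (3 * m) (2 * n) s (begin
        3 * m * s                          ≡⟨ *-assoc 3 m s ⟩
        3 * (m * s)                        ≤⟨ *-monoʳ-≤ 3 (new-bound i new-i (λ _ → 2) (λ _ c≤2 → c≤2)) ⟩
        3 * S (vecs n) (λ A → 2 * X A i)   ≡⟨ cong (3 *_) (S-*ˡ (vecs n) 2 (λ A → X A i)) ⟩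
        3 * (2 * edges i)                  ≡⟨ one (edges i) ⟩
        2 * (3 * edges i)                  ≡⟨ cong (2 *_) (handshake G i) ⟩
        2 * (s * n)                        ≡⟨ two s n ⟩
        2 * n * s ∎)
        where
        open ≤-Reasoning
        one : ∀ x → 3 * (2 * x) ≡ 2 * (3 * x)
        one = solve-∀
        two : ∀ s n → 2 * (s * n) ≡ 2 * n * s
        two = solve-∀

    doubles-bound : ∀ i → 0 < new i → 3 * (m * s) ≤ s * n + 3 * doubles i
    doubles-bound i new-i = begin
      3 * (m * s)
        ≤⟨ *-monoʳ-≤ 3 (new-bound i new-i (λ c → 1 + bin 0 2 c) small) ⟩
      3 * S (vecs n) (λ A → (1 + bin 0 2 (card (low Q A))) * X A i)
        ≡⟨ cong (3 *_) (S-+ (vecs n) (λ A → X A i) (λ A → bin 0 2 (card (low Q A)) * X A i)) ⟩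
      3 * (edges i + doubles i)
        ≡⟨ *-distribˡ-+ 3 (edges i) (doubles i) ⟩
      3 * edges i + 3 * doubles i
        ≡⟨ cong (_+ 3 * doubles i) (handshake G i) ⟩
      s * n + 3 * doubles i ∎
      where
      open ≤-Reasoning
      small : ∀ c → c ≤ 2 → c ≤ 1 + bin 0 2 c
      small 0 _ = z≤n
      small 1 _ = s≤s z≤n
      small 2 _ = ≤-refl
      small (suc (suc (suc c))) (s≤s (s≤s ()))

    doubles-total : S (allFin (k G)) doubles ≡ l * (Q * (m C 2))
    doubles-total = begin
      S (allFin (k G)) doubles
        ≡⟨ S-swap (allFin (k G)) (vecs n) (λ i A → bin 0 2 (card (low Q A)) * X A i) ⟩
      S (vecs n) (λ A → S (allFin (k G)) (λ i → bin 0 2 (card (low Q A)) * X A i))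
        ≡⟨ S-cong (vecs n) (λ A → trans (S-*ˡ (allFin (k G)) (bin 0 2 (card (low Q A))) (X A))
             (trans (cong (bin 0 2 (card (low Q A)) *_) (trans (count-total (col G) A) (cong (λ c → l * bin 0 3 c) (card-high-low Q A))))
               (select (card (low Q A)) (high Q A)))) ⟩
      S (vecs n) (λ A → l * (bin 0 1 (high Q A) * bin 0 2 (card (low Q A))))
        ≡⟨ S-*ˡ (vecs n) l (λ A → bin 0 1 (high Q A) * bin 0 2 (card (low Q A))) ⟩
      l * S (vecs n) (λ A → bin 0 1 (high Q A) * bin 0 2 (card (low Q A)))
        ≡⟨ cong (l *_) (trans (sum-high-low Q 1 (λ A₀ → bin 0 2 (card A₀))) (cong₂ _*_ (nC1≡n Q) (number-of-sets m 2))) ⟩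
      l * (Q * (m C 2)) ∎
      where
      open ≡-Reasoning
      select : ∀ c h → bin 0 2 c * (l * bin 0 3 (h + c)) ≡ l * (bin 0 1 h * bin 0 2 c)
      select 0 h = sym (trans (cong (l *_) (*-zeroʳ (bin 0 1 h))) (*-zeroʳ l))
      select 1 h = sym (trans (cong (l *_) (*-zeroʳ (bin 0 1 h))) (*-zeroʳ l))
      select 2 h = trans (*-identityˡ _) (cong (l *_) (trans (cong (bin 0 3) (+-comm h 2)) (sym (*-identityʳ _))))
      select (suc (suc (suc c))) h = sym (trans (cong (l *_) (*-zeroʳ (bin 0 1 h))) (*-zeroʳ l))

    -- Each new colour needs at least s u / 3 edges with two old vertices, there are at least l v /
    -- (r s) new colours, and all colours together have only l Q (m choose 2) such edges.
    iv-ℕ : ∀ u v → 3 * m ≡ n + u → r * Bₙ ≡ s * Aₘ + v → u * v ≤ 3 * r * (Q * (m C 2))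
    iv-ℕ u v hu hv = *-cancelˡ-≤ l (begin
      l * (u * v)                          ≡⟨ one l u v ⟩
      u * (l * v)                          ≤⟨ *-monoʳ-≤ u lv≤ ⟩
      u * (r * s * new-total)              ≡⟨ two u r s new-total ⟩
      r * (new-total * (s * u))            ≤⟨ *-monoʳ-≤ r new≤ ⟩
      r * (3 * (l * (Q * (m C 2))))        ≡⟨ three r l (Q * (m C 2)) ⟩
      l * (3 * r * (Q * (m C 2))) ∎)
      where
      open ≤-Reasoning
      one : ∀ l u v → l * (u * v) ≡ u * (l * v)
      one = solve-∀
      two : ∀ u r s x → u * (r * s * x) ≡ r * (x * (s * u))
      two = solve-∀
      three : ∀ r l x → r * (3 * (l * x)) ≡ l * (3 * r * x)
      three = solve-∀
      lv≤ : l * v ≤ r * s * new-total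
      lv≤ = +-cancelˡ-≤ (r * s * k F) _ _ (begin
        r * s * k F + l * v                 ≡⟨ cong (_+ l * v) (sym lsA) ⟩
        l * (s * Aₘ) + l * v                ≡⟨ sym (*-distribˡ-+ l (s * Aₘ) v) ⟩
        l * (s * Aₘ + v)                    ≡⟨ cong (l *_) (sym hv) ⟩
        l * (r * Bₙ)                        ≡⟨ lrB ⟩
        r * s * k G                         ≤⟨ *-monoʳ-≤ (r * s) k≤ ⟩
        r * s * (k F + new-total)           ≡⟨ *-distribˡ-+ (r * s) (k F) new-total ⟩
        r * s * k F + r * s * new-total ∎)
      su≤ : ∀ i → new i * (s * u) ≤ 3 * doubles i
      su≤ i with new i in eq
      ... | zero  = z≤n
      ... | suc x = ≤-trans (*-monoˡ-≤ (s * u) (≤-trans (≤-reflexive (sym eq)) (m∸n≤m 1 (image i))))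
        (≤-trans (≤-reflexive (*-identityˡ (s * u))) (+-cancelˡ-≤ (s * n) _ _ (begin
          s * n + s * u              ≡⟨ sym (*-distribˡ-+ s n u) ⟩
          s * (n + u)                ≡⟨ cong (s *_) (sym hu) ⟩
          s * (3 * m)                ≡⟨ four s m ⟩
          3 * (m * s)                ≤⟨ doubles-bound i (subst (0 <_) (sym eq) (s≤s z≤n)) ⟩
          s * n + 3 * doubles i ∎)))
        where
        four : ∀ s m → s * (3 * m) ≡ 3 * (m * s)
        four = solve-∀
      new≤ : new-total * (s * u) ≤ 3 * (l * (Q * (m C 2)))
      new≤ = begin
        new-total * (s * u)                           ≡⟨ sym (S-*ʳ (allFin (k G)) (s * u) new) ⟩
        S (allFin (k G)) (λ i → new i * (s * u))      ≤⟨ S-mono (allFin (k G)) su≤ ⟩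
        S (allFin (k G)) (λ i → 3 * doubles i)        ≡⟨ S-*ˡ (allFin (k G)) 3 doubles ⟩
        3 * S (allFin (k G)) doubles                  ≡⟨ cong (3 *_) doubles-total ⟩
        3 * (l * (Q * (m C 2))) ∎

    v : ℕ
    v = r * Bₙ ∸ s * Aₘ

    hv : r * Bₙ ≡ s * Aₘ + v
    hv = sym (m+[n∸m]≡n sA≤rB)

    difference : ℤ._-_ (ℤ.+ (r * Bₙ)) (ℤ.+ (s * Aₘ)) ≡ ℤ.+ v
    difference = trans (cong (λ t → ℤ._-_ (ℤ.+ t) (ℤ.+ (s * Aₘ))) hv) (pos-∸ (s * Aₘ) v)

    iv : ℤ._≤_ (ℤ._*_ (ℤ._-_ (ℤ.+ (3 * m)) (ℤ.+ n)) (ℤ._-_ (ℤ.+ (r * Bₙ)) (ℤ.+ (s * Aₘ))))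
      (ℤ.+ (3 * r * ((n ∸ m) * (m C 2))))
    iv with n ≤? 3 * m
    ... | yes n≤3m = subst₂ ℤ._≤_ (sym left) (cong (λ t → ℤ.+ (3 * r * (t * (m C 2)))) (sym (m+n∸n≡m Q m)))
        (ℤ.+≤+ (iv-ℕ (3 * m ∸ n) v hu hv))
      where
      hu : 3 * m ≡ n + (3 * m ∸ n)
      hu = sym (m+[n∸m]≡n n≤3m)
      left : ℤ._*_ (ℤ._-_ (ℤ.+ (3 * m)) (ℤ.+ n)) (ℤ._-_ (ℤ.+ (r * Bₙ)) (ℤ.+ (s * Aₘ))) ≡ ℤ.+ ((3 * m ∸ n) * v)
      left = trans (cong₂ ℤ._*_ (trans (cong (λ t → ℤ._-_ (ℤ.+ t) (ℤ.+ n)) hu) (pos-∸ n (3 * m ∸ n))) difference)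
        (sym (ℤₚ.pos-* (3 * m ∸ n) v))
    -- The first factor is negative here and the second is not, so the product is at most zero.
    ... | no n≰3m = ℤₚ.≤-trans (subst (λ t → ℤ._≤_ (ℤ._*_ (ℤ._-_ (ℤ.+ (3 * m)) (ℤ.+ n)) t) (ℤ.+ 0)) (sym difference)
        (ℤₚ.*-monoʳ-≤-nonNeg (ℤ.+ v) (ℤₚ.i≤j⇒i-j≤0 (ℤ.+≤+ (<⇒≤ (≰⇒> n≰3m)))))) (ℤ.+≤+ z≤n)

  conditions : Conditions m n r s l
  conditions = (admissible-m , admissible-n) , (r<s , sA≤rB) , iii , iv

theorem8p5 : (m n r s l : ℕ) → 1 ≤ r → 1 ≤ s → 1 ≤ l →
    (3<m : 3 < m) → (m<n : m < n) → (F : Factorization m l r) →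
    Embeds s (<⇒≤ m<n) F ⇔ Conditions m n r s l
theorem8p5 (suc a) n r s l 1≤r 1≤s 1≤l 3<m m<n F with m≤n⇒∃[o]m+o≡n m<n
-- The order of summands in n = suc q + suc a matches the vectors, in which the suc q new vertices
-- precede the old ones.
... | q , e with trans (cong suc (+-comm q (suc a))) e
... | refl = mk⇔
  (Necessity.conditions F 1≤r 1≤s 1≤l (s≤s⁻¹ 3<m) (<⇒≤ m<n))
  (Sufficiency.embedding F 1≤r 1≤s 1≤l (s≤s⁻¹ 3<m) (<⇒≤ m<n))
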